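{- There is a deterministic static data structure for the leaf-to-ancestor minimum query problem in the oracle model with the following guarantee. For every rooted tree $T$ with $n$ nodes and height $h\ge 2$, with hidden edge values accessible only through the comparison oracle, the data structure is built using $O(n\log h)$ preprocessing time, $O(n\log h)$ space and $O(n\log h)$ oracle calls. After this preprocessing, every query $(v,u)$, where $v$ is a leaf of $T$ and $u$ is an ancestor of $v$, is answered correctly in $O(1)$ worst-case time with zero oracle calls at query time. The constants hidden in the $O(\cdot)$ notation are absolute (independent of $T$, $n$, $h$ and the edge values).
   Context: Problem. The input is a rooted tree $T$ (known explicitly to the algorithm) in which each edge $e$ has a hidden value $w(e)$ from a totally ordered set (e.g. the reals); equal values may occur. The values are accessible only through a black-box function $\mathrm{Oracle}(e,f)$, which takes two edge identifiers and returns true if and only if $w(e)<w(f)$. A leaf-to-ancestor minimum query is a pair $(v,u)$ with $v$ a leaf and $u$ an ancestor of $v$; a correct answer is (the identifier of) an edge of minimum value among the edges on the path of $T$ from $v$ to $u$. If $u=v$, the path is empty and the correct answer is a special symbol EMPTY. The depth of a vertex is the number of edges on the path from the root to it (so the root has depth $0$), and the height of $T$ is the maximum depth of a vertex. Model of computation. Time is measured in the word RAM model (a random-access machine performing arithmetic and bitwise operations on words of $w$ bits in unit time, with words large enough to hold a node identifier); each oracle call costs unit time and oracle calls are also counted separately. Space is measured in words. The data structure first preprocesses $T$ (with oracle access) and afterwards answers an arbitrary online sequence of queries. -}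

module Defs where

open import Level using (Level)
open import Data.Bool using (Bool; if_then_else_; _∧_; _∨_; _xor_)
open import Data.Nat using (ℕ; zero; suc; _+_; _*_; _∸_; _^_; _/_; _%_; _≤_; _<_; _<ᵇ_; _≡ᵇ_)
open import Data.Nat.Properties using (m^n≢0; _<?_)
open import Data.Fin using (Fin; toℕ; fromℕ<)
open import Data.List using (List; []; _∷_; map; allFin)
open import Data.List.Extrema.Nat using (max)
open import Data.List.Membership.Propositional using (_∈_)
open import Data.Maybe using (Maybe; just; nothing)
open import Data.Product using (∃-syntax; _×_)
open import Data.Unit using (⊤)
open import Relation.Nullary using (¬_; does; yes; no)
open import Relation.Binary.Bundles using (StrictTotalOrder)
open import Relation.Binary.PropositionalEquality using (_≡_; _≢_)

------------------------------------------------------------------------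
-- Rooted trees

-- Ascent root parent v u: the path of the tree leading from v up to u.
-- As no step leaves the root, there is at most one for given v and u, and
-- it exists exactly when u is an ancestor of v (v itself included).

data Ascent {n : ℕ} (root : Fin n) (parent : Fin n → Fin n) : Fin n → Fin n → Set where
  []  : ∀ {v} → Ascent root parent v v
  _∷_ : ∀ {v u} → v ≢ root → Ascent root parent (parent v) u → Ascent root parent v u

-- The nodes are labelled 0, …, n-1 in an arbitrary order.  The parent of
-- the root is only a convention (the root has no parent edge).

record RootedTree (n : ℕ) : Set where
  field
    root        : Fin n
    parent      : Fin n → Fin n
    parent-root : parent root ≡ root
    toRoot      : ∀ v → Ascent root parent v root

  Path : Fin n → Fin n → Set
  Path = Ascent root parent

  -- An edge is named by its lower endpoint.
  record Edge : Set where
    constructor edge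
    field
      child    : Fin n
      .nonroot : child ≢ root

  edgeId : Edge → ℕ
  edgeId e = toℕ (Edge.child e)

  edges : ∀ {v u} → Path v u → List Edge
  edges []              = []
  edges (_∷_ {v} v≢r p) = edge v v≢r ∷ edges p

  pathLength : ∀ {v u} → Path v u → ℕ
  pathLength []      = 0
  pathLength (_ ∷ p) = suc (pathLength p)

  depth : Fin n → ℕ
  depth v = pathLength (toRoot v)

  height : ℕ
  height = max 0 (map depth (allFin n))

  IsLeaf : Fin n → Set
  IsLeaf v = ∀ x → x ≢ root → parent x ≢ v

  record Query : Set where
    field
      leaf     : Fin n
      isLeaf   : IsLeaf leaf
      ancestor : Fin n
      path     : Path leaf ancestor

open RootedTree public using (Edge; Query; height)

------------------------------------------------------------------------
-- Words of w bits, represented by the naturals below 2 ^ w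

wrap : ℕ → ℕ → ℕ
wrap w a = _%_ a (2 ^ w) {{m^n≢0 2 w}}

bit : Bool → ℕ
bit b = if b then 1 else 0

odd : ℕ → Bool
odd a = a % 2 ≡ᵇ 1

bitwise : (Bool → Bool → Bool) → ℕ → ℕ → ℕ → ℕ
bitwise f zero    a b = 0
bitwise f (suc w) a b = bit (f (odd a) (odd b)) + 2 * bitwise f w (a / 2) (b / 2)

data BinOp : Set where
  add sub mul div mod and or xor shl shr lt eq : BinOp

-- Arithmetic is modulo 2 ^ w; x div 0 = 0 and x mod 0 = x.
evalOp : ℕ → BinOp → ℕ → ℕ → ℕ
evalOp w add a b       = wrap w (a + b)
evalOp w sub a b       = wrap w ((a + 2 ^ w) ∸ b)
evalOp w mul a b       = wrap w (a * b)
evalOp w div a zero    = 0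
evalOp w div a (suc b) = a / suc b
evalOp w mod a zero    = a
evalOp w mod a (suc b) = a % suc b
evalOp w and a b       = bitwise _∧_ w a b
evalOp w or  a b       = bitwise _∨_ w a b
evalOp w xor a b       = bitwise _xor_ w a b
evalOp w shl a b       = wrap w (a * 2 ^ b)
evalOp w shr a b       = _/_ a (2 ^ b) {{m^n≢0 2 b}}
evalOp w lt  a b       = bit (a <ᵇ b)
evalOp w eq  a b       = bit (a ≡ᵇ b)

------------------------------------------------------------------------
-- Word RAM programs.  Registers are named in the program text, so a program
-- uses a constant number of them; all other storage is the addressed memory.

Reg : Set
Reg = ℕ

infixr 5 _⨾_

data Program : Set where
  nop    : Program
  const  : Reg → ℕ → Program
  move   : Reg → Reg → Program
  op     : BinOp → Reg → Reg → Reg → Program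
  load   : Reg → Reg → Program
  store  : Reg → Reg → Program
  oracle : Reg → Reg → Reg → Program
  _⨾_    : Program → Program → Program
  ifnz   : Reg → Program → Program → Program
  while  : Reg → Program → Program

record State : Set where
  constructor ⟨_,_⟩
  field
    reg : Reg → ℕ
    mem : ℕ → ℕ

open State public

infixl 6 _[_↦_]

_[_↦_] : (ℕ → ℕ) → ℕ → ℕ → (ℕ → ℕ)
(f [ i ↦ x ]) j = if i ≡ᵇ j then x else f j

setReg : Reg → ℕ → State → State
setReg r x s = ⟨ reg s [ r ↦ x ] , mem s ⟩

setMem : ℕ → ℕ → State → State
setMem a x s = ⟨ reg s , mem s [ a ↦ x ] ⟩

-- A machine with w-bit words and memory cells 0, …, S-1.
-- Run P s s′ t o: started in s, the program P halts in s′ after t unit-time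
-- steps (instructions and tests), o of which are oracle calls.  An access
-- outside the memory, or an oracle call on a word that is no edge
-- identifier, has no run.

module Machine (w S : ℕ) {E : Set} (ident : E → ℕ) (less : E → E → Bool) where

  data Run : Program → State → State → ℕ → ℕ → Set where

    nop    : ∀ {s} → Run nop s s 1 0

    const  : ∀ {s r k} → Run (const r k) s (setReg r (wrap w k) s) 1 0

    move   : ∀ {s r a} → Run (move r a) s (setReg r (reg s a) s) 1 0

    op     : ∀ {s f r a b} →
             Run (op f r a b) s (setReg r (evalOp w f (reg s a) (reg s b)) s) 1 0

    load   : ∀ {s r a} → reg s a < S →
             Run (load r a) s (setReg r (mem s (reg s a)) s) 1 0

    store  : ∀ {s a r} → reg s a < S →
             Run (store a r) s (setMem (reg s a) (reg s r) s) 1 0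

    oracle : ∀ {s r a b} (e f : E) → reg s a ≡ ident e → reg s b ≡ ident f →
             Run (oracle r a b) s (setReg r (bit (less e f)) s) 1 1

    _⨾_    : ∀ {P Q s s′ s″ t t′ o o′} →
             Run P s s′ t o → Run Q s′ s″ t′ o′ →
             Run (P ⨾ Q) s s″ (t + t′) (o + o′)

    ifnz-≢ : ∀ {r P Q s s′ t o} → reg s r ≢ 0 → Run P s s′ t o →
             Run (ifnz r P Q) s s′ (1 + t) o

    ifnz-≡ : ∀ {r P Q s s′ t o} → reg s r ≡ 0 → Run Q s s′ t o →
             Run (ifnz r P Q) s s′ (1 + t) o

    loop   : ∀ {r P s s′ s″ t t′ o o′} → reg s r ≢ 0 →
             Run P s s′ t o → Run (while r P) s′ s″ t′ o′ →
             Run (while r P) s s″ (1 + (t + t′)) (o + o′)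

    exit   : ∀ {r P s} → reg s r ≡ 0 → Run (while r P) s s 1 0

------------------------------------------------------------------------
-- Data structures for leaf-to-ancestor minimum queries

record DataStructure : Set where
  field
    preprocess : Program
    query      : Program

-- Register 0 holds n and cell i < n holds the parent of node i (the root
-- being its own parent); everything else is zero.
initial : ∀ {n} → RootedTree n → State
initial {n} T = ⟨ (λ _ → 0) [ 0 ↦ n ] , parents ⟩
  where
  open RootedTree T
  parents : ℕ → ℕ
  parents i with i <? n
  ... | yes i<n = toℕ (parent (fromℕ< i<n))
  ... | no  _   = 0

module OracleModel {a ℓ₁ ℓ₂ : Level} (O : StrictTotalOrder a ℓ₁ ℓ₂)
                   {n : ℕ} (T : RootedTree n)
                   (value : Edge T → StrictTotalOrder.Carrier O) where

  open RootedTree T hiding (Edge; Query)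
  private module O = StrictTotalOrder O

  less : Edge T → Edge T → Bool
  less e f = does (value e O.<? value f)

  module RAM (w S : ℕ) = Machine w S edgeId less

  IsMinimum : Edge T → List (Edge T) → Set ℓ₂
  IsMinimum e es = e ∈ es × (∀ f → f ∈ es → ¬ (value f O.< value e))

  -- The answer nothing stands for EMPTY.
  data Correct : ∀ {v u} → Path v u → Maybe (Edge T) → Set ℓ₂ where
    empty   : ∀ {v} → Correct {v} [] nothing
    minimum : ∀ {v u} {v≢r : v ≢ root} {p : Path (parent v) u} {e} →
              IsMinimum e (edges (v≢r ∷ p)) → Correct (v≢r ∷ p) (just e)

  -- EMPTY is the word n, which identifies no node.
  encode : Maybe (Edge T) → ℕ
  encode nothing  = n
  encode (just e) = edgeId e

  pose : Query T → State → State
  pose q s = setReg 1 (toℕ (Query.ancestor q)) (setReg 0 (toℕ (Query.leaf q)) s)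

  -- Starting from s, the queries are posed one after the other, each run
  -- starting in the state left by its predecessor; each takes at most c
  -- steps and no oracle call, and leaves a correct answer in register 0.
  AnswersAll : (w S c : ℕ) → Program → State → List (Query T) → Set ℓ₂
  AnswersAll w S c Q s []       = Level.Lift ℓ₂ ⊤
  AnswersAll w S c Q s (q ∷ qs) =
    ∃[ s′ ] ∃[ t ] ∃[ ans ]
      RAM.Run w S Q (pose q s) s′ t 0 ×
      t ≤ c ×
      reg s′ 0 ≡ encode ans ×
      Correct (Query.path q) ans ×
      AnswersAll w S c Q s′ qs

{-# OPTIONS --safe #-}
module Submission where

-- Binary lifting yields, for every node v and every level k, the 2 ^ k-th
-- ancestor of v and the lightest of the lowest 2 ^ k edges above v, and from
-- these, for every edge, its nearest lighter ancestor edge.  For a query (v , u)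
-- of distance d with 2 ^ j ≤ d < 2 ^ (j + 1), let e be the lightest of the lowest
-- 2 ^ j edges above v.  If no edge between e and u is lighter than e, then e is
-- the answer; this is read off the depth of the nearest lighter ancestor of e.
-- Otherwise the answer is the lightest edge between z and u, for any z on the path
-- less than 2 ^ j edges above v.  For j = k + 1 take as z the lowest ancestor at
-- least 2 ^ k edges above v whose depth is a multiple of 2 ^ k, and tabulate the
-- minima from z upwards over 3 · 2 ^ k edges.  Such a z is the top of a path of
-- 2 ^ k nodes, and these paths are disjoint, so that all tables of one level
-- take at most 3 n cells.

open import Defs
open import Level using (Level; lift)
open import Data.Bool using (Bool; true; false; T; _∧_)
open import Data.Empty using (⊥; ⊥-elim; ⊥-elim-irr)
open import Data.Fin using (Fin; toℕ; fromℕ<; combine; remQuot)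
import Data.Fin.Properties as Fin
open import Data.List using (List; []; _∷_; map; allFin)
open import Data.List.Extrema.Nat using (xs≤max; max≤v⁺)
open import Data.List.Membership.Propositional using (_∈_)
open import Data.List.Membership.Propositional.Properties using (∈-allFin; ∈-map⁺; ∈-map⁻)
open import Data.List.Relation.Unary.All using () renaming (lookup to all-lookup; tabulate to all-tabulate)
open import Data.List.Relation.Unary.Any using (here; there)
open import Data.Maybe using (Maybe; just; nothing)
open import Data.Nat hiding (less; compare)
open import Data.Nat.DivMod hiding (_div_; _mod_)
open import Data.Nat.Divisibility using (_∣_; divides; quotient; m%n≡0⇒n∣m)
open import Data.Nat.Induction using (<-wellFounded)
open import Data.Nat.Logarithm using (⌊log₂_⌋; ⌊log₂⌋-mono-≤; ⌊log₂⌊n/2⌋⌋≡⌊log₂n⌋∸1; ⌊log₂[2^n]⌋≡n)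
open import Data.Nat.Properties
open import Data.Nat.Solver using (module +-*-Solver)
open import Data.Product using (_×_; _,_; proj₁; proj₂; ∃-syntax; uncurry)
open import Data.Sum using (_⊎_; inj₁; inj₂; [_,_]′)
open import Data.Unit using (tt)
open import Function.Definitions using (Injective)
open import Induction.WellFounded using (Acc; acc)
open import Relation.Binary.Bundles using (StrictTotalOrder)
open import Relation.Binary.Definitions using (tri<; tri≈; tri>)
open import Relation.Binary.PropositionalEquality
open import Relation.Nullary using (¬_; Dec; yes; no)
open import Relation.Nullary.Decidable using (dec-true; dec-false)

-- Ancestors in a weighted tree

-- The lightest low edge e and the lightest edge between z and u together cover the path, but
-- choosing between them by value would take an oracle call, and queries have none. The nearest
-- lighter ancestor turns this choice into a comparison of two depths. With a second window of 2 ^ j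
-- edges ending at u, as in a sparse table for arrays, the start would depend on both v and u, and
-- finding it would be a level ancestor query. The node z depends on v and k alone, so it can be
-- tabulated, at the price of an array for each z. For these arrays to be affordable z must not be
-- too low: if v itself were allowed, every leaf of suitable depth could claim 3 · 2 ^ k cells. It
-- must not be too high either: the edges below z are discarded unseen, which is justified only
-- because they all lie in the window in which e is lightest, while something lighter than e lies
-- further up. A distance of at least 2 ^ k and less than 2 ^ (k + 1) meets both demands. The number
-- of levels depends on the height only and each costs O(n), whence log h instead of log n.

divMod-unique : ∀ p .{{_ : NonZero p}} {i j q r} → i < p → j < p → i + q * p ≡ j + r * p → i ≡ j × q * p ≡ r * p
divMod-unique p {i} {j} {q} {r} i<p j<p e≡ = i≡j , +-cancelˡ-≡ i (q * p) (r * p) (trans e≡ (cong (_+ r * p) (sym i≡j)))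
  where
  rem : ∀ {i} q → i < p → (i + q * p) % p ≡ i
  rem {i} q i<p = trans ([m+kn]%n≡m%n i q p) (m<n⇒m%n≡m i<p)
  i≡j : i ≡ j
  i≡j = trans (sym (rem q i<p)) (trans (cong (_% p) e≡) (rem r j<p))

-- Nodes are the naturals below size; elsewhere the fields are arbitrary.
-- lighter compares the edges above two nodes.
record WeightedTree : Set where
  field
    size root  : ℕ
    parent     : ℕ → ℕ
    depth      : ℕ → ℕ
    lighter         : ℕ → ℕ → Bool
    root<size  : root < size
    parent<    : ∀ {v} → v < size → parent v < size
    parent-root : parent root ≡ root
    parent-fix : ∀ {v} → v < size → parent v ≡ v → v ≡ root
    depth-root : depth root ≡ 0
    depth-step : ∀ {v} → v < size → v ≢ root → depth v ≡ suc (depth (parent v))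
    lighter-irrefl  : ∀ x → lighter x x ≡ false
    lighter-asym    : ∀ {x y} → lighter x y ≡ true → lighter y x ≡ false
    ≮-trans    : ∀ {x y z} → lighter y x ≡ false → lighter z y ≡ false → lighter z x ≡ false

module TreeTheory (F : WeightedTree) where
  open WeightedTree F public

  anc : ℕ → ℕ → ℕ
  anc zero    v = v
  anc (suc i) v = parent (anc i v)

  anc< : ∀ i {v} → v < size → anc i v < size
  anc< zero    v< = v<
  anc< (suc i) v< = parent< (anc< i v<)

  anc-+ : ∀ i j v → anc (i + j) v ≡ anc i (anc j v)
  anc-+ zero    j v = refl
  anc-+ (suc i) j v = cong parent (anc-+ i j v)

  anc-∸ : ∀ {i j} v → i ≤ j → anc (j ∸ i) (anc i v) ≡ anc j v
  anc-∸ {i} {j} v i≤j = trans (sym (anc-+ (j ∸ i) i v)) (cong (λ k → anc k v) (m∸n+n≡m i≤j))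

  anc-parent : ∀ i v → anc i (parent v) ≡ parent (anc i v)
  anc-parent zero    v = refl
  anc-parent (suc i) v = cong parent (anc-parent i v)

  anc-root : ∀ i → anc i root ≡ root
  anc-root zero    = refl
  anc-root (suc i) = trans (cong parent (anc-root i)) parent-root

  depth-parent : ∀ {v} → v < size → depth (parent v) ≡ pred (depth v)
  depth-parent {v} v< with v ≟ root
  ... | yes refl = trans (cong depth parent-root) (trans depth-root (cong pred (sym depth-root)))
  ... | no v≢    = cong pred (sym (depth-step v< v≢))

  depth-anc : ∀ i {v} → v < size → depth (anc i v) ≡ depth v ∸ i
  depth-anc zero    v< = refl
  depth-anc (suc i) {v} v< =
    trans (depth-parent (anc< i v<)) (trans (cong pred (depth-anc i v<)) (pred[m∸n]≡m∸[1+n] (depth v) i))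

  depth≡0 : ∀ {v} → v < size → depth v ≡ 0 → v ≡ root
  depth≡0 {v} v< d≡0 with v ≟ root
  ... | yes v≡ = v≡
  ... | no v≢ with trans (sym d≡0) (depth-step v< v≢)
  ... | ()

  depth>0 : ∀ {v} → v < size → v ≢ root → 0 < depth v
  depth>0 v< v≢ = subst (0 <_) (sym (depth-step v< v≢)) (s≤s z≤n)

  depth>0⇒≢ : ∀ {v} → 0 < depth v → v ≢ root
  depth>0⇒≢ 0<d refl = <-irrefl (sym depth-root) 0<d

  anc≡root : ∀ {i v} → v < size → depth v ≤ i → anc i v ≡ root
  anc≡root {i} {v} v< d≤i = depth≡0 (anc< i v<) (trans (depth-anc i v<) (m≤n⇒m∸n≡0 d≤i))

  anc≢root : ∀ {i v} → v < size → i < depth v → anc i v ≢ root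
  anc≢root {i} {v} v< i<d = depth>0⇒≢ (subst (0 <_) (sym (depth-anc i v<)) (m<n⇒0<n∸m i<d))

  anc≡root⇒ : ∀ {i v} → v < size → anc i v ≡ root → depth v ≤ i
  anc≡root⇒ v< a≡ = ≮⇒≥ λ i<d → anc≢root v< i<d a≡

  anc≢root⇒ : ∀ {i v} → v < size → anc i v ≢ root → i < depth v
  anc≢root⇒ v< a≢ = ≰⇒> λ d≤i → a≢ (anc≡root v< d≤i)

  -- The ancestors at distances 0, ..., `depth v` have different depths, so the pigeonhole principle
  -- applies.
  depth<size : ∀ {v} → v < size → depth v < size
  depth<size {v} v< = Fin.injective⇒≤ {f = f} inj
    where
    f : Fin (suc (depth v)) → Fin size
    f i = fromℕ< (anc< (toℕ i) v<)
    inj : Injective _≡_ _≡_ f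
    inj {i} {j} e≡ = Fin.toℕ-injective (∸-cancelˡ-≡ (bound i) (bound j)
      (trans (sym (depth-anc (toℕ i) v<)) (trans (cong depth (Fin.fromℕ<-injective _ _ _ _ e≡)) (depth-anc (toℕ j) v<))))
      where
      bound : ∀ (k : Fin (suc (depth v))) → toℕ k ≤ depth v
      bound k = ≤-pred (Fin.toℕ<n k)

  -- For m = 0 the only minimum allowed is v itself.
  IsMin : ℕ → ℕ → ℕ → Set
  IsMin e v m =
    (∃[ j ] (j < depth v × j ≤ pred m × e ≡ anc j v)) ×
    (∀ j → j < m → j < depth v → lighter (anc j v) e ≡ false)

  isMin-edge : ∀ {e v m} → v < size → IsMin e v m → e < size × e ≢ root
  isMin-edge v< ((j , j<d , _ , refl) , _) = anc< j v< , anc≢root v< j<d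

  isMin-self : ∀ {v} m → v < size → v ≢ root → m ≤ 1 → IsMin v v m
  isMin-self {v} m v< v≢ m≤1 = (0 , depth>0 v< v≢ , z≤n , refl) , low
    where
    low : ∀ j → j < m → j < depth v → lighter (anc j v) v ≡ false
    low zero    _   _ = lighter-irrefl v
    low (suc j) j<m _ with ≤-trans j<m m≤1
    ... | s≤s ()

  isMin-≡ : ∀ {e v v′ m m′} → v ≡ v′ → m ≡ m′ → IsMin e v m → IsMin e v′ m′
  isMin-≡ refl refl h = h

  -- Once the window reaches the root, the bound `j < depth v` already implies `j < m`, so a larger
  -- window contains no further edge.
  isMin-short : ∀ {e v m m′} → v < size → anc m v ≡ root → m ≤ m′ → IsMin e v m → IsMin e v m′
  isMin-short v< a≡ m≤m′ ((j , j<d , j≤ , e≡) , low) =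
    (j , j<d , ≤-trans j≤ (pred-mono-≤ m≤m′) , e≡) ,
    λ i _ i<d → low i (≤-trans i<d (anc≡root⇒ v< a≡)) i<d

  private
    shift< : ∀ {v j m} → v < size → j < depth (anc m v) → j + m < depth v
    shift< {v} {j} {m} v< j< = subst (_≤ depth v) refl
      (m≤o∸n⇒m+n≤o (suc j) m≤d (subst (j <_) (depth-anc m v<) j<))
      where
      m≤d : m ≤ depth v
      m≤d = <⇒≤ (anc≢root⇒ v< (depth>0⇒≢ (m<n⇒0<n j<)))

    covers : ∀ {v m m′ g} → v < size →
      (∀ j → j < m → j < depth v → lighter (anc j v) g ≡ false) →
      (∀ j → j < m′ → j < depth (anc m v) → lighter (anc j (anc m v)) g ≡ false) →
      ∀ j → j < m + m′ → j < depth v → lighter (anc j v) g ≡ false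
    covers {v} {m} {m′} {g} v< lo hi j j< j<d with j <? m
    ... | yes j<m = lo j j<m j<d
    ... | no j≮m  = subst (λ x → lighter x g ≡ false) (anc-∸ v m≤j)
                      (hi (j ∸ m) (+-cancelˡ-< m (j ∸ m) m′ (subst (_< m + m′) (sym (m+[n∸m]≡n m≤j)) j<))
                        (subst (j ∸ m <_) (sym (depth-anc m v<)) (∸-monoˡ-< j<d m≤j)))
      where
      m≤j = ≮⇒≥ j≮m

  isMin-keep : ∀ {e f v m m′} → v < size → IsMin e v m → IsMin f (anc m v) m′ →
               lighter f e ≡ false → IsMin e v (m + m′)
  isMin-keep {m = m} {m′} v< ((j , j<d , j≤ , e≡) , low) (_ , low′) f≮e =
    (j , j<d , ≤-trans j≤ (pred-mono-≤ (m≤m+n m m′)) , e≡) ,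
    covers v< low (λ i i<m i<d → ≮-trans f≮e (low′ i i<m i<d))

  -- `0 < m′` is needed because for `m′ = 0` the edge `f` would be the one above `anc m v`, which
  -- for positive `m` lies just outside the joint window.
  isMin-replace : ∀ {e f v m m′} → v < size → 0 < m′ → IsMin e v m → IsMin f (anc m v) m′ →
                  lighter f e ≡ true → IsMin f v (m + m′)
  isMin-replace {v = v} {m} {suc m′} v< _ (_ , low) ((j , j<d , j≤ , e≡) , low′) f<e =
    (j + m , shift< v< j<d ,
     subst (j + m ≤_) (cong pred (sym (+-suc m m′))) (subst (_≤ m + m′) (+-comm m j) (+-monoʳ-≤ m j≤)) ,
     trans e≡ (sym (anc-+ j m v))) ,
    covers v< (λ i i<m i<d → ≮-trans (lighter-asym f<e) (low i i<m i<d)) low′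

  -- c is the nearest ancestor edge of x below x in value, or the root.
  Smaller : ℕ → ℕ → Set
  Smaller c x = ∃[ i ] (c ≡ anc i x × (c ≡ root ⊎ lighter c x ≡ true) ×
                        (∀ l → l < i → l < depth x → lighter (anc l x) x ≡ false))

  -- Between `e` and `c` there is no edge lighter than `e`, and by its depth `c` lies at or above
  -- the upper end of the path; the low window accounts for the edges below `e`.
  min-below : ∀ {v d m e c} → v < size → d ≤ depth v → 0 < m → m ≤ d → IsMin e v m →
              Smaller c e → depth c ≤ depth (anc d v) → IsMin e v d
  min-below {v} {d} {m} {e} {c} v< d≤ 0<m m≤d ((a , a<d , a≤ , refl) , low) (i , refl , _ , none) dc≤ =
    (a , a<d , ≤-trans a≤ (pred-mono-≤ m≤d) , refl) , λ l l<d l<dep → case l l<d l<dep (l <? m)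
    where
    dc≤′ : depth v ∸ (i + a) ≤ depth v ∸ d
    dc≤′ = subst₂ _≤_ (trans (cong depth (sym (anc-+ i a v))) (depth-anc (i + a) v<)) (depth-anc d v<) dc≤
    case : ∀ l → l < d → l < depth v → Dec (l < m) → lighter (anc l v) e ≡ false
    case l l<d l<dep (yes l<m) = low l l<m l<dep
    case l l<d l<dep (no l≮m) = subst (λ x → lighter x e ≡ false) (anc-∸ v a≤l) (none (l ∸ a) l∸a<i l∸a<dep)
      where
      a≤l : a ≤ l
      a≤l = ≤-trans a≤ (≤-trans pred[n]≤n (≮⇒≥ l≮m))
      l∸a<dep : l ∸ a < depth (anc a v)
      l∸a<dep = subst (l ∸ a <_) (sym (depth-anc a v<)) (∸-monoˡ-< l<dep a≤l)
      -- Otherwise `c` would be strictly deeper than `anc d v`. As `d ≤ depth v`, the truncated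
      -- subtraction is strict in this range, even when `i + a` counts steps beyond the root.
      l<i+a : l < i + a
      l<i+a = ≰⇒> λ i+a≤l → <-irrefl refl (≤-trans (∸-monoʳ-< (<-≤-trans (s≤s i+a≤l) l<d) d≤) dc≤′)
      l∸a<i : l ∸ a < i
      l∸a<i = subst (l ∸ a <_) (m+n∸n≡m i a) (∸-monoˡ-< l<i+a a≤l)

  -- Having positive depth, `c` is not the root and hence really lighter than `e`; it cannot be
  -- among the lowest `m` edges, where `e` is a minimum.
  crossing : ∀ {v d m e c} → v < size → d ≤ depth v → IsMin e v m → Smaller c e → depth (anc d v) < depth c →
             ∃[ x ] (m ≤ x × x < d × lighter (anc x v) e ≡ true)
  crossing {v} {d} {m} {e} {c} v< d≤ ((a , a<d , a≤ , refl) , low) (i , refl , stop , none) dc< =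
    i + a , m≤i+a , i+a<d , c<e
    where
    c≡ : anc i (anc a v) ≡ anc (i + a) v
    c≡ = sym (anc-+ i a v)
    i+a<d : i + a < d
    i+a<d = ∸-cancelʳ-< (subst₂ _<_ (depth-anc d v<) (trans (cong depth c≡) (depth-anc (i + a) v<)) dc<)
    c<e : lighter (anc (i + a) v) (anc a v) ≡ true
    c<e = [ (λ c≡root → ⊥-elim (depth>0⇒≢ (m<n⇒0<n dc<) c≡root)) , subst (λ x → lighter x (anc a v) ≡ true) c≡ ]′ stop
    m≤i+a : m ≤ i + a
    m≤i+a = ≮⇒≥ λ i+a<m → true≢false (trans (sym c<e) (low (i + a) i+a<m (<-≤-trans i+a<d d≤)))
      where
      true≢false : true ≢ false
      true≢false ()

  -- The edge supplied by `crossing` lies in the range of `g`, so `g` is no heavier than it. It is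
  -- lighter than `e`, which in turn is no heavier than any of the `b ≤ m` edges left out.
  min-above : ∀ {v d b m e c g} → v < size → d ≤ depth v → b ≤ m → IsMin e v m →
              Smaller c e → depth (anc d v) < depth c → IsMin g (anc b v) (d ∸ b) → IsMin g v d
  min-above {v} {d} {b} {m} {e} {c} {g} v< d≤ b≤m mine smaller dc< ((j , j< , j≤ , refl) , lowg)
    with x , m≤x , x<d , x<e ← crossing v< d≤ mine smaller dc< =
    (j + b , shift< v< j< , j+b≤ , sym (anc-+ j b v)) , λ l l<d l<dep → case l l<d l<dep (l <? b)
    where
    b≤x = ≤-trans b≤m m≤x
    b<d = ≤-<-trans b≤x x<d
    upper : ∀ l → b ≤ l → l < d → l < depth v → lighter (anc l v) g ≡ false
    upper l b≤l l<d l<dep = subst (λ x → lighter x g ≡ false) (anc-∸ v b≤l)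
      (lowg (l ∸ b) (∸-monoˡ-< l<d b≤l) (subst (l ∸ b <_) (sym (depth-anc b v<)) (∸-monoˡ-< l<dep b≤l)))
    j+b≤ : j + b ≤ pred d
    j+b≤ = ≤-trans (+-monoˡ-≤ b j≤) (≤-pred (≤-trans (≤-reflexive step) (≤-reflexive (sym (suc-pred d {{>-nonZero (m<n⇒0<n b<d)}})))))
      where
      step : suc (pred (d ∸ b) + b) ≡ d
      step = trans (cong (_+ b) (suc-pred (d ∸ b) {{>-nonZero (m<n⇒0<n∸m b<d)}})) (m∸n+n≡m (<⇒≤ b<d))
    case : ∀ l → l < d → l < depth v → Dec (l < b) → lighter (anc l v) g ≡ false
    case l l<d l<dep (no l≮b)  = upper l (≮⇒≥ l≮b) l<d l<dep
    case l l<d l<dep (yes l<b) =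
      ≮-trans (≮-trans (upper x b≤x x<d (<-≤-trans x<d d≤)) (lighter-asym x<e)) (proj₂ mine l (<-≤-trans l<b b≤m) l<dep)

  -- As b < p, this is the lowest ancestor of y whose depth is a multiple of p.
  Aligned : ℕ → ℕ → ℕ → Set
  Aligned p y z = ∃[ b ] (b < p × b ≤ depth y × z ≡ anc b y × p ∣ depth z)

  aligned-self : ∀ y → Aligned 1 y y
  aligned-self y = 0 , s≤s z≤n , z≤n , refl , divides (depth y) (sym (*-identityʳ (depth y)))

  aligned-double-here : ∀ {p y z} → Aligned p y z → 2 * p ∣ depth z → Aligned (2 * p) y z
  aligned-double-here {p} (b , b<p , b≤ , e≡ , _) p∣z = b , ≤-trans b<p (m≤m+n p _) , b≤ , e≡ , p∣z

  -- If `depth z` is an odd multiple of `p`, the next even multiple is `p` edges higher, and one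
  -- jump of the current level leads there. Thus each level's aligned ancestors come from those of
  -- the level before in constant time.
  aligned-double-up : ∀ {p y z} .{{_ : NonZero (2 * p)}} → y < size → Aligned p y z → depth z % (2 * p) ≢ 0 →
                      Aligned (2 * p) y (anc p z)
  aligned-double-up {p} {y} {z} y< (b , b<p , b≤ , refl , divides q e≡) mod≢ = split (q % 2) (m%n<n q 2) (m≡m%n+[m/n]*n q 2)
    where
    split : ∀ r → r < 2 → q ≡ r + (q / 2) * 2 → Aligned (2 * p) y (anc p z)
    split zero _ q≡ = ⊥-elim (mod≢ (trans (cong (_% (2 * p)) (trans e≡ (trans (cong (_* p) q≡) (*-assoc (q / 2) 2 p)))) (m*n%n≡0 (q / 2) (2 * p))))
    split (suc (suc _)) (s≤s (s≤s ())) _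
    split (suc zero) _ q≡ = p + b , +-monoʳ-< p b<p′ , p+b≤ , sym (anc-+ p b y) ,
      divides (q / 2) (trans (depth-anc p (anc< b y<)) (trans (cong (_∸ p) dz) (m+n∸m≡n p _)))
      where
      b<p′ : b < 1 * p
      b<p′ = subst (b <_) (sym (*-identityˡ p)) b<p
      dz : depth z ≡ p + q / 2 * (2 * p)
      dz = trans e≡ (trans (cong (_* p) q≡) (cong (p +_) (*-assoc (q / 2) 2 p)))
      p+b≤ : p + b ≤ depth y
      p+b≤ = m≤o∸n⇒m+n≤o p b≤ (subst (p ≤_) (trans (sym dz) (depth-anc b y<)) (m≤m+n p _))

  Deep : ℕ → ℕ → Set
  Deep p z = ∃[ v ] ∃[ b ] (v < size × z ≡ anc b v × p ≤ b × b ≤ depth v × p ∣ depth z)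

  deep-aligned : ∀ {p v z} → v < size → p ≤ depth v → Aligned p (anc p v) z → Deep p z
  deep-aligned {p} {v} v< p≤ (b , _ , b≤ , refl , p∣z) =
    v , b + p , v< , sym (anc-+ b p v) , m≤n+m p b ,
    m≤o∸n⇒m+n≤o b p≤ (subst (b ≤_) (depth-anc p v<) b≤) , p∣z

  -- Below a deep node there is a path of p nodes, itself included, and these
  -- paths are disjoint: every node on one of them has its top as aligned ancestor.
  deep-count : ∀ {p} cnt .{{_ : NonZero p}} (z : Fin cnt → ℕ) → (∀ s → Deep p (z s)) →
               Injective _≡_ _≡_ z → cnt * p ≤ size
  deep-count {p} cnt z deep inj = Fin.injective⇒≤ {f = f} f-inj
    where
    q : Fin cnt → ℕ
    q s = let _ , _ , _ , _ , _ , _ , divisible = deep s in quotient divisible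
    node : Fin cnt → Fin p → ℕ
    node s i = let v , b , _ = deep s in anc (b ∸ toℕ i) v
    node< : ∀ s i → node s i < size
    node< s i = let v , b , v< , _ = deep s in anc< (b ∸ toℕ i) v<
    i≤b : ∀ s (i : Fin p) → toℕ i ≤ proj₁ (proj₂ (deep s))
    i≤b s i = let v , b , v< , _ , p≤b , _ = deep s in ≤-trans (<⇒≤ (Fin.toℕ<n i)) p≤b
    up : ∀ s i → anc (toℕ i) (node s i) ≡ z s
    up s i = let v , b , v< , z≡ , p≤b , b≤ , _ = deep s in
      trans (sym (anc-+ (toℕ i) (b ∸ toℕ i) v)) (trans (cong (λ k → anc k v) (m+[n∸m]≡n (i≤b s i))) (sym z≡))
    depth-node : ∀ s i → depth (node s i) ≡ toℕ i + q s * p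
    depth-node s i = let v , b , v< , z≡ , p≤b , b≤ , divides _ dz≡ = deep s in
      trans (depth-anc (b ∸ toℕ i) v<)
      (trans (lemma (depth v) b (toℕ i) (i≤b s i) b≤)
      (cong (toℕ i +_) (trans (sym (trans (cong depth z≡) (depth-anc b v<))) dz≡)))
      where
      lemma : ∀ d b i → i ≤ b → b ≤ d → d ∸ (b ∸ i) ≡ i + (d ∸ b)
      lemma d b i i≤b b≤d = trans (cong (_∸ (b ∸ i)) (sym d≡)) (m+n∸n≡m (i + (d ∸ b)) (b ∸ i))
        where
        d≡ : i + (d ∸ b) + (b ∸ i) ≡ d
        d≡ = trans (cong (_+ (b ∸ i)) (+-comm i (d ∸ b)))
             (trans (+-assoc (d ∸ b) i (b ∸ i)) (trans (cong (d ∸ b +_) (m+[n∸m]≡n i≤b)) (m∸n+n≡m b≤d)))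
    f : Fin (cnt * p) → Fin size
    f x = let s , i = remQuot {cnt} p x in fromℕ< (node< s i)
    -- The depth modulo `p` of a node reveals its distance `i` to the top of its path; climbing `i`
    -- edges then recovers the top.
    node-inj : ∀ s i s′ i′ → node s i ≡ node s′ i′ → (s , i) ≡ (s′ , i′)
    node-inj s i s′ i′ e≡ = cong₂ _,_ (inj z≡) (Fin.toℕ-injective i≡)
      where
      i≡ : toℕ i ≡ toℕ i′
      i≡ = proj₁ (divMod-unique p {q = q s} {r = q s′} (Fin.toℕ<n i) (Fin.toℕ<n i′)
             (trans (sym (depth-node s i)) (trans (cong depth e≡) (depth-node s′ i′))))
      z≡ : z s ≡ z s′
      z≡ = trans (sym (up s i)) (trans (cong₂ anc i≡ e≡) (up s′ i′))
    f-inj : Injective _≡_ _≡_ f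
    f-inj {x} {y} e≡ = trans (sym (Fin.combine-remQuot {cnt} p x)) (trans (cong (uncurry combine) pairs≡) (Fin.combine-remQuot {cnt} p y))
      where
      pairs≡ : remQuot {cnt} p x ≡ remQuot {cnt} p y
      pairs≡ = node-inj _ _ _ _ (Fin.fromℕ<-injective _ _ _ _ e≡)

-- Reasoning about word RAM programs

bit-lt≢0 : ∀ a b → bit (a <ᵇ b) ≢ 0 → a < b
bit-lt≢0 a b h with a <ᵇ b in eq
... | true  = <ᵇ⇒< a b (subst T (sym eq) tt)
... | false = ⊥-elim (h refl)

bit-lt≡0 : ∀ a b → bit (a <ᵇ b) ≡ 0 → b ≤ a
bit-lt≡0 a b h with a <ᵇ b in eq
... | false = ≮⇒≥ λ a<b → subst T eq (<⇒<ᵇ a<b)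

bit-eq≢0 : ∀ a b → bit (a ≡ᵇ b) ≢ 0 → a ≡ b
bit-eq≢0 a b h with a ≡ᵇ b in eq
... | true  = ≡ᵇ⇒≡ a b (subst T (sym eq) tt)
... | false = ⊥-elim (h refl)

bit-eq≡0 : ∀ a b → bit (a ≡ᵇ b) ≡ 0 → a ≢ b
bit-eq≡0 a b h a≡b with a ≡ᵇ b in eq
... | false = subst T eq (≡⇒≡ᵇ a b a≡b)

bit≢0 : ∀ {x} → bit x ≢ 0 → x ≡ true
bit≢0 {true}  _ = refl
bit≢0 {false} h = ⊥-elim (h refl)

bit≡0 : ∀ {x} → bit x ≡ 0 → x ≡ false
bit≡0 {false} _ = refl

update-same : ∀ (f : ℕ → ℕ) i x → (f [ i ↦ x ]) i ≡ x
update-same f i x with i ≡ᵇ i in eq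
... | true  = refl
... | false = ⊥-elim (subst T eq (≡⇒≡ᵇ i i refl))

update-other : ∀ (f : ℕ → ℕ) {i j} x → i ≢ j → (f [ i ↦ x ]) j ≡ f j
update-other f {i} {j} x i≢j with i ≡ᵇ j in eq
... | true  = ⊥-elim (i≢j (≡ᵇ⇒≡ i j (subst T (sym eq) tt)))
... | false = refl

module WordArithmetic (w : ℕ) where

  wrap-small : ∀ {a} → a < 2 ^ w → wrap w a ≡ a
  wrap-small = m<n⇒m%n≡m {{m^n≢0 2 w}}

  -- The equations for the operands allow register contents to be replaced by their intended values
  -- on the spot, without rewriting the goal; the same form serves for the other operations.
  add= : ∀ {x y a b} → x ≡ a → y ≡ b → a + b < 2 ^ w → evalOp w add x y ≡ a + b
  add= refl refl = wrap-small

  sub= : ∀ {x y a b} → x ≡ a → y ≡ b → b ≤ a → a < 2 ^ w → evalOp w sub x y ≡ a ∸ b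
  sub= {a = a} {b} refl refl b≤a a< =
    trans (cong (wrap w) (+-∸-comm (2 ^ w) b≤a))
    (trans ([m+n]%n≡m%n (a ∸ b) (2 ^ w) {{m^n≢0 2 w}}) (wrap-small (≤-<-trans (m∸n≤m a b) a<)))

  div= : ∀ {x y a b} .{{_ : NonZero b}} → x ≡ a → y ≡ b → evalOp w div x y ≡ a / b
  div= {b = suc _} refl refl = refl

  mod= : ∀ {x y a b} .{{_ : NonZero b}} → x ≡ a → y ≡ b → evalOp w mod x y ≡ a % b
  mod= {b = suc _} refl refl = refl

  lt= : ∀ {x y a b} → x ≡ a → y ≡ b → evalOp w lt x y ≡ bit (a <ᵇ b)
  lt= refl refl = refl

  eq= : ∀ {x y a b} → x ≡ a → y ≡ b → evalOp w eq x y ≡ bit (a ≡ᵇ b)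
  eq= refl refl = refl

noOracle : Program → Bool
noOracle (oracle _ _ _) = false
noOracle (P ⨾ Q)        = noOracle P ∧ noOracle Q
noOracle (ifnz _ P Q)   = noOracle P ∧ noOracle Q
noOracle (while _ P)    = noOracle P
noOracle _              = true

-- The catch-all covers `while` too, for which 1 is no bound; as `wp` of a loop is empty, `straight`
-- remains true.
cost : Program → ℕ
cost (P ⨾ Q)      = cost P + cost Q
cost (ifnz _ P Q) = suc (cost P ⊔ cost Q)
cost _            = 1

Outside : ℕ → ℕ → (ℕ → ℕ) → (ℕ → ℕ) → Set
Outside b len m m′ = ∀ a → a < b ⊎ b + len ≤ a → m′ a ≡ m a

-- A record instead of the bare function type, so that the address and the predicate can be inferred
-- from the type of a proof.
record Filled (b : ℕ) (G : ℕ → ℕ → Set) (i : ℕ) (m : ℕ → ℕ) : Set where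
  constructor filled
  field at : ∀ {j} → j < i → G j (m (b + j))

open Filled public

rone ri rc ra rval rdst rlim : Reg
rone = 3
ri   = 6
rc   = 7
ra   = 8
rval = 9
rdst = 10
rlim = 11

-- For each i below rlim, P leaves in rval the word to be stored in cell rdst + i.
fill : Program → Program
fill P = (const ri 0 ⨾ op lt rc ri rlim) ⨾
         while rc (P ⨾ op add ra rdst ri ⨾ store ra rval ⨾ op add ri ri rone ⨾ op lt rc ri rlim)

-- Depends on the registers through their values only, so that writing
-- another register does not change the type.
record Control (b len i vi vdst vlim vone : ℕ) : Set where
  constructor ctl
  field
    index : vi ≡ i
    base  : vdst ≡ b
    limit : vlim ≡ len
    unit  : vone ≡ 1

Ctl : (b len i : ℕ) → (Reg → ℕ) → Set
Ctl b len i ρ = Control b len i (ρ ri) (ρ rdst) (ρ rlim) (ρ rone)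

module Hoare (w S : ℕ) {E : Set} (ident : E → ℕ) (less : E → E → Bool) where
  open Machine w S ident less
  open WordArithmetic w public

  -- Oracle calls of the preprocessing are bounded through its running time and need no count of
  -- their own.
  calls≤time : ∀ {P s s′ t o} → Run P s s′ t o → o ≤ t
  calls≤time nop             = z≤n
  calls≤time const           = z≤n
  calls≤time move            = z≤n
  calls≤time op              = z≤n
  calls≤time (load _)        = z≤n
  calls≤time (store _)       = z≤n
  calls≤time (oracle _ _ _ _) = ≤-refl
  calls≤time (r ⨾ r′)        = +-mono-≤ (calls≤time r) (calls≤time r′)
  calls≤time (ifnz-≢ _ r)    = m≤n⇒m≤1+n (calls≤time r)
  calls≤time (ifnz-≡ _ r)    = m≤n⇒m≤1+n (calls≤time r)
  calls≤time (loop _ r r′)   = m≤n⇒m≤1+n (+-mono-≤ (calls≤time r) (calls≤time r′))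
  calls≤time (exit _)        = z≤n

  private
    ∧-split : ∀ {x y} → (x ∧ y) ≡ true → x ≡ true × y ≡ true
    ∧-split {true} {true} _ = refl , refl

  -- That queries make no oracle call is thus read off the program text.
  noOracle-calls : ∀ {P s s′ t o} → noOracle P ≡ true → Run P s s′ t o → o ≡ 0
  noOracle-calls h nop          = refl
  noOracle-calls h const        = refl
  noOracle-calls h move         = refl
  noOracle-calls h op           = refl
  noOracle-calls h (load _)     = refl
  noOracle-calls h (store _)    = refl
  noOracle-calls h (r ⨾ r′)     = cong₂ _+_ (noOracle-calls (proj₁ (∧-split h)) r) (noOracle-calls (proj₂ (∧-split h)) r′)
  noOracle-calls h (ifnz-≢ _ r) = noOracle-calls (proj₁ (∧-split h)) r
  noOracle-calls {ifnz _ P _} h (ifnz-≡ _ r) = noOracle-calls (proj₂ (∧-split {noOracle P} h)) r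
  noOracle-calls h (loop _ r r′) = cong₂ _+_ (noOracle-calls h r) (noOracle-calls h r′)
  noOracle-calls h (exit _)     = refl

  -- Total correctness with a time bound. The number of calls is left open, since the two lemmas
  -- above supply what is required of it.
  record ⟪_⟫ (P : Program) (s : State) (T : ℕ) (Q : State → Set) : Set where
    constructor halts
    field
      {final}      : State
      {time calls} : ℕ
      run          : Run P s final time calls
      time≤        : time ≤ T
      post         : Q final

  weaken : ∀ {P s T T′ Q Q′} → T ≤ T′ → (∀ {s′} → Q s′ → Q′ s′) → ⟪ P ⟫ s T Q → ⟪ P ⟫ s T′ Q′
  weaken T≤ imp (halts r t≤ q) = halts r (≤-trans t≤ T≤) (imp q)

  infixr 4 _andThen_
  _andThen_ : ∀ {P P′ s T T′ Q Q′} → ⟪ P ⟫ s T Q → (∀ {s′} → Q s′ → ⟪ P′ ⟫ s′ T′ Q′) → ⟪ P ⨾ P′ ⟫ s (T + T′) Q′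
  halts r t≤ q andThen f = let halts r′ t≤′ q′ = f q in halts (r ⨾ r′) (+-mono-≤ t≤ t≤′) q′

  -- For loop-free programs only.
  wp : Program → (State → Set) → State → Set
  wp nop            Q s = Q s
  wp (const r k)    Q s = k < 2 ^ w × Q (setReg r k s)
  wp (move r a)     Q s = Q (setReg r (reg s a) s)
  wp (op f r a b)   Q s = ∃[ x ] (evalOp w f (reg s a) (reg s b) ≡ x × Q (setReg r x s))
  wp (load r a)     Q s = ∃[ x ] (reg s a < S × mem s (reg s a) ≡ x × Q (setReg r x s))
  wp (store a r)    Q s = reg s a < S × Q (setMem (reg s a) (reg s r) s)
  wp (oracle r a b) Q s = ∃[ x ] ((∃[ e ] ∃[ f ] (reg s a ≡ ident e × reg s b ≡ ident f × bit (less e f) ≡ x)) × Q (setReg r x s))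
  wp (P ⨾ P′)       Q s = wp P (wp P′ Q) s
  wp (ifnz r P P′)  Q s = (reg s r ≢ 0 → wp P Q s) × (reg s r ≡ 0 → wp P′ Q s)
  wp (while r P)    Q s = ⊥

  -- The witness that `wp` demands for each computed word lets a proof choose the form in which the
  -- word enters the conditions on later instructions.
  straight : ∀ {P s Q} → wp P Q s → ⟪ P ⟫ s (cost P) Q
  straight {nop}            q                     = halts nop ≤-refl q
  straight {const r k} {s} {Q} (k< , q)           = halts const ≤-refl (subst (λ x → Q (setReg r x s)) (sym (wrap-small k<)) q)
  straight {move r a}       q                     = halts move ≤-refl q
  straight {op f r a b}     (_ , refl , q)        = halts op ≤-refl q
  straight {load r a}       (_ , a< , refl , q)   = halts (load a<) ≤-refl q
  straight {store a r}      (a< , q)              = halts (store a<) ≤-refl q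
  straight {oracle r a b}   (_ , (e , f , ea , fb , refl) , q) = halts (oracle e f ea fb) ≤-refl q
  straight {P ⨾ P′}         q                     = straight {P} q andThen straight {P′}
  straight {ifnz r P P′} {s} (q , q′) with reg s r ≟ 0
  ... | no ≢0  = let halts r t≤ p = straight {P} (q ≢0) in halts (ifnz-≢ ≢0 r) (s≤s (≤-trans t≤ (m≤m⊔n (cost P) (cost P′)))) p
  ... | yes ≡0 = let halts r t≤ p = straight {P′} (q′ ≡0) in halts (ifnz-≡ ≡0 r) (s≤s (≤-trans t≤ (m≤n⊔m (cost P) (cost P′)))) p

  straightThen : ∀ {P P′ s T Q} → wp P (λ s′ → ⟪ P′ ⟫ s′ T Q) s → ⟪ P ⨾ P′ ⟫ s (cost P + T) Q
  straightThen {P} h = straight {P} h andThen λ h′ → h′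

  ifnz-then : ∀ {r P P′ s T Q} → reg s r ≢ 0 → ⟪ P ⟫ s T Q → ⟪ ifnz r P P′ ⟫ s (suc T) Q
  ifnz-then ≢0 (halts run t≤ q) = halts (ifnz-≢ ≢0 run) (s≤s t≤) q

  ifnz-else : ∀ {r P P′ s T Q} → reg s r ≡ 0 → ⟪ P′ ⟫ s T Q → ⟪ ifnz r P P′ ⟫ s (suc T) Q
  ifnz-else ≡0 (halts run t≤ q) = halts (ifnz-≡ ≡0 run) (s≤s t≤) q

  ifnz-rule : ∀ {r P P′ s T Q} → (reg s r ≢ 0 → ⟪ P ⟫ s T Q) → (reg s r ≡ 0 → ⟪ P′ ⟫ s T Q) → ⟪ ifnz r P P′ ⟫ s (suc T) Q
  ifnz-rule {r} {s = s} f g with reg s r ≟ 0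
  ... | no ≢0  = ifnz-then ≢0 (f ≢0)
  ... | yes ≡0 = ifnz-else ≡0 (g ≡0)

  -- The second index of the invariant is the time spent so far.
  while-rule : ∀ {r P} (Inv : ℕ → ℕ → State → Set) (N B : ℕ) →
    (∀ {k τ s} → Inv k τ s → τ ≤ B) →
    (∀ {k τ s} → Inv k τ s → reg s r ≢ 0 → k < N × ∃[ T ] ⟪ P ⟫ s T (Inv (suc k) (suc T + τ))) →
    ∀ {s} → Inv 0 0 s →
    ⟪ while r P ⟫ s (suc B) (λ s′ → reg s′ r ≡ 0 × ∃[ k ] ∃[ τ ] Inv k τ s′)
  while-rule {r} {P} Inv N B bounded step {s} inv =
    let s′ , t , o , run , t≤ , post = go N 0 0 s (≤-reflexive (sym (+-identityʳ N))) inv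
    in halts run (subst (_≤ suc B) (+-identityʳ t) t≤) post
    where
    -- `f` is fuel: at least as many iterations as can still follow. When it is used up, `N ≤ k`
    -- contradicts the bound `k < N` that the step yields for a further iteration.
    go : ∀ f k τ s → N ≤ f + k → Inv k τ s →
         ∃[ s′ ] ∃[ t ] ∃[ o ] (Run (while r P) s s′ t o × t + τ ≤ suc B × (reg s′ r ≡ 0 × ∃[ k ] ∃[ τ ] Inv k τ s′))
    go f k τ s N≤ inv with reg s r ≟ 0
    ... | yes ≡0 = s , 1 , 0 , exit ≡0 , s≤s (bounded inv) , ≡0 , k , τ , inv
    go zero k τ s N≤ inv | no ≢0 = ⊥-elim (<⇒≱ (proj₁ (step inv ≢0)) N≤)
    go (suc f) k τ s N≤ inv | no ≢0 =
      let _ , T , halts {t₁} {time} r₁ t≤₁ inv₁ = step inv ≢0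
          s′ , t , o , r₂ , t≤ , post = go f (suc k) (suc T + τ) t₁ (≤-trans N≤ (≤-reflexive (sym (+-suc f k)))) inv₁
      in s′ , _ , _ , loop ≢0 r₁ r₂ ,
         ≤-trans (≤-trans (+-monoˡ-≤ τ (s≤s (+-monoˡ-≤ t t≤₁))) (≤-reflexive (rearrange T t τ))) t≤ , post
      where
      rearrange : ∀ T t τ → suc (T + t) + τ ≡ t + (suc T + τ)
      rearrange T t τ = trans (cong (λ x → suc x + τ) (+-comm T t))
                        (trans (cong suc (+-assoc t T τ)) (sym (+-suc t (T + τ))))

  for-rule : ∀ {r P} (Inv : ℕ → State → Set) (N T : ℕ) →
    (∀ {k s} → Inv k s → k ≤ N) →
    (∀ {k s} → Inv k s → reg s r ≢ 0 → k < N × ⟪ P ⟫ s T (Inv (suc k))) →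
    ∀ {s} → Inv 0 s →
    ⟪ while r P ⟫ s (suc (N * suc T)) (λ s′ → reg s′ r ≡ 0 × ∃[ k ] Inv k s′)
  for-rule Inv N T k≤N step inv =
    weaken ≤-refl (λ (≡0 , k , τ , _ , i) → ≡0 , k , i)
      (while-rule (λ k τ s → τ ≡ k * suc T × Inv k s) N (N * suc T)
        (λ { (refl , i) → *-monoˡ-≤ (suc T) (k≤N i) })
        (λ { (refl , i) ≢0 → let k< , h = step i ≢0 in k< , T , weaken ≤-refl (λ i′ → refl , i′) h })
        (refl , inv))

  -- `R` is an invariant on registers that may depend on the index, such as a flag or a running
  -- minimum. The two closure conditions say that the bookkeeping of the loop does not disturb it;
  -- for a concrete `R` on other registers they hold by computation. The body is also told about the
  -- cells filled so far, because the logarithms are computed from earlier ones.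
  fill-rule : ∀ {P b len T s} (R : ℕ → (Reg → ℕ) → Set) (G : ℕ → ℕ → Set) →
    S < 2 ^ w → b + len ≤ S →
    (∀ ρ y z → R 0 ρ → R 0 (ρ [ ri ↦ y ] [ rc ↦ z ])) →
    (∀ i ρ x y z → R i ρ → R i (ρ [ ra ↦ x ] [ ri ↦ y ] [ rc ↦ z ])) →
    (∀ {i s′} → i < len → Ctl b len i (reg s′) → R i (reg s′) →
       Outside b len (mem s) (mem s′) → Filled b G i (mem s′) →
       ⟪ P ⟫ s′ T (λ s″ → mem s″ ≡ mem s′ × Ctl b len i (reg s″) × R (suc i) (reg s″) × G i (reg s″ rval))) →
    reg s rdst ≡ b → reg s rlim ≡ len → reg s rone ≡ 1 → R 0 (reg s) →
    ⟪ fill P ⟫ s (2 + suc (len * suc (T + 4)))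
      (λ s′ → Outside b len (mem s) (mem s′) × Filled b G len (mem s′) × R len (reg s′))
  fill-rule {P} {b} {len} {T} {s} R G S<W b+len≤S st₁ st₂ compute dst≡ lim≡ one≡ r₀ =
    straight (≤-<-trans z≤n S<W , _ , lt= refl lim≡ ,
              (z≤n , ctl refl dst≡ lim≡ one≡ , refl , st₁ _ _ _ r₀ , (λ _ _ → refl) , filled λ ()))
    andThen λ inv → weaken ≤-refl finish (for-rule Inv len (T + 4) proj₁ step inv)
    where
    Inv : ℕ → State → Set
    Inv k s′ = k ≤ len × Ctl b len k (reg s′) × reg s′ rc ≡ bit (k <ᵇ len) × R k (reg s′) ×
               Outside b len (mem s) (mem s′) × Filled b G k (mem s′)
    finish : ∀ {s′} → reg s′ rc ≡ 0 × ∃[ k ] Inv k s′ → Outside b len (mem s) (mem s′) × Filled b G len (mem s′) × R len (reg s′)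
    finish {s′} (≡0 , k , k≤ , _ , c≡ , r , out , fl) with ≤-antisym k≤ (bit-lt≡0 k len (trans (sym c≡) ≡0))
    ... | refl = out , fl , r
    step : ∀ {k s′} → Inv k s′ → reg s′ rc ≢ 0 →
           k < len × ⟪ P ⨾ op add ra rdst ri ⨾ store ra rval ⨾ op add ri ri rone ⨾ op lt rc ri rlim ⟫ s′ (T + 4) (Inv (suc k))
    step {k} {s′} (k≤ , c , c≡ , r , out , fl) ≢0 =
      k<len , (compute k<len c r out fl andThen λ (m≡ , ctl i≡ d≡ l≡ o≡ , r′ , g) →
        straight (_ , add= d≡ i≡ (<-trans b+k<S S<W) , b+k<S ,
                  _ , trans (add= i≡ o≡ k+1<W) (+-comm k 1) , _ , lt= refl l≡ ,
                  (k<len , ctl refl d≡ l≡ o≡ , refl , st₂ _ _ _ _ _ r′ , outside m≡ , stored m≡ g)))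
      where
      k<len = bit-lt≢0 k len (λ e → ≢0 (trans c≡ e))
      b+k<S = <-≤-trans (+-monoʳ-< b k<len) b+len≤S
      k+1<W : k + 1 < 2 ^ w
      k+1<W = ≤-<-trans (≤-trans (≤-reflexive (+-comm k 1)) (≤-trans k<len (≤-trans (m≤n+m len b) b+len≤S))) S<W
      outside : ∀ {m x} → m ≡ mem s′ → Outside b len (mem s) (m [ b + k ↦ x ])
      outside {m} {x} m≡ a h = trans (update-other (m) x (≢a h)) (trans (cong (λ m → m a) m≡) (out a h))
        where
        ≢a : a < b ⊎ b + len ≤ a → b + k ≢ a
        ≢a (inj₁ a<b) refl = <⇒≱ a<b (m≤m+n b k)
        ≢a (inj₂ ≤a)  refl = <⇒≱ (+-monoʳ-< b k<len) ≤a
      stored : ∀ {m x} → m ≡ mem s′ → G k x → Filled b G (suc k) (m [ b + k ↦ x ])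
      at (stored {m} {x} m≡ g) {j} (s≤s j≤k) with j ≟ k
      ... | yes refl = subst (G k) (sym (update-same (m) (b + k) x)) g
      ... | no j≢k   = subst (G j) (sym (trans (update-other (m) x (λ e → j≢k (sym (+-cancelˡ-≡ b k j e)))) (cong (λ m → m (b + j)) m≡)))
                         (at fl (≤∧≢⇒< j≤k j≢k))

-- The programs

-- The memory is divided into a block of 6 n cells for each level k ≤ K, where
-- K ≤ lg + 1 is least with height ≤ 2 ^ K; two arrays of n cells (depths of
-- nearest lighter ancestors, logarithms); and a chunk of 6 n cells for each k.
-- Block k: the ancestors 2 ^ k steps up, the lightest among the lowest 2 ^ k
-- edges, the depths cut off at 2 ^ k.  Chunk k: the aligned ancestors, the
-- address of the array allocated to each node (0 for none), the pointers into
-- these arrays, and 3 n cells for the arrays.  The last n cells are unused: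
-- a pointer may exceed the array's end by less than n.
-- Registers rp and rq hold the addresses of the current block and chunk, rD that
-- of the depths in block K, which are not cut off.

rN rtwo rroot rt ru re rflag rp rstride rpM rpD : Reg
rN      = 2
rtwo    = 4
rroot   = 5
rt      = 12
ru      = 13
re      = 14
rflag   = 15
rp      = 16
rstride = 17
rpM     = 18
rpD     = 19

-- depthInit also finds the root, the only node that is its own parent.
minInit depthInit jumpStep minStep depthStep : Program
minInit   = move rval ri
depthInit = load rt ri ⨾ op eq rt rt ri ⨾ ifnz rt (move rroot ri ⨾ const rval 0) (const rval 1)
jumpStep  = op add rt rp ri ⨾ load rt rt ⨾ op add rt rp rt ⨾ load rval rt ⨾
            op eq re rval rroot ⨾ ifnz re nop (const rflag 1)
minStep   = op add rt rp ri ⨾ load rt rt ⨾ op add ru rpM ri ⨾ load rval ru ⨾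
            op eq re rt rroot ⨾
            ifnz re nop (op add ru rpM rt ⨾ load ru ru ⨾ oracle re ru rval ⨾ ifnz re (move rval ru) nop)
depthStep = op add rt rp ri ⨾ load rt rt ⨾ op add ru rpD rt ⨾ load ru ru ⨾
            op add rt rpD ri ⨾ load rt rt ⨾ op add rval rt ru

-- The input is already the first array of block 0, as the 2 ^ 0-th ancestor is the parent; hence
-- only two arrays are filled before the loop. The flag raised by `jumpStep` tells whether some jump
-- still ends below the root.
levelStep doubling : Program
levelStep =
  (op add rpM rp rN ⨾ op add rpD rpM rN ⨾ op add rdst rstride rp ⨾ const rflag 0) ⨾
  fill jumpStep ⨾ op add rdst rdst rN ⨾
  fill minStep ⨾ op add rdst rdst rN ⨾
  fill depthStep ⨾ op add rp rstride rp
doubling =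
  (move rN 0 ⨾ move rlim rN ⨾ const rone 1 ⨾ const rtwo 2 ⨾
   op add rt rN rN ⨾ op add rstride rt rt ⨾ op add rstride rt rstride ⨾ const rp 0 ⨾ move rdst rN) ⨾
  fill minInit ⨾ op add rdst rdst rN ⨾
  fill depthInit ⨾ const rflag 1 ⨾
  while rflag levelStep

rD rthr rlg rend rbP rq rpw rcur rs rbest rv rgo rgo′ rslot rP rfree rdouble rlen rz rx : Reg
rD      = 20
rthr    = 21
rlg     = 22
rend    = 23
rbP     = 24
rq      = 25
rpw     = 26
rcur    = 27
rs      = 28
rbest   = 29
rv      = 30
rgo     = 31
rgo′    = 32
rslot   = 33
rP      = 34
rfree   = 35
rdouble = 36
rlen    = 37
rz      = 38
rx      = 39

-- The search tries windows of decreasing length: a window whose minimum is not lighter is skipped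
-- as a whole, otherwise the search continues inside it. Levels are represented by the addresses of
-- their blocks. So the loop ends at address 0, and the logarithm array holds block addresses, which
-- grow by one stride when the argument doubles.
climb nearest logarithm searching : Program
climb     = op sub rs rs rstride ⨾ op eq re rcur rroot ⨾
            ifnz re nop (op add ru rs rN ⨾ op add ru ru rcur ⨾ load ru ru ⨾ oracle re ru ri ⨾
                         ifnz re nop (op add rt rs rcur ⨾ load rcur rt))
nearest   = op eq re ri rroot ⨾
            ifnz re (const rval 0)
                    ((load rcur ri ⨾ move rs rthr) ⨾ while rs climb ⨾ op add rt rD rcur ⨾ load rval rt)
logarithm = const rval 0 ⨾ op lt re rone ri ⨾
            ifnz re (op div rt ri rtwo ⨾ op add rt rdst rt ⨾ load rt rt ⨾ op add rval rstride rt) nop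
searching = (op add rD rp rN ⨾ op add rD rD rN ⨾ op add rbP rD rN ⨾ op add rbP rbP rN ⨾
             move rend rp ⨾ op add rthr rstride rp ⨾ move rdst rthr) ⨾
            fill nearest ⨾
            (op add rlg rthr rN ⨾ move rdst rlg) ⨾ fill logarithm ⨾ op add rq rlg rN

-- The array allocated to z at address x holds in cell x + i the lightest of the
-- i lowest edges above z.  The pointer stored is depth z + x, so that the cell for
-- the path from z up to u is found by subtracting the depth of u.
runningMin allocate setPointer allocStep alignStep chunkStep chunks : Program
runningMin = move rval rbest ⨾ op eq re rcur rroot ⨾
             ifnz re nop (oracle re rcur rbest ⨾ ifnz re (move rbest rcur) nop ⨾ load rcur rcur)
allocate   = (store rs rfree ⨾ move rx rfree ⨾ move rdst rfree ⨾ move rlim rlen ⨾ move rcur rz ⨾ move rbest rz) ⨾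
             fill runningMin ⨾ op add rfree rfree rlen ⨾ move rlim rN
setPointer = op add rt rD rz ⨾ load rt rt ⨾ op add rt rt rx ⨾ op add ru rP rv ⨾ store ru rt
allocStep  = (op add rt rD rv ⨾ load rt rt ⨾ op lt re rt rpw) ⨾
             ifnz re nop
               ((op add rt rp rv ⨾ load rt rt ⨾ op add rt rq rt ⨾ load rz rt ⨾ op add rs rslot rz ⨾ load rx rs) ⨾
                ifnz rx nop allocate ⨾ setPointer) ⨾
             op add rv rv rone ⨾ op lt rgo′ rv rN
alignStep  = op add rt rq ri ⨾ load rval rt ⨾ op add ru rD rval ⨾ load ru ru ⨾ op mod ru ru rdouble ⨾
             ifnz ru (op add ru rp rval ⨾ load rval ru) nop
chunkStep  = (op add rslot rq rN ⨾ move rdst rslot) ⨾ fill (const rval 0) ⨾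
             (op add rP rslot rN ⨾ op add rfree rP rN ⨾ op add rdouble rpw rpw ⨾ op add rlen rdouble rpw ⨾
              const rv 0 ⨾ op lt rgo′ rv rN) ⨾
             while rgo′ allocStep ⨾
             op add rdst rstride rq ⨾ fill alignStep ⨾
             op add rp rstride rp ⨾ move rq rdst ⨾ move rpw rdouble ⨾ op lt rgo rp rend
chunks     = move rdst rq ⨾ fill (move rval ri) ⨾
             (const rp 0 ⨾ const rpw 1 ⨾ op lt rgo rp rend) ⨾ while rgo chunkStep

-- Register rbP is such that rbP + base (suc k) is the address of the pointers in chunk k.
preprocessing distance lookUp follow answering : Program
preprocessing = doubling ⨾ searching ⨾ chunks
distance  = op add rt rD 0 ⨾ load rt rt ⨾ op add ru rD 1 ⨾ load ru ru ⨾ op sub rx rt ru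
lookUp    = op add rx rlg rx ⨾ load rx rx ⨾ op add rt rx rN ⨾ op add rt rt 0 ⨾ load rt rt ⨾
            op add rs rthr rt ⨾ load rs rs ⨾ op lt re ru rs
follow    = op add rx rbP rx ⨾ op add rx rx 0 ⨾ load rx rx ⨾ op sub rx rx ru ⨾ load 0 rx
answering = distance ⨾ ifnz rx (lookUp ⨾ ifnz re follow (move 0 rt)) (move 0 rN)

-- Standing assumptions, memory bounds and the meaning of the level tables

tables space : ℕ → ℕ → ℕ
tables n lg  = (2 + lg) * (6 * n)
space  n lg  = tables n lg + n + n + tables n lg + n

-- The logarithm of the height enters through three properties: `lg-max` bounds the number of
-- doubling rounds, `lg-small` keeps the array lengths 3 · 2 ^ k within a word, and `fits` makes
-- every address a word.
record Setting : Set₁ where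
  field
    tree    : WeightedTree
  open WeightedTree tree
  field
    lg w    : ℕ
    lg-max  : ∀ k {v} → v < size → 2 ^ k < depth v → k ≤ lg
    lg-small : 2 ^ lg ≤ size
    fits    : space size lg < 2 ^ w
    E       : Set
    ident   : E → ℕ
    edgeLess : E → E → Bool
    edges    : ∀ {x y} → x < size × x ≢ root → y < size × y ≢ root →
              ∃[ e ] ∃[ f ] (x ≡ ident e × y ≡ ident f × edgeLess e f ≡ lighter x y)

-- The top level is found by the run of the doubling loop, so everything after that loop takes it as
-- a parameter.
record TopLevel (X : Setting) : Set where
  constructor topLevel
  open Setting X
  open WeightedTree tree
  field
    K    : ℕ
    K≤   : K ≤ suc lg
    deep : ∀ {v} → v < size → depth v ≤ 2 ^ K

module Context (X : Setting) where
  open Setting X public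
  open TreeTheory tree public renaming (size to n)

  S : ℕ
  S = space n lg

  open Hoare w S ident edgeLess public

  S<W : S < 2 ^ w
  S<W = fits

  0<n : 0 < n
  0<n = m<n⇒0<n root<size

  str : ℕ
  str = 6 * n

  base : ℕ → ℕ
  base k = k * str

  infixl 6 _⊕_
  -- Time bounds are collected in the form `n * a`; as `n` is positive, a constant `c` is charged as
  -- `n * c`.
  _⊕_ : ∀ {x y a b} → x ≤ n * a → y ≤ n * b → x + y ≤ n * (a + b)
  _⊕_ {a = a} {b} p q = ≤-trans (+-mono-≤ p q) (≤-reflexive (sym (*-distribˡ-+ n a b)))

  constant : ∀ c → c ≤ n * c
  constant c = ≤-trans (≤-reflexive (sym (*-identityˡ c))) (*-monoˡ-≤ c 0<n)

  fill-time : ∀ T → 2 + suc (n * suc (T + 4)) ≤ n * (3 + suc (T + 4))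
  fill-time T = constant 3 ⊕ ≤-refl

  Below : ℕ → (ℕ → ℕ) → (ℕ → ℕ) → Set
  Below lim m m′ = ∀ a → a < lim → m′ a ≡ m a

  below : ∀ {b len m m′ lim} → lim ≤ b → Outside b len m m′ → Below lim m m′
  below lim≤b out a a< = out a (inj₁ (<-≤-trans a< lim≤b))

  below-trans : ∀ {l m m′ m″} → Below l m m′ → Below l m′ m″ → Below l m m″
  below-trans b b′ a a< = trans (b′ a a<) (b a a<)

  keep : ∀ {b G len m m′ lim} → b + len ≤ lim → Below lim m m′ → Filled b G len m → Filled b G len m′
  at (keep {b} {G} {len} le bel f) {i} i< = subst (G i) (sym (bel (b + i) (<-≤-trans (+-monoʳ-< b i<) le))) (at f i<)

  JumpAt MinAt DepthAt : ℕ → ℕ → ℕ → Set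
  JumpAt  k v x = x ≡ anc (2 ^ k) v
  MinAt   k v x = v ≢ root → IsMin x v (2 ^ k)
  DepthAt k v x = x ≡ depth v ⊓ 2 ^ k

  record Table (k : ℕ) (m : ℕ → ℕ) : Set where
    constructor level
    field
      jump  : Filled (base k) (JumpAt k) n m
      low   : Filled (base k + n) (MinAt k) n m
      depth⊓ : Filled (base k + n + n) (DepthAt k) n m

  Levels : ℕ → (ℕ → ℕ) → Set
  Levels K m = ∀ k → k ≤ K → Table k m

  room : ∀ k → base k + n + n + n ≤ base (suc k)
  room k = ≤-trans (≤-reflexive assoc₁) (≤-trans (+-monoʳ-≤ (base k) (m≤m+n (n + (n + n)) (n + (n + (n + 0)))))
             (≤-reflexive (trans (+-comm (base k) _) (cong (_+ base k) assoc₂))))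
    where
    assoc₁ : base k + n + n + n ≡ base k + (n + (n + n))
    assoc₁ = trans (+-assoc (base k + n) n n) (+-assoc (base k) n (n + n))
    assoc₂ : n + (n + n) + (n + (n + (n + 0))) ≡ str
    assoc₂ = trans (+-assoc n (n + n) _) (cong (n +_) (+-assoc n n _))

  room₂ : ∀ k → base k + n + n ≤ base (suc k)
  room₂ k = ≤-trans (m≤m+n _ n) (room k)

  room₁ : ∀ k → base k + n ≤ base (suc k)
  room₁ k = ≤-trans (m≤m+n _ n) (room₂ k)

  level-keep : ∀ {k m m′ lim} → base (suc k) ≤ lim → Below lim m m′ → Table k m → Table k m′
  level-keep {k} le bel (level j l d) =
    level (keep (≤-trans (room₁ k) le) bel j) (keep (≤-trans (room₂ k) le) bel l) (keep (≤-trans (room k) le) bel d)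

  levels-keep : ∀ {K m m′} → Below (base (suc K)) m m′ → Levels K m → Levels K m′
  levels-keep bel lv k k≤ = level-keep (*-monoˡ-≤ str (s≤s k≤)) bel (lv k k≤)

  record Constants (N one two rt st lim : ℕ) : Set where
    constructor constants
    field
      size≡   : N ≡ n
      one≡    : one ≡ 1
      two≡    : two ≡ 2
      root≡   : rt ≡ root
      stride≡ : st ≡ str
      limit≡  : lim ≡ n

  Const : (Reg → ℕ) → Set
  Const ρ = Constants (ρ rN) (ρ rone) (ρ rtwo) (ρ rroot) (ρ rstride) (ρ rlim)

  tables≤ : ∀ {k} → k ≤ 2 + lg → base k ≤ tables n lg
  tables≤ = *-monoˡ-≤ str

  tables≤S : tables n lg ≤ S
  tables≤S = ≤-trans (m≤m+n _ n) (≤-trans (m≤m+n _ n) (≤-trans (m≤m+n _ (tables n lg)) (m≤m+n _ n)))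

  word : ∀ {x} → x ≤ S → x < 2 ^ w
  word x≤S = ≤-<-trans x≤S S<W

  word< : ∀ {x y} → x < y → y ≤ S → x < 2 ^ w
  word< x< y≤ = word (≤-trans (<⇒≤ x<) y≤)

  2≤S : 2 ≤ S
  2≤S = ≤-trans (≤-trans (m≤m*n 2 n {{>-nonZero 0<n}}) (*-monoˡ-≤ n {2} {6} (s≤s (s≤s z≤n)))) (≤-trans (m≤m+n str _) tables≤S)

-- Binary lifting

module Doubling (X : Setting) where
  open Context X
  open +-*-Solver using (solve; _:=_; _:+_; _:*_; con)

  2^suc : ∀ k → 2 ^ k + 2 ^ k ≡ 2 ^ suc k
  2^suc k = cong (2 ^ k +_) (sym (+-identityʳ (2 ^ k)))

  anc-double : ∀ k v → anc (2 ^ k) (anc (2 ^ k) v) ≡ anc (2 ^ suc k) v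
  anc-double k v = trans (sym (anc-+ (2 ^ k) (2 ^ k) v)) (cong (λ j → anc j v) (2^suc k))

  -- With `p = 2 ^ k`, the second summand is the cut-off depth of the ancestor `p` steps up: depths
  -- can be added up by doubling like the other tables.
  ⊓-double : ∀ d p → d ⊓ p + (d ∸ p) ⊓ p ≡ d ⊓ (p + p)
  ⊓-double d p with ≤-total d p
  ... | inj₁ d≤p = trans (cong₂ _+_ (m≤n⇒m⊓n≡m d≤p) (cong (_⊓ p) (m≤n⇒m∸n≡0 d≤p)))
                   (trans (+-identityʳ d) (sym (m≤n⇒m⊓n≡m (≤-trans d≤p (m≤m+n p p)))))
  ... | inj₂ p≤d = trans (cong (_+ (d ∸ p) ⊓ p) (m≥n⇒m⊓n≡n p≤d))
                   (trans (+-distribˡ-⊓ p (d ∸ p) p) (cong (_⊓ (p + p)) (m+[n∸m]≡n p≤d)))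

  -- A raised flag licenses another round. It comes from a node deeper than 2 ^ k, whence `k ≤ lg`
  -- by `lg-max`, except at `k = 0`, where it is set at the start and the bound is trivial. A
  -- lowered flag certifies that level `k` can be the top.
  Flag : ℕ → ℕ → ℕ → Set
  Flag k i f = (f ≢ 0 → k ≤ lg) × (f ≡ 0 → ∀ {j} → j < i → depth j ≤ 2 ^ k)

  record LevelInv (k : ℕ) (s : State) : Set where
    constructor inv
    field
      const≡ : Const (reg s)
      base≡  : reg s rp ≡ base k
      flag   : Flag k n (reg s rflag)
      levels : Levels k (mem s)

  module Step {k : ℕ} {s : State} (k≤lg : k ≤ lg) (c : Const (reg s)) (p≡ : reg s rp ≡ base k)
              (pM≡ : reg s rpM ≡ base k + n) (pD≡ : reg s rpD ≡ base k + n + n)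
              (lv : Table k (mem s)) where

    Regs : (Reg → ℕ) → Set
    Regs ρ = Const ρ × ρ rp ≡ base k × ρ rpM ≡ base k + n × ρ rpD ≡ base k + n + n

    lim≤ : base (suc k) + n + n + n ≤ S
    lim≤ = ≤-trans (room (suc k)) (≤-trans (tables≤ (s≤s (s≤s k≤lg))) tables≤S)

    in₀ : ∀ {i} → i < n → base k + i < base (suc k)
    in₀ i< = <-≤-trans (+-monoʳ-< (base k) i<) (room₁ k)
    in₁ : ∀ {i} → i < n → base k + n + i < base (suc k)
    in₁ i< = <-≤-trans (+-monoʳ-< (base k + n) i<) (room₂ k)
    in₂ : ∀ {i} → i < n → base k + n + n + i < base (suc k)
    in₂ i< = <-≤-trans (+-monoʳ-< (base k + n + n) i<) (room k)

    next≤S : base (suc k) ≤ S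
    next≤S = ≤-trans (≤-trans (≤-trans (m≤m+n _ n) (m≤m+n _ n)) (m≤m+n _ n)) lim≤

    S< : ∀ {a} → a < base (suc k) → a < S
    S< a< = <-≤-trans a< next≤S
    W< : ∀ {a} → a < base (suc k) → a < 2 ^ w
    W< a< = word< a< next≤S

    jump-rule : ∀ {s′} → Below (base (suc k)) (mem s) (mem s′) → Regs (reg s′) → reg s′ rdst ≡ base (suc k) →
                reg s′ rflag ≡ 0 →
                ⟪ fill jumpStep ⟫ s′ (n * 15) (λ s″ → Outside (base (suc k)) n (mem s′) (mem s″) ×
                  Filled (base (suc k)) (JumpAt (suc k)) n (mem s″) ×
                  Regs (reg s″) × reg s″ rdst ≡ base (suc k) × Flag (suc k) n (reg s″ rflag))
    jump-rule {s′} bel regs dst≡ f≡ = weaken (fill-time (cost jumpStep)) (λ h → h)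
      (fill-rule R (JumpAt (suc k)) S<W (≤-trans (≤-trans (m≤m+n _ n) (m≤m+n _ n)) lim≤)
        (λ _ _ _ h → h) (λ _ _ _ _ _ h → h) compute dst≡ (Constants.limit≡ (proj₁ regs)) (Constants.one≡ (proj₁ regs))
        (regs , dst≡ , (λ f≢ → ⊥-elim (f≢ f≡)) , λ _ ()))
      where
      R : ℕ → (Reg → ℕ) → Set
      R i ρ = Regs ρ × ρ rdst ≡ base (suc k) × Flag (suc k) i (ρ rflag)
      compute : ∀ {i s″} → i < n → Ctl (base (suc k)) n i (reg s″) → R i (reg s″) →
        Outside (base (suc k)) n (mem s′) (mem s″) → Filled (base (suc k)) (JumpAt (suc k)) i (mem s″) →
        ⟪ jumpStep ⟫ s″ (cost jumpStep) (λ t → mem t ≡ mem s″ × Ctl (base (suc k)) n i (reg t) × R (suc i) (reg t) × JumpAt (suc k) i (reg t rval))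
      compute {i} {s″} i< ct@(ctl i≡ _ _ _) (regs@(c′ , p≡′ , _) , d≡ , fl) out _ = straight
        (_ , add= p≡′ i≡ (W< (in₀ i<)) , _ , S< (in₀ i<) , at jumps i< ,
         _ , add= p≡′ refl (W< (in₀ y<)) , _ , S< (in₀ y<) , trans (at jumps y<) (anc-double k i) ,
         _ , eq= {a = anc (2 ^ suc k) i} refl (Constants.root≡ c′) ,
         (λ ≢0 → refl , ct , (regs , d≡ , proj₁ fl ,
           λ f≡0 {j} j< → [ proj₂ fl f≡0 , (λ { refl → anc≡root⇒ i< (bit-eq≢0 (anc (2 ^ suc k) i) root ≢0) }) ]′ (m≤n⇒m<n∨m≡n (≤-pred j<))) , refl) ,
         (λ ≡0 → word (≤-trans (s≤s z≤n) 2≤S) , refl , ct ,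
           (regs , d≡ , (λ _ → lg-max (suc k) i< (anc≢root⇒ i< (bit-eq≡0 (anc (2 ^ suc k) i) root ≡0))) , λ ()) , refl))
        where
        y< = anc< (2 ^ k) i<
        jumps : Filled (base k) (JumpAt k) n (mem s″)
        jumps = keep (room₁ k) (below-trans bel (below ≤-refl out)) (Table.jump lv)

    min-rule : ∀ {s′ b} → base (suc k) ≤ b → b + n ≤ S → Below (base (suc k)) (mem s) (mem s′) →
               Regs (reg s′) → reg s′ rdst ≡ b →
               ⟪ fill minStep ⟫ s′ (n * 19) (λ s″ → Outside b n (mem s′) (mem s″) ×
                 Filled b (MinAt (suc k)) n (mem s″) ×
                 Regs (reg s″) × reg s″ rdst ≡ b × reg s″ rflag ≡ reg s′ rflag)
    min-rule {s′} {b} ≤b b+n≤ bel regs dst≡ = weaken (fill-time (cost minStep)) (λ h → h)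
      (fill-rule R (MinAt (suc k)) S<W b+n≤
        (λ _ _ _ h → h) (λ _ _ _ _ _ h → h) compute dst≡ (Constants.limit≡ (proj₁ regs)) (Constants.one≡ (proj₁ regs))
        (regs , dst≡ , refl))
      where
      R : ℕ → (Reg → ℕ) → Set
      R i ρ = Regs ρ × ρ rdst ≡ b × ρ rflag ≡ reg s′ rflag
      compute : ∀ {i s″} → i < n → Ctl b n i (reg s″) → R i (reg s″) →
        Outside b n (mem s′) (mem s″) → Filled b (MinAt (suc k)) i (mem s″) →
        ⟪ minStep ⟫ s″ (cost minStep) (λ t → mem t ≡ mem s″ × Ctl b n i (reg t) × R (suc i) (reg t) × MinAt (suc k) i (reg t rval))
      compute {i} {s″} i< ct@(ctl i≡ _ _ _) r@((c′ , p≡′ , pM≡′ , _) , _) out _ = straight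
        (_ , add= p≡′ i≡ (W< (in₀ i<)) , _ , S< (in₀ i<) , at jumps i< ,
         _ , add= pM≡′ i≡ (W< (in₁ i<)) , _ , S< (in₁ i<) , refl ,
         _ , eq= {a = y} refl (Constants.root≡ c′) ,
         -- Here the upper half of the window is empty, and no oracle call is permitted on the root.
         (λ ≢0 → refl , ct , r , λ i≢ →
            isMin-short i< (bit-eq≢0 y root ≢0) (≤-trans (m≤m+n (2 ^ k) _) ≤-refl) (at lows i< i≢)) ,
         λ ≡0 → let y≢ = bit-eq≡0 y root ≡0
                    i≢ = λ i≡root → y≢ (trans (cong (anc (2 ^ k)) i≡root) (anc-root (2 ^ k)))
                    lowᵢ = at lows i< i≢
                    lowy = at lows y< y≢
                    e , f , e≡ , f≡ , less≡ = edges (isMin-edge y< lowy) (isMin-edge i< lowᵢ)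
                in _ , add= pM≡′ refl (W< (in₁ y<)) , _ , S< (in₁ y<) , refl ,
                   _ , (e , f , e≡ , f≡ , cong bit less≡) ,
                   (λ b≢0 → refl , ct , r , λ _ →
                      isMin-≡ refl (2^suc k) (isMin-replace i< (m^n>0 2 k) lowᵢ lowy (bit≢0 b≢0))) ,
                   (λ b≡0 → refl , ct , r , λ _ → isMin-≡ refl (2^suc k) (isMin-keep i< lowᵢ lowy (bit≡0 b≡0))))
        where
        y = anc (2 ^ k) i
        y< = anc< (2 ^ k) i<
        bel′ = below-trans bel (below ≤b out)
        jumps : Filled (base k) (JumpAt k) n (mem s″)
        jumps = keep (room₁ k) bel′ (Table.jump lv)
        lows : Filled (base k + n) (MinAt k) n (mem s″)
        lows = keep (room₂ k) bel′ (Table.low lv)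

    depth-rule : ∀ {s′ b} → base (suc k) ≤ b → b + n ≤ S → Below (base (suc k)) (mem s) (mem s′) →
                 Regs (reg s′) → reg s′ rdst ≡ b →
                 ⟪ fill depthStep ⟫ s′ (n * 15) (λ s″ → Outside b n (mem s′) (mem s″) ×
                   Filled b (DepthAt (suc k)) n (mem s″) ×
                   Regs (reg s″) × reg s″ rflag ≡ reg s′ rflag)
    depth-rule {s′} {b} ≤b b+n≤ bel regs dst≡ = weaken (fill-time (cost depthStep)) (λ h → h)
      (fill-rule R (DepthAt (suc k)) S<W b+n≤
        (λ _ _ _ h → h) (λ _ _ _ _ _ h → h) compute dst≡ (Constants.limit≡ (proj₁ regs)) (Constants.one≡ (proj₁ regs))
        (regs , refl))
      where
      R : ℕ → (Reg → ℕ) → Set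
      R i ρ = Regs ρ × ρ rflag ≡ reg s′ rflag
      compute : ∀ {i s″} → i < n → Ctl b n i (reg s″) → R i (reg s″) →
        Outside b n (mem s′) (mem s″) → Filled b (DepthAt (suc k)) i (mem s″) →
        ⟪ depthStep ⟫ s″ (cost depthStep) (λ t → mem t ≡ mem s″ × Ctl b n i (reg t) × R (suc i) (reg t) × DepthAt (suc k) i (reg t rval))
      compute {i} {s″} i< ct@(ctl i≡ _ _ _) r@((c′ , p≡′ , _ , pD≡′) , _) out _ = straight
        (_ , add= p≡′ i≡ (W< (in₀ i<)) , _ , S< (in₀ i<) , at jumps i< ,
         _ , add= pD≡′ refl (W< (in₂ y<)) , _ , S< (in₂ y<) , at depths y< ,
         _ , add= pD≡′ i≡ (W< (in₂ i<)) , _ , S< (in₂ i<) , at depths i< ,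
         _ , trans (wrap-small (subst (_< 2 ^ w) (sym sum≡) small)) sum≡ , refl , ct , r , refl)
        where
        y = anc (2 ^ k) i
        y< = anc< (2 ^ k) i<
        bel′ = below-trans bel (below ≤b out)
        jumps : Filled (base k) (JumpAt k) n (mem s″)
        jumps = keep (room₁ k) bel′ (Table.jump lv)
        depths : Filled (base k + n + n) (DepthAt k) n (mem s″)
        depths = keep (room k) bel′ (Table.depth⊓ lv)
        sum≡ : depth i ⊓ 2 ^ k + depth y ⊓ 2 ^ k ≡ depth i ⊓ 2 ^ suc k
        sum≡ = trans (cong (λ d → depth i ⊓ 2 ^ k + d ⊓ 2 ^ k) (depth-anc (2 ^ k) i<))
               (trans (⊓-double (depth i) (2 ^ k)) (cong (depth i ⊓_) (2^suc k)))
        small : depth i ⊓ 2 ^ suc k < 2 ^ w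
        small = ≤-<-trans (m⊓n≤m (depth i) _) (word< (depth<size i<) (≤-trans (m≤n+m n b) b+n≤))

  levelStep-rule : ∀ {k s} → k ≤ lg → LevelInv k s → ⟪ levelStep ⟫ s (n * 56) (LevelInv (suc k))
  levelStep-rule {k} {s} k≤lg (inv c@(constants n≡ one≡ _ _ st≡ _) p≡ _ lvs) =
    weaken (constant 4 ⊕ (≤-refl {n * 15} ⊕ (constant 1 ⊕ (≤-refl {n * 19} ⊕ (constant 1 ⊕ (≤-refl {n * 15} ⊕ constant 1)))))) (λ h → h)
      (straightThen
        (_ , add= p≡ n≡ (word (≤-trans (room₁ k) next≤S)) ,
         _ , add= refl n≡ (word (≤-trans (room₂ k) next≤S)) ,
         _ , add= st≡ p≡ (word next≤S) , word z≤n , after c p≡ refl refl refl refl refl))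
    where
    next≤S : base (suc k) ≤ S
    next≤S = ≤-trans (tables≤ (m≤n⇒m≤1+n (s≤s k≤lg))) tables≤S
    after : ∀ {s₁} → Const (reg s₁) → reg s₁ rp ≡ base k → reg s₁ rpM ≡ base k + n → reg s₁ rpD ≡ base k + n + n →
            reg s₁ rdst ≡ base (suc k) → reg s₁ rflag ≡ 0 → mem s₁ ≡ mem s →
            ⟪ fill jumpStep ⨾ op add rdst rdst rN ⨾ fill minStep ⨾ op add rdst rdst rN ⨾ fill depthStep ⨾ op add rp rstride rp ⟫ s₁
              _ (LevelInv (suc k))
    after {s₁} c₁ p₁ pM₁ pD₁ d₁ f₁ m≡ =
      jump-rule (λ _ _ → refl) (c₁ , p₁ , pM₁ , pD₁) d₁ f₁ andThen λ { (outJ , jumps , regs₂ , d₂ , fl₂) →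
      straightThen (_ , add= d₂ (Constants.size≡ (proj₁ regs₂)) (word b₁≤S) ,
      (min-rule (m≤m+n _ n) b₂≤S (below ≤-refl outJ) regs₂ refl andThen λ { (outM , lows , regs₃ , d₃ , f₃) →
      straightThen (_ , add= d₃ (Constants.size≡ (proj₁ regs₃)) (word b₂≤S) ,
      (depth-rule (≤-trans (m≤m+n _ n) (m≤m+n _ n)) lim≤ (below-trans (below ≤-refl outJ) (below (m≤m+n _ n) outM)) regs₃ refl
         andThen λ { (outD , depths , (c₄ , p₄ , _) , f₄) →
      straight (_ , add= (Constants.stride≡ c₄) p₄ (word next≤S) ,
        inv c₄ refl (subst (Flag (suc k) n) (sym (trans f₄ f₃)) fl₂)
          (λ j j≤ → [ (λ { (s≤s j≤k) → level-keep (*-monoˡ-≤ str (s≤s j≤k))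
                              (below-trans (below ≤-refl outJ) (below-trans (below (m≤m+n _ n) outM) (below (≤-trans (m≤m+n _ n) (m≤m+n _ n)) outD)))
                              (lvs′ j j≤k) }) ,
                      (λ { refl → level (beforeJ outM outD jumps) (keep ≤-refl (below ≤-refl outD) lows) depths }) ]′ (m≤n⇒m<n∨m≡n j≤))) })) })) }
      where
      lvs′ : Levels k (mem s₁)
      lvs′ = subst (Levels k) (sym m≡) lvs
      open Step {k} {s₁} k≤lg c₁ p₁ pM₁ pD₁ (lvs′ k ≤-refl) hiding (next≤S)
      b₂≤S : base (suc k) + n + n ≤ S
      b₂≤S = ≤-trans (m≤m+n _ n) lim≤
      b₁≤S : base (suc k) + n ≤ S
      b₁≤S = ≤-trans (m≤m+n _ n) b₂≤S
      beforeJ : ∀ {m m′ m″} → Outside (base (suc k) + n) n m m′ → Outside (base (suc k) + n + n) n m′ m″ →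
                Filled (base (suc k)) (JumpAt (suc k)) n m → Filled (base (suc k)) (JumpAt (suc k)) n m″
      beforeJ outM outD jumps = keep (m≤m+n _ n) (below ≤-refl outD) (keep ≤-refl (below ≤-refl outM) jumps)

  record Doubled (s : State) : Set where
    constructor doubled
    field
      top    : TopLevel X
    open TopLevel top
    field
      const≡ : Const (reg s)
      base≡  : reg s rp ≡ base K
      levels : Levels K (mem s)

  doubling-loop : ∀ {s} → LevelInv 0 s → ⟪ while rflag levelStep ⟫ s (suc (suc lg * suc (n * 56))) Doubled
  doubling-loop {s} i₀ = weaken ≤-refl finish
    (for-rule (λ k s → k ≤ suc lg × LevelInv k s) (suc lg) (n * 56) proj₁ step (z≤n , i₀))
    where
    step : ∀ {k s} → k ≤ suc lg × LevelInv k s → reg s rflag ≢ 0 →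
           k < suc lg × ⟪ levelStep ⟫ s (n * 56) (λ s′ → suc k ≤ suc lg × LevelInv (suc k) s′)
    step (_ , i) ≢0 = let k≤lg = proj₁ (LevelInv.flag i) ≢0
                      in s≤s k≤lg , weaken ≤-refl (λ i′ → s≤s k≤lg , i′) (levelStep-rule k≤lg i)
    finish : ∀ {s′} → reg s′ rflag ≡ 0 × ∃[ k ] (k ≤ suc lg × LevelInv k s′) → Doubled s′
    finish (≡0 , k , k≤ , inv c p≡ fl lv) = doubled (topLevel k k≤ (λ v< → proj₂ fl ≡0 v<)) c p≡ lv

  doubling-rule : ∀ {s} → reg s 0 ≡ n → (∀ {v} → v < n → mem s v ≡ parent v) →
                  ⟪ doubling ⟫ s (n * 34 + suc lg * (n * 57)) Doubled
  doubling-rule {s} n≡ parents =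
    weaken time (λ h → h)
      (straightThen (1<W , 2<W , _ , add= n≡ n≡ (word 2n≤) , _ , wrap-small (word 4n≤) ,
         _ , trans (wrap-small (word 6n≤)) six , word z≤n ,
       (weaken (fill-time 1) (λ h → h) (fill-rule (λ _ → Regs n) (MinAt 0) S<W 2n≤ (λ _ _ _ h → h) (λ _ _ _ _ _ h → h)
         (λ { {i} {s′} i< ct@(ctl i≡ _ _ _) r out _ → straight
            (refl , ct , r , λ i≢ → subst (λ x → IsMin x i 1) (sym i≡) (isMin-self 1 i< (λ e → i≢ e) ≤-refl)) })
         n≡ n≡ refl (n≡ , refl , refl , refl , n≡ , refl , n≡))
       andThen λ { (outM , lows , (N≡ , one≡ , two≡ , st≡ , lim≡ , p≡ , d≡)) →
       straightThen (_ , add= d≡ N≡ (word 2n≤) ,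
       (weaken (fill-time 5) (λ h → h) (fill-rule R (DepthAt 0) S<W 3n≤ (λ _ _ _ h → h) (λ _ _ _ _ _ h → h)
         (λ { {i} {s′} i< ct@(ctl i≡ _ _ _) r out _ → depth-compute i< ct r
              (λ v< → trans (out _ (inj₁ (<-≤-trans v< (m≤m+n n n)))) (trans (outM _ (inj₁ v<)) (parents v<))) })
         refl lim≡ one≡ ((N≡ , one≡ , two≡ , st≡ , lim≡ , p≡ , refl) , λ ()))
       andThen λ { (outD , depths , ((N≡ , one≡ , two≡ , st≡ , lim≡ , p≡ , d≡) , rt≡)) →
       straightThen (1<W ,
       doubling-loop (inv (constants N≡ one≡ two≡ (rt≡ root<size) st≡ lim≡) p≡
         ((λ _ → z≤n) , (λ ()))
         (λ { zero z≤n → level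
           (filled λ v< → trans (outD _ (inj₁ (<-≤-trans v< (m≤m+n n n)))) (trans (outM _ (inj₁ v<)) (parents v<)))
           (keep ≤-refl (below ≤-refl outD) lows) depths }))) })) })))
    where
    1<W : 1 < 2 ^ w
    1<W = word (≤-trans (s≤s z≤n) 2≤S)
    2<W : 2 < 2 ^ w
    2<W = word 2≤S
    six : n + n + (n + n + (n + n)) ≡ str
    six = solve 1 (λ x → x :+ x :+ (x :+ x :+ (x :+ x)) := con 6 :* x) refl n
    6n≤ : n + n + (n + n + (n + n)) ≤ S
    6n≤ = ≤-trans (≤-reflexive six) (≤-trans (m≤m+n str _) tables≤S)
    4n≤ : n + n + (n + n) ≤ S
    4n≤ = ≤-trans (m≤n+m (n + n + (n + n)) (n + n)) 6n≤
    3n≤ : n + n + n ≤ S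
    3n≤ = ≤-trans (+-monoʳ-≤ (n + n) (m≤m+n n n)) 4n≤
    2n≤ : n + n ≤ S
    2n≤ = ≤-trans (m≤m+n (n + n) n) 3n≤
    Regs : ℕ → (Reg → ℕ) → Set
    Regs d ρ = ρ rN ≡ n × ρ rone ≡ 1 × ρ rtwo ≡ 2 × ρ rstride ≡ str × ρ rlim ≡ n × ρ rp ≡ 0 × ρ rdst ≡ d
    -- The root is discovered during this scan, so its register is known to be right only from the
    -- index after the root onwards.
    R : ℕ → (Reg → ℕ) → Set
    R i ρ = Regs (n + n) ρ × (root < i → ρ rroot ≡ root)
    depth-compute : ∀ {i s′} → i < n → Ctl (n + n) n i (reg s′) → R i (reg s′) → (∀ {v} → v < n → mem s′ v ≡ parent v) →
      ⟪ depthInit ⟫ s′ 5 (λ t → mem t ≡ mem s′ × Ctl (n + n) n i (reg t) × R (suc i) (reg t) × DepthAt 0 i (reg t rval))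
    depth-compute {i} {s′} i< ct@(ctl i≡ _ _ _) (regs , rt≡) par≡ = straight
      (_ , subst (_< S) (sym i≡) (<-≤-trans i< n≤) , trans (cong (mem s′) i≡) (par≡ i<) ,
       _ , eq= {a = parent i} refl i≡ ,
       (λ ≢0 → let i≡root = parent-fix i< (bit-eq≢0 (parent i) i ≢0) in
          word z≤n , refl , ct , (regs , λ _ → trans i≡ i≡root) , sym (cong (_⊓ 1) (trans (cong depth i≡root) depth-root))) ,
       (λ ≡0 → let i≢ = λ i≡root → bit-eq≡0 (parent i) i ≡0 (subst (λ x → parent x ≡ x) (sym i≡root) parent-root) in
          1<W , refl , ct , (regs , λ { (s≤s r≤i) → rt≡ (≤∧≢⇒< r≤i λ e → i≢ (sym e)) }) ,
          sym (trans (cong (_⊓ 1) (depth-step i< i≢)) (cong suc (⊓-zeroʳ _)))))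
      where
      n≤ : n ≤ S
      n≤ = ≤-trans (m≤m+n n n) 2n≤
    time : 9 + (n * 9 + (1 + (n * 13 + (1 + suc (suc lg * suc (n * 56)))))) ≤ n * 34 + suc lg * (n * 57)
    time = ≤-trans (≤-reflexive (regroup (n * 9) (n * 13) (suc lg * suc (n * 56))))
      (+-mono-≤ (constant 9 ⊕ ≤-refl {n * 9} ⊕ constant 1 ⊕ ≤-refl {n * 13} ⊕ constant 2)
                (*-monoʳ-≤ (suc lg) (constant 1 ⊕ ≤-refl {n * 56})))
      where
      regroup : ∀ a b x → 9 + (a + (1 + (b + (1 + suc x)))) ≡ 9 + a + 1 + b + 2 + x
      regroup = solve 3 (λ a b x → con 9 :+ (a :+ (con 1 :+ (b :+ (con 1 :+ (con 1 :+ x))))) := con 9 :+ a :+ con 1 :+ b :+ con 2 :+ x) refl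

-- Nearest lighter ancestors and logarithms

module Searching (X : Setting) (B : TopLevel X) where
  open Context X
  open TopLevel B
  open +-*-Solver using (solve; _:=_; _:+_; _:*_; con)

  thr0 lg0 chunk0 : ℕ
  thr0 = base (suc K)
  lg0  = thr0 + n
  chunk0 = thr0 + n + n

  thr0≤ : thr0 ≤ tables n lg
  thr0≤ = tables≤ (s≤s K≤)

  chunk0≤ : ∀ {k} → k ≤ suc K → chunk0 + base k + n ≤ S
  chunk0≤ k≤ = +-monoˡ-≤ n (+-mono-≤ (+-monoˡ-≤ n (+-monoˡ-≤ n thr0≤)) (tables≤ (≤-trans k≤ (s≤s K≤))))

  chunk0≤S : chunk0 ≤ S
  chunk0≤S = ≤-trans (m≤m+n _ (base 0)) (≤-trans (m≤m+n _ n) (chunk0≤ z≤n))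

  lg0≤S : lg0 ≤ S
  lg0≤S = ≤-trans (m≤m+n _ n) chunk0≤S

  thr0≤S : thr0 ≤ S
  thr0≤S = ≤-trans (m≤m+n _ n) lg0≤S

  record PointerValues (D th l en bP : ℕ) : Set where
    constructor pointers
    field
      depths≡ : D ≡ base K + n + n
      thr≡    : th ≡ thr0
      lg≡     : l ≡ lg0
      end≡    : en ≡ base K
      bP≡     : bP ≡ base K + n + n + n + n

  Pointers : (Reg → ℕ) → Set
  Pointers ρ = PointerValues (ρ rD) (ρ rthr) (ρ rlg) (ρ rend) (ρ rbP)

  -- LogAt claims nothing for i > 2 ^ K, where base j may exceed the word size.
  NearAt LogAt : ℕ → ℕ → Set
  NearAt x d = x ≢ root → ∃[ c ] (c < n × Smaller c x × d ≡ depth c)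
  LogAt  i x = 0 < i → i ≤ 2 ^ K → ∃[ j ] (2 ^ j ≤ i × i < 2 ^ suc j × x ≡ base j)

  inJ : ∀ {k i} → k ≤ K → i < n → base k + i < thr0
  inJ {k} k≤ i< = <-≤-trans (+-monoʳ-< (base k) i<) (≤-trans (room₁ k) (*-monoˡ-≤ str (s≤s k≤)))
  inM : ∀ {k i} → k ≤ K → i < n → base k + n + i < thr0
  inM {k} k≤ i< = <-≤-trans (+-monoʳ-< (base k + n) i<) (≤-trans (room₂ k) (*-monoˡ-≤ str (s≤s k≤)))
  inD : ∀ {k i} → k ≤ K → i < n → base k + n + n + i < thr0
  inD {k} k≤ i< = <-≤-trans (+-monoʳ-< (base k + n + n) i<) (≤-trans (room k) (*-monoˡ-≤ str (s≤s k≤)))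
  inS : ∀ {a} → a < thr0 → a < S
  inS a< = <-≤-trans a< thr0≤S
  inW : ∀ {a} → a < thr0 → a < 2 ^ w
  inW a< = word< a< thr0≤S

  parentAt : ∀ {m v} → Levels K m → v < n → m v ≡ parent v
  parentAt lv v< = at (Table.jump (lv 0 z≤n)) v<

  depthAt : ∀ {m v} → Levels K m → v < n → m (base K + n + n + v) ≡ depth v
  depthAt lv v< = trans (at (Table.depth⊓ (lv K ≤-refl)) v<) (m≤n⇒m⊓n≡m (deep v<))

  Stop : ℕ → ℕ → Set
  Stop x y = y ≡ root ⊎ lighter y x ≡ true

  -- cur lies above x, no edge from x up to cur is lighter than x, and
  -- the search ends less than 2 ^ c steps above cur.
  Search : ℕ → ℕ → ℕ → Set
  Search c x cur = (∃[ i ] (cur ≡ anc i x × (∀ l → l < i → l < depth x → lighter (anc l x) x ≡ false))) ×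
                   (∃[ b ] (b < 2 ^ c × Stop x (anc b cur)))

  -- The root is at most 2 ^ `K` steps away, possibly exactly so; the strict bound in `Search`
  -- therefore starts from `suc K`.
  search-start : ∀ {x} → x < n → Search (suc K) x (parent x)
  search-start {x} x< = (1 , refl , λ { zero _ _ → lighter-irrefl x ; (suc _) (s≤s ()) _ }) ,
    depth (parent x) , ≤-<-trans (deep (parent< x<)) (^-monoʳ-< 2 (s≤s (s≤s z≤n)) {K} ≤-refl) , inj₁ (anc≡root (parent< x<) ≤-refl)

  search-root : ∀ {c x} → Search (suc c) x root → Search c x root
  search-root {c} (above , _) = above , 0 , m^n>0 2 c , inj₁ refl

  -- The minimum of the window is itself a place to stop, fewer than 2 ^ `c` steps ahead.
  search-stay : ∀ {c x cur e} → cur < n → IsMin e cur (2 ^ c) → lighter e x ≡ true → Search (suc c) x cur → Search c x cur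
  search-stay {c} cur< ((j , _ , j≤ , refl) , _) e<x (above , _) =
    above , j , ≤-<-trans j≤ (≤-reflexive (suc-pred (2 ^ c) {{m^n≢0 2 c}})) , inj₂ e<x

  -- If the known stop lies beyond the skipped window, 2 ^ `c` steps are saved. If it lies inside,
  -- it cannot be a lighter edge and must be the root; then the jump lands on the root as well, and
  -- the remaining distance is 0.
  search-jump : ∀ {c x cur e} → x < n → IsMin e cur (2 ^ c) → lighter e x ≡ false → Search (suc c) x cur →
                Search c x (anc (2 ^ c) cur)
  search-jump {c} {x} {cur} {e} x< (_ , low) e≮x ((i , refl , none) , b , b< , stop) =
    (2 ^ c + i , sym (anc-+ (2 ^ c) i x) , none′) , ahead
    where
    none′ : ∀ l → l < 2 ^ c + i → l < depth x → lighter (anc l x) x ≡ false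
    none′ l l< l<d with l <? i
    ... | yes l<i = none l l<i l<d
    ... | no l≮i  = ≮-trans e≮x (subst (λ y → lighter y e ≡ false) (anc-∸ x i≤l)
                      (low (l ∸ i) (subst (l ∸ i <_) (m+n∸n≡m (2 ^ c) i) (∸-monoˡ-< l< i≤l))
                        (subst (l ∸ i <_) (sym (depth-anc i x<)) (∸-monoˡ-< l<d i≤l))))
      where
      i≤l = ≮⇒≥ l≮i
    ahead : ∃[ b ] (b < 2 ^ c × Stop x (anc b (anc (2 ^ c) cur)))
    ahead with b <? 2 ^ c
    ... | no b≮ = b ∸ 2 ^ c , +-cancelˡ-< (2 ^ c) _ _ (subst₂ _<_ (sym (m+[n∸m]≡n (≮⇒≥ b≮))) (cong (2 ^ c +_) (+-identityʳ (2 ^ c))) b<) ,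
                  subst (Stop x) (sym (anc-∸ cur (≮⇒≥ b≮))) stop
    ... | yes b<c = 0 , m^n>0 2 c , inj₁ (anc≡root (anc< i x<) (≤-trans short (<⇒≤ b<c)))
      where
      short : depth cur ≤ b
      short = ≮⇒≥ λ b<d → [ anc≢root (anc< i x<) b<d , (λ lt → true≢false (trans (sym lt) (≮-trans e≮x (low b b<c b<d)))) ]′ stop
        where
        true≢false : true ≢ false
        true≢false ()

  search-end : ∀ {x cur} → Search 0 x cur → Smaller cur x
  search-end ((i , cur≡ , none) , zero , _ , stop) = i , cur≡ , stop , none
  search-end (_ , suc _ , s≤s () , _)

  Regs : ℕ → (Reg → ℕ) → Set
  Regs d ρ = Const ρ × ρ rD ≡ base K + n + n × ρ rthr ≡ thr0 × ρ rend ≡ base K × ρ rbP ≡ base K + n + n + n + n × ρ rdst ≡ d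

  climb-rule : ∀ {x s} → x < n → x ≢ root → Levels K (mem s) → Regs thr0 (reg s) → reg s ri ≡ x → reg s rs ≡ thr0 → Search (suc K) x (reg s rcur) → reg s rcur < n →
               ⟪ while rs climb ⟫ s (suc ((2 + lg) * suc (cost climb))) (λ s′ → mem s′ ≡ mem s × Regs thr0 (reg s′) × reg s′ ri ≡ x × reg s′ rcur < n × Smaller (reg s′ rcur) x)
  climb-rule {x} {s} x< x≢ lv₀ regs₀ i≡₀ s≡₀ search₀ cur<₀ =
    weaken (s≤s (*-monoˡ-≤ (suc (cost climb)) (s≤s K≤))) (λ {s′} → finish {s′})
      (for-rule Inv (suc K) (cost climb) (λ { {k} (c , c+k≡ , _) → subst (k ≤_) c+k≡ (m≤n+m k c) }) step
        (suc K , +-identityʳ (suc K) , s≡₀ , regs₀ , i≡₀ , cur<₀ , search₀ , refl))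
    where
    Inv : ℕ → State → Set
    Inv k s′ = ∃[ c ] (c + k ≡ suc K × reg s′ rs ≡ base c × Regs thr0 (reg s′) × reg s′ ri ≡ x × reg s′ rcur < n × Search c x (reg s′ rcur) × mem s′ ≡ mem s)
    finish : ∀ {s′} → reg s′ rs ≡ 0 × ∃[ k ] Inv k s′ → mem s′ ≡ mem s × Regs thr0 (reg s′) × reg s′ ri ≡ x × reg s′ rcur < n × Smaller (reg s′ rcur) x
    finish (≡0 , k , zero , _ , _ , regs , i≡ , cur< , search , m≡) = m≡ , regs , i≡ , cur< , search-end search
    finish (≡0 , k , suc c , _ , s≡ , _) = ⊥-elim (<⇒≢ (≤-trans 0<n (≤-trans (m≤m+n n _) (m≤m+n str (base c)))) (sym (trans (sym s≡) ≡0)))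
    step : ∀ {k s′} → Inv k s′ → reg s′ rs ≢ 0 → k < suc K × ⟪ climb ⟫ s′ (cost climb) (Inv (suc k))
    step (zero , _ , s≡ , _) ≢0 = ⊥-elim (≢0 s≡)
    step {k} {s′} (suc c , c+k≡ , s≡ , regs@(constants n≡ _ _ root≡ st≡ _ , _) , i≡ , cur< , search , refl) ≢0 =
      subst (k <_) c+k≡ (s≤s (m≤n+m k c)) , straight
        (_ , trans (sub= s≡ st≡ (m≤m+n str (base c)) (word (≤-trans (*-monoˡ-≤ str (s≤s c≤K)) thr0≤S))) (m+n∸m≡n str (base c)) ,
         _ , eq= {a = cur} refl root≡ ,
         (λ e≢0 → c , c+sk≡ , refl , regs , i≡ , cur< ,
            subst (Search c x) (sym (bit-eq≢0 cur root e≢0)) (search-root {c} (subst (Search (suc c) x) (bit-eq≢0 cur root e≢0) search)) , refl) ,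
         λ e≡0 → let cur≢ = bit-eq≡0 cur root e≡0
                     low = at (Table.low (lv₀ c c≤K)) cur< cur≢
                     e , f , e≡ , f≡ , less≡ = edges (isMin-edge cur< low) (x< , x≢)
                 in _ , add= refl n≡ (word (≤-trans (room₁ c) (≤-trans (*-monoˡ-≤ str (s≤s c≤K)) thr0≤S))) ,
                    _ , wrap-small (inW (inM c≤K cur<)) ,
                    _ , inS (inM c≤K cur<) , refl ,
                    _ , (e , f , e≡ , trans i≡ f≡ , cong bit less≡) ,
                    (λ l≢0 → c , c+sk≡ , refl , regs , i≡ , cur< , search-stay {c} cur< low (bit≢0 l≢0) search , refl) ,
                    λ l≡0 → _ , wrap-small (inW (inJ c≤K cur<)) , _ , inS (inJ c≤K cur<) , at (Table.jump (lv₀ c c≤K)) cur< ,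
                      c , c+sk≡ , refl , regs , i≡ , anc< (2 ^ c) cur< , search-jump {c} x< low (bit≡0 l≡0) search , refl)
      where
      cur = reg s′ rcur
      c+sk≡ : c + suc k ≡ suc K
      c+sk≡ = trans (+-suc c k) c+k≡
      c≤K : c ≤ K
      c≤K = ≤-pred (subst (suc c ≤_) c+k≡ (m≤m+n (suc c) k))

  nearest-time : ℕ
  nearest-time = 1 + suc (2 + (suc ((2 + lg) * suc (cost climb)) + 2))

  nearest-rule : ∀ {s} → Levels K (mem s) → Regs thr0 (reg s) →
    ⟪ fill nearest ⟫ s (n * (3 + suc (nearest-time + 4)))
      (λ s′ → Outside thr0 n (mem s) (mem s′) × Filled thr0 NearAt n (mem s′) × Regs thr0 (reg s′))
  nearest-rule {s} lv regs@(c₀ , _ , _ , _ , _ , d≡) = weaken (fill-time nearest-time) (λ h → h)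
    (fill-rule (λ _ → Regs thr0) NearAt S<W lg0≤S (λ _ _ _ h → h) (λ _ _ _ _ _ h → h) compute d≡
      (Constants.limit≡ c₀) (Constants.one≡ c₀) regs)
    where
    compute : ∀ {i s′} → i < n → Ctl thr0 n i (reg s′) → Regs thr0 (reg s′) →
      Outside thr0 n (mem s) (mem s′) → Filled thr0 NearAt i (mem s′) →
      ⟪ nearest ⟫ s′ nearest-time (λ t → mem t ≡ mem s′ × Ctl thr0 n i (reg t) × Regs thr0 (reg t) × NearAt i (reg t rval))
    compute {i} {s′} i< ct@(ctl i≡ _ _ _) regs@(constants _ _ _ root≡ _ _ , D≡ , th≡ , _) out _ =
      straightThen (_ , eq= i≡ root≡ , ifnz-rule
        (λ ≢0 → weaken (s≤s z≤n) (λ h → h) (straight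
           (word z≤n , refl , ct , regs , λ i≢ → ⊥-elim (i≢ (bit-eq≢0 i root ≢0)))))
        (λ ≡0 → straightThen (_ , subst (_< S) (sym i≡) (inS (inJ z≤n i<)) , trans (cong (mem s′) i≡) (parentAt lv′ i<) ,
          (climb-rule i< (bit-eq≡0 i root ≡0) lv′ regs i≡ th≡ (search-start i<) (parent< i<)
           andThen λ { {s″} (m≡ , regs″@(constants N≡ one≡ _ _ _ lim≡ , D≡″ , _ , _ , _ , d≡″) , i≡″ , cur< , small) →
           straight (_ , add= D≡″ refl (inW (inD ≤-refl cur<)) , _ , inS (inD ≤-refl cur<) ,
             trans (cong (λ m → m (base K + n + n + reg s″ rcur)) m≡) (depthAt lv′ cur<) ,
             m≡ , ctl i≡″ d≡″ lim≡ one≡ , regs″ , λ _ → _ , cur< , small , refl) }))))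
      where
      lv′ : Levels K (mem s′)
      lv′ = levels-keep (below ≤-refl out) lv

  log-step : ∀ {i j} → 2 ^ j ≤ i / 2 → i / 2 < 2 ^ suc j → 2 ^ suc j ≤ i × i < 2 ^ suc (suc j)
  log-step {i} {j} lo hi =
    ≤-trans (*-monoʳ-≤ 2 lo) (≤-trans (m≤n+m (2 * h) (i % 2)) (≤-reflexive (sym i≡))) ,
    <-≤-trans (subst (_< 2 * suc h) (sym i≡) (subst (i % 2 + 2 * h <_) (sym (*-suc 2 h)) (+-monoˡ-< (2 * h) (m%n<n i 2)))) (*-monoʳ-≤ 2 hi)
    where
    h = i / 2
    i≡ : i ≡ i % 2 + 2 * h
    i≡ = trans (m≡m%n+[m/n]*n i 2) (cong (i % 2 +_) (*-comm h 2))

  log≤K : ∀ {i j} → 2 ^ j ≤ i → i ≤ 2 ^ K → j ≤ K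
  log≤K {i} {j} lo hi = ≮⇒≥ λ K<j → <⇒≱ (^-monoʳ-< 2 (s≤s (s≤s z≤n)) K<j) (≤-trans lo hi)

  logarithm-rule : ∀ {s} → Regs lg0 (reg s) → reg s rlg ≡ lg0 →
    ⟪ fill logarithm ⟫ s (n * 15)
      (λ s′ → Outside lg0 n (mem s) (mem s′) × Filled lg0 LogAt n (mem s′) × Regs lg0 (reg s′) × reg s′ rlg ≡ lg0)
  logarithm-rule {s} regs@(c₀ , _ , _ , _ , _ , d≡) lg≡ = weaken (fill-time 7) (λ h → h)
    (fill-rule (λ _ ρ → Regs lg0 ρ × ρ rlg ≡ lg0) LogAt S<W chunk0≤S (λ _ _ _ h → h) (λ _ _ _ _ _ h → h) compute d≡
      (Constants.limit≡ c₀) (Constants.one≡ c₀) (regs , lg≡))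
    where
    compute : ∀ {i s′} → i < n → Ctl lg0 n i (reg s′) → Regs lg0 (reg s′) × reg s′ rlg ≡ lg0 →
      Outside lg0 n (mem s) (mem s′) → Filled lg0 LogAt i (mem s′) →
      ⟪ logarithm ⟫ s′ 7 (λ t → mem t ≡ mem s′ × Ctl lg0 n i (reg t) × (Regs lg0 (reg t) × reg t rlg ≡ lg0) × LogAt i (reg t rval))
    compute {i} {s′} i< ct@(ctl i≡ _ _ _) r@((constants _ one≡ two≡ _ st≡ _ , _ , _ , _ , _ , d≡′) , _) _ fl = straight
      (word z≤n , _ , lt= one≡ i≡ ,
       (λ ≢0 → let 1<i = bit-lt≢0 1 i ≢0
                   h<i = m/n<m i 2 {{>-nonZero (m<n⇒0<n 1<i)}} (s≤s (s≤s z≤n))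
                   a<S = <-≤-trans (+-monoʳ-< lg0 (<-trans h<i i<)) chunk0≤S
               in _ , div= i≡ two≡ , _ , add= d≡′ refl (word (<⇒≤ a<S)) , _ , a<S , refl ,
                  -- The sum is left unevaluated: that it does not wrap around is shown below, under
                  -- the hypothesis `i ≤ 2 ^ K` of `LogAt`.
                  _ , refl , refl , ct , r , λ _ i≤ →
                    let j , lo , hi , x≡ = at fl h<i (m≥n⇒m/n>0 1<i) (≤-trans (<⇒≤ h<i) i≤)
                        lo′ , hi′ = log-step {i} {j} lo hi
                    in suc j , lo′ , hi′ , add= st≡ x≡ (word (≤-trans (*-monoˡ-≤ str (m≤n⇒m≤1+n (log≤K {i} {suc j} lo′ i≤))) thr0≤S))) ,
       (λ ≡0 → refl , ct , r , λ 0<i _ → 0 , 0<i , s≤s (bit-lt≡0 1 i ≡0) , refl))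

  record Searched (s : State) : Set where
    constructor searched
    field
      const≡   : Const (reg s)
      pointer≡ : Pointers (reg s)
      chunk≡   : reg s rq ≡ chunk0
      levels   : Levels K (mem s)
      near     : Filled thr0 NearAt n (mem s)
      logs     : Filled lg0 LogAt n (mem s)

  search-time : ℕ
  search-time = 7 + (3 + suc (nearest-time + 4) + (2 + (15 + 1)))

  searching-rule : ∀ {s} → Const (reg s) → reg s rp ≡ base K → Levels K (mem s) →
                   ⟪ searching ⟫ s (n * search-time) Searched
  searching-rule {s} c@(constants n≡ _ _ _ st≡ _) p≡ lv =
    weaken (constant 7 ⊕ (≤-refl {n * (3 + suc (nearest-time + 4))} ⊕ (constant 2 ⊕ (≤-refl {n * 15} ⊕ constant 1)))) (λ h → h)
    (straightThen (_ , add= p≡ n≡ (word (bound (m≤m+n (base K + n) n))) , _ , add= refl n≡ (word (bound ≤-refl)) ,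
      _ , add= refl n≡ (word 3n≤) , _ , add= refl n≡ (word 4n≤) , _ , add= st≡ p≡ (word thr0≤S) ,
    (nearest-rule lv (c , refl , refl , p≡ , refl , refl) andThen λ { (outN , near , (c₁ , D≡ , th≡ , en≡ , bP≡ , d≡)) →
    straightThen (_ , add= th≡ (Constants.size≡ c₁) (word lg0≤S) ,
    (logarithm-rule (c₁ , D≡ , th≡ , en≡ , bP≡ , refl) refl andThen λ { (outL , logs , (c₂ , D≡ , th≡ , en≡ , bP≡ , d≡) , lg≡) →
    straight (_ , add= lg≡ (Constants.size≡ c₂) (word chunk0≤S) ,
      searched c₂ (pointers D≡ th≡ lg≡ en≡ bP≡) refl
        (levels-keep (below-trans (below ≤-refl outN) (below (m≤m+n _ n) outL)) lv)
        (keep ≤-refl (below ≤-refl outL) near) logs) })) })))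
    where
    4n≤ : base K + n + n + n + n ≤ S
    4n≤ = ≤-trans (≤-trans (m≤m+n _ (n + n)) (≤-reflexive (solve 2 (λ b x → b :+ x :+ x :+ x :+ x :+ (x :+ x) := con 6 :* x :+ b) refl (base K) n))) thr0≤S
    3n≤ : base K + n + n + n ≤ S
    3n≤ = ≤-trans (m≤m+n _ n) 4n≤
    bound : ∀ {x} → x ≤ base K + n + n → x ≤ S
    bound h = ≤-trans h (≤-trans (m≤m+n _ n) 3n≤)

-- Running minima above aligned ancestors

module Chunking (X : Setting) (B : TopLevel X) where
  open Context X
  open TopLevel B
  open Searching X B hiding (Regs)
  open +-*-Solver using (solve; _:=_; _:+_; _:*_; con)

  chunk : ℕ → ℕ
  chunk k = chunk0 + base k

  chunk-suc : ∀ k → str + chunk k ≡ chunk (suc k)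
  chunk-suc k = solve 3 (λ s c b → s :+ (c :+ b) := c :+ (s :+ b)) refl str chunk0 (base k)

  AlignAt RunMinAt : ℕ → ℕ → ℕ → Set
  AlignAt  k y z = Aligned (2 ^ k) y z
  RunMinAt z i x = z ≢ root → IsMin x z i

  -- `Const` without its claim on `rlim`, which temporarily holds the array length while an array is
  -- being filled.
  Fixed : (Reg → ℕ) → Set
  Fixed ρ = Constants (ρ rN) (ρ rone) (ρ rtwo) (ρ rroot) (ρ rstride) n

  -- What a query has to know about the pointer of `v` at level `k`. The bound `inside` protects the
  -- array from all later chunks.
  record Ready (k v y : ℕ) (m : ℕ → ℕ) : Set where
    constructor ready
    field
      {z x}    : ℕ
      aligned  : Aligned (2 ^ k) (anc (2 ^ k) v) z
      pointer≡ : y ≡ depth z + x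
      inside   : x + (2 ^ suc k + 2 ^ k) ≤ chunk (suc k)
      minima   : Filled x (RunMinAt z) (2 ^ suc k + 2 ^ k) m

  filled-store : ∀ {b G len m a x} → a < b → Filled b G len m → Filled b G len (m [ a ↦ x ])
  at (filled-store {b} {G} {len} {m} {a} {x} a<b f) {i} i< =
    subst (G i) (sym (update-other m x (<⇒≢ (<-≤-trans a<b (m≤m+n b i))))) (at f i<)

  module Alloc {k : ℕ} (k<K : k < K) where
    p L C slot0 ptr0 F : ℕ
    p = 2 ^ k
    L = 2 ^ suc k + p
    C = chunk k
    slot0 = C + n
    ptr0 = slot0 + n
    F = ptr0 + n

    k≤K = <⇒≤ k<K

    instance
      p≢0 : NonZero p
      p≢0 = m^n≢0 2 k

    0<L : 0 < L
    0<L = <-≤-trans (m^n>0 2 k) (m≤n+m p _)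

    chunk-end : F + (n + n + n) ≡ chunk (suc k)
    chunk-end = solve 3 (λ x c b → c :+ b :+ x :+ x :+ x :+ (x :+ x :+ x) := c :+ (con 6 :* x :+ b)) refl n chunk0 (base k)

    chunk≤S : chunk (suc k) + n ≤ S
    chunk≤S = chunk0≤ (s≤s k≤K)

    F≤S : F ≤ S
    F≤S = ≤-trans (m≤m+n F _) (≤-trans (≤-reflexive chunk-end) (≤-trans (m≤m+n _ n) chunk≤S))

    record ChunkValues (vp vq vpw vslot vP vdouble vlen : ℕ) : Set where
      constructor chunkValues
      field
        p≡      : vp ≡ base k
        q≡      : vq ≡ C
        pw≡     : vpw ≡ p
        slot≡   : vslot ≡ slot0
        P≡      : vP ≡ ptr0
        double≡ : vdouble ≡ 2 ^ suc k
        len≡    : vlen ≡ L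

    ChunkRegs : (Reg → ℕ) → Set
    ChunkRegs ρ = ChunkValues (ρ rp) (ρ rq) (ρ rpw) (ρ rslot) (ρ rP) (ρ rdouble) (ρ rlen)

    Regs : ℕ → ℕ → (Reg → ℕ) → Set
    Regs cnt v ρ = Fixed ρ × Pointers ρ × ChunkRegs ρ × ρ rfree ≡ F + cnt * L × ρ rv ≡ v

    -- Arrays are numbered in the order of their allocation; each number is traced back to the node
    -- whose slot holds its address.
    Owned : ℕ → (ℕ → ℕ) → Set
    Owned cnt m = ∀ s → s < cnt → ∃[ z ] (z < n × m (slot0 + z) ≡ F + s * L × Deep p z)

    -- A slot holds a single address and different arrays have different addresses, so no node owns
    -- two arrays and `deep-count` applies.
    owned-count : ∀ {cnt m} → Owned cnt m → cnt * p ≤ n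
    owned-count {cnt} {m} own = deep-count cnt (λ s → proj₁ (own (toℕ s) (Fin.toℕ<n s)))
      (λ s → proj₂ (proj₂ (proj₂ (own (toℕ s) (Fin.toℕ<n s)))))
      (λ {s} {t} z≡ → Fin.toℕ-injective (*-cancelʳ-≡ (toℕ s) (toℕ t) L {{>-nonZero 0<L}}
        (+-cancelˡ-≡ F _ _ (trans (sym (slot s)) (trans (cong (λ z → m (slot0 + z)) z≡) (slot t))))))
      where
      slot : ∀ s → m (slot0 + proj₁ (own (toℕ s) (Fin.toℕ<n s))) ≡ F + toℕ s * L
      slot s = proj₁ (proj₂ (proj₂ (own (toℕ s) (Fin.toℕ<n s))))

    owned-length : ∀ {cnt m} → Owned cnt m → cnt * L ≤ n + n + n
    owned-length {cnt} {m} own = ≤-trans (≤-reflexive (solve 2 (λ c p → c :* (p :+ (p :+ con 0) :+ p) := c :* p :+ c :* p :+ c :* p) refl cnt p))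
      (+-mono-≤ (+-mono-≤ (owned-count {m = m} own) (owned-count {m = m} own)) (owned-count {m = m} own))

    owned-fits : ∀ {cnt m} → Owned cnt m → F + cnt * L ≤ chunk (suc k)
    owned-fits {m = m} own = ≤-trans (+-monoʳ-≤ F (owned-length {m = m} own)) (≤-reflexive chunk-end)

    -- The word 0 can stand for a missing array because arrays start at `F` or above, and `F` is
    -- positive.
    Slot : ℕ → ℕ → ℕ → (ℕ → ℕ) → Set
    Slot cnt z x m = x ≡ 0 ⊎ ∃[ s ] (s < cnt × x ≡ F + s * L × Filled (F + s * L) (RunMinAt z) L m)

    Pointer : ℕ → (ℕ → ℕ) → Set
    Pointer u m = ∃[ z ] (z < n × Aligned p (anc p u) z × m (slot0 + z) ≢ 0 × m (ptr0 + u) ≡ depth z + m (slot0 + z))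

    record Allocated (m₀ : ℕ → ℕ) (cnt v : ℕ) (m : ℕ → ℕ) : Set where
      constructor allocated
      field
        frame : Below slot0 m₀ m
        slots : ∀ {z} → z < n → Slot cnt z (m (slot0 + z)) m
        owned : Owned cnt m
        ptrs  : ∀ {u} → u < v → p ≤ depth u → Pointer u m

    0<F : 0 < F
    0<F = <-≤-trans 0<n (m≤n+m n ptr0)

    slot<ptr0 : ∀ {z} → z < n → slot0 + z < ptr0
    slot<ptr0 = +-monoʳ-< slot0

    before : ∀ {cnt s} → s < cnt → F + s * L + L ≤ F + cnt * L
    before {cnt} {s} s< = ≤-trans (≤-reflexive (trans (+-assoc F (s * L) L) (cong (F +_) (+-comm (s * L) L)))) (+-monoʳ-≤ F (*-monoˡ-≤ L s<))

    alloc-skip : ∀ {m₀ cnt v m} → depth v < p → Allocated m₀ cnt v m → Allocated m₀ cnt (suc v) m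
    alloc-skip {v = v} {m} small (allocated fr sl ow ptrs) = allocated fr sl ow ptrs′
      where
      ptrs′ : ∀ {u} → u < suc v → p ≤ depth u → Pointer u m
      ptrs′ (s≤s u≤v) p≤ with m≤n⇒m<n∨m≡n u≤v
      ... | inj₁ u<v  = ptrs u<v p≤
      ... | inj₂ refl = ⊥-elim (<⇒≱ small p≤)

    -- Ownership is extended before the array is filled, since the count including the new array is
    -- what shows that there is room for it. The slots of the earlier owners are nonzero, so none of
    -- them is overwritten.
    alloc-new : ∀ {m₀ cnt v z m} → z < n → m (slot0 + z) ≡ 0 → Deep p z → Allocated m₀ cnt v m →
                Owned (suc cnt) (m [ slot0 + z ↦ F + cnt * L ])
    alloc-new {cnt = cnt} {z = z} {m} z< ≡0 dp (allocated _ _ ow _) s (s≤s s≤) with m≤n⇒m<n∨m≡n s≤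
    ... | inj₂ refl = z , z< , update-same m (slot0 + z) _ , dp
    ... | inj₁ s<cnt = let z′ , z′< , slot≡ , dp′ = ow s s<cnt in
      z′ , z′< , trans (update-other m _ (λ e → <⇒≢ (<-≤-trans 0<F (m≤m+n F (s * L))) (trans (sym ≡0) (trans (cong m e) slot≡)))) slot≡ , dp′

    alloc-fill : ∀ {m₀ cnt v z m m′} → v ≤ n → z < n → m (slot0 + z) ≡ 0 → Owned (suc cnt) (m [ slot0 + z ↦ F + cnt * L ]) →
                 Outside (F + cnt * L) L (m [ slot0 + z ↦ F + cnt * L ]) m′ → Filled (F + cnt * L) (RunMinAt z) L m′ →
                 Allocated m₀ cnt v m → Allocated m₀ (suc cnt) v m′
    alloc-fill {m₀} {cnt} {v} {z} {m} {m′} v≤n z< slot≡0 own out fl (allocated fr sl _ ptrs) = allocated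
      (λ a a< → trans (bel a (<-trans a< slot0<F)) (trans (update-other m _ (λ e → <⇒≢ (<-≤-trans a< (m≤m+n slot0 z)) (sym e))) (fr a a<)))
      slots′
      (λ s s< → let z′ , z′< , slot≡ , dp = own s s< in z′ , z′< , trans (bel _ (slot<F z′<)) slot≡ , dp)
      ptrs′
      where
      m₁ = m [ slot0 + z ↦ F + cnt * L ]
      slot0<F : slot0 < F
      slot0<F = <-≤-trans (m<m+n slot0 0<n) (m≤m+n ptr0 n)
      slot<F : ∀ {z} → z < n → slot0 + z < F
      slot<F z< = <-≤-trans (slot<ptr0 z<) (m≤m+n ptr0 n)
      bel : Below F m₁ m′
      bel = below (m≤m+n F (cnt * L)) out
      same : ∀ {z′} → z′ < n → z ≢ z′ → m′ (slot0 + z′) ≡ m (slot0 + z′)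
      same z′< z≢ = trans (bel _ (slot<F z′<)) (update-other m _ (λ e → z≢ (+-cancelˡ-≡ slot0 _ _ e)))
      slots′ : ∀ {z′} → z′ < n → Slot (suc cnt) z′ (m′ (slot0 + z′)) m′
      slots′ {z′} z′< with z ≟ z′
      ... | yes refl = inj₂ (cnt , ≤-refl , trans (bel _ (slot<F z′<)) (update-same m (slot0 + z) _) , fl)
      ... | no z≢z′ with sl z′<
      ... | inj₁ ≡0 = inj₁ (trans (same z′< z≢z′) ≡0)
      ... | inj₂ (s , s< , slot≡ , fl′) = inj₂ (s , m≤n⇒m≤1+n s< , trans (same z′< z≢z′) slot≡ ,
              keep (before s<) (below ≤-refl out) (filled-store (<-≤-trans (slot<F z<) (m≤m+n F _)) fl′))
      ptrs′ : ∀ {u} → u < v → p ≤ depth u → Pointer u m′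
      ptrs′ {u} u< p≤ =
        let z′ , z′< , al , slot≢0 , ptr≡ = ptrs u< p≤
            same′ = same z′< (λ { refl → slot≢0 slot≡0 })
        in z′ , z′< , al , (λ ≡0 → slot≢0 (trans (sym same′) ≡0)) ,
           trans (bel _ (+-monoʳ-< ptr0 (<-≤-trans u< v≤n)))
           (trans (update-other m _ (<⇒≢ (<-≤-trans (slot<ptr0 z<) (m≤m+n ptr0 u))))
           (trans ptr≡ (cong (depth z′ +_) (sym same′))))

    alloc-pointer : ∀ {m₀ cnt v z m} → v < n → z < n → Aligned p (anc p v) z → m (slot0 + z) ≢ 0 → Allocated m₀ cnt v m →
                    Allocated m₀ cnt (suc v) (m [ ptr0 + v ↦ depth z + m (slot0 + z) ])
    alloc-pointer {m₀} {cnt} {v} {z} {m} v<n z< al ≢0 (allocated fr sl ow ptrs) = allocated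
      (λ a a< → trans (other (<-trans a< (m<m+n slot0 0<n))) (fr a a<))
      slots′
      (λ s s< → let z′ , z′< , slot≡ , dp = ow s s< in z′ , z′< , trans (other (slot<ptr0 z′<)) slot≡ , dp)
      ptrs′
      where
      m₁ = m [ ptr0 + v ↦ depth z + m (slot0 + z) ]
      other : ∀ {a} → a < ptr0 → m₁ a ≡ m a
      other a< = update-other m _ (λ e → <⇒≢ (<-≤-trans a< (m≤m+n ptr0 v)) (sym e))
      slots′ : ∀ {z′} → z′ < n → Slot cnt z′ (m₁ (slot0 + z′)) m₁
      slots′ z′< with sl z′<
      ... | inj₁ ≡0 = inj₁ (trans (other (slot<ptr0 z′<)) ≡0)
      ... | inj₂ (s , s< , slot≡ , fl) = inj₂ (s , s< , trans (other (slot<ptr0 z′<)) slot≡ ,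
              filled-store (<-≤-trans (+-monoʳ-< ptr0 v<n) (m≤m+n F _)) fl)
      old : ∀ {u} → u < v → Pointer u m → Pointer u m₁
      old u< (z′ , z′< , al′ , ≢0′ , ptr≡) = z′ , z′< , al′ , (λ ≡0 → ≢0′ (trans (sym (other (slot<ptr0 z′<))) ≡0)) ,
        trans (update-other m _ (λ e → <⇒≢ u< (sym (+-cancelˡ-≡ ptr0 _ _ e)))) (trans ptr≡ (cong (depth z′ +_) (sym (other (slot<ptr0 z′<)))))
      ptrs′ : ∀ {u} → u < suc v → p ≤ depth u → Pointer u m₁
      ptrs′ (s≤s u≤v) p≤ with m≤n⇒m<n∨m≡n u≤v
      ... | inj₁ u<v  = old u<v (ptrs u<v p≤)
      ... | inj₂ refl = z , z< , al , (λ ≡0 → ≢0 (trans (sym (other (slot<ptr0 z<))) ≡0)) ,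
        trans (update-same m (ptr0 + v) _) (cong (depth z +_) (sym (other (slot<ptr0 z<))))

    alloc-ready : ∀ {m₀ cnt m u} → Allocated m₀ cnt n m → u < n → p ≤ depth u → Ready k u (m (ptr0 + u)) m
    alloc-ready {cnt = cnt} {m} (allocated _ sl ow ptrs) u< p≤ with ptrs u< p≤
    ... | z , z< , al , ≢0 , ptr≡ with sl z<
    ... | inj₁ ≡0 = ⊥-elim (≢0 ≡0)
    ... | inj₂ (s , s< , slot≡ , fl) = ready al (trans ptr≡ (cong (depth z +_) slot≡)) (≤-trans (before s<) (owned-fits {m = m} ow)) fl

    FillRegs : ℕ → ℕ → ℕ → (Reg → ℕ) → Set
    FillRegs cnt v z ρ = Regs cnt v ρ × ρ rz ≡ z × ρ rx ≡ F + cnt * L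

    runningMin-rule : ∀ {s cnt v z} → z < n → F + cnt * L + L ≤ S → (∀ {u} → u < n → mem s u ≡ parent u) → FillRegs cnt v z (reg s) →
      reg s rdst ≡ F + cnt * L → reg s rlim ≡ L → reg s rcur ≡ z → reg s rbest ≡ z →
      ⟪ fill runningMin ⟫ s (2 + suc (L * suc (7 + 4)))
        (λ s′ → Outside (F + cnt * L) L (mem s) (mem s′) × Filled (F + cnt * L) (RunMinAt z) L (mem s′) × FillRegs cnt v z (reg s′))
    runningMin-rule {s} {cnt} {v} {z} z< room≤ parents regs@((c₀ , _) , _) d≡ l≡ cur≡ best≡ =
      weaken ≤-refl (λ { (out , fl , r , _) → out , fl , r })
      (fill-rule R (RunMinAt z) S<W room≤ (λ _ _ _ h → h) (λ _ _ _ _ _ h → h) compute d≡ l≡ (Constants.one≡ c₀)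
        (regs , cur≡ , λ z≢ → subst (λ x → IsMin x z 0) (sym best≡) (isMin-self 0 z< z≢ z≤n)))
      where
      -- The body copies the current minimum to `rval` before it takes in the next edge, so that
      -- cell `i` covers exactly `i` edges.
      R : ℕ → (Reg → ℕ) → Set
      R i ρ = FillRegs cnt v z ρ × ρ rcur ≡ anc i z × RunMinAt z i (ρ rbest)
      compute : ∀ {i s′} → i < L → Ctl (F + cnt * L) L i (reg s′) → R i (reg s′) → Outside (F + cnt * L) L (mem s) (mem s′) →
        Filled (F + cnt * L) (RunMinAt z) i (mem s′) →
        ⟪ runningMin ⟫ s′ 7 (λ t → mem t ≡ mem s′ × Ctl (F + cnt * L) L i (reg t) × R (suc i) (reg t) × RunMinAt z i (reg t rval))
      compute {i} {s′} i< ct (regs@((constants _ _ _ root≡ _ _ , _) , _) , cur≡ , best) out _ = straight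
        (_ , eq= cur≡ root≡ ,
         (λ ≢0 → let a≡ = bit-eq≢0 (anc i z) root ≢0 in
            refl , ct , (regs , trans cur≡ (trans a≡ (sym (trans (cong parent a≡) parent-root))) ,
                         λ z≢ → isMin-short z< a≡ (n≤1+n i) (best z≢)) , best) ,
         λ ≡0 → let a≢ = bit-eq≡0 (anc i z) root ≡0
                    z≢ = λ z≡ → a≢ (trans (cong (anc i) z≡) (anc-root i))
                    self = isMin-self 1 (anc< i z<) a≢ ≤-refl
                    e , f , e≡ , f≡ , less≡ = edges (anc< i z< , a≢) (isMin-edge z< (best z≢))
                    load≡ = trans (cong (mem s′) cur≡) (trans (out _ (inj₁ a<)) (parents (anc< i z<)))
                in _ , (e , f , trans cur≡ e≡ , f≡ , cong bit less≡) ,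
                   (λ l≢0 → _ , subst (_< S) (sym cur≡) (<-≤-trans a< (≤-trans (m≤m+n _ L) room≤)) , load≡ , refl , ct ,
                     (regs , refl , λ _ → subst (λ x → IsMin x z (suc i)) (sym cur≡)
                       (isMin-≡ refl (+-comm i 1) (isMin-replace z< (s≤s z≤n) (best z≢) self (bit≢0 l≢0)))) , best) ,
                   (λ l≡0 → _ , subst (_< S) (sym cur≡) (<-≤-trans a< (≤-trans (m≤m+n _ L) room≤)) , load≡ , refl , ct ,
                     (regs , refl , λ _ → isMin-≡ refl (+-comm i 1) (isMin-keep z< (best z≢) self (bit≡0 l≡0))) , best))
        where
        a< : anc i z < F + cnt * L
        a< = <-≤-trans (anc< i z<) (≤-trans (m≤n+m n ptr0) (m≤m+n F _))

    record Inv (m₀ : ℕ → ℕ) (v τ : ℕ) (s : State) : Set where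
      constructor invariant
      field
        {cnt} : ℕ
        v≤n   : v ≤ n
        -- Amortised: the lengths of the arrays add up to cnt * L ≤ 3 n.
        time≤ : τ ≤ v * 40 + cnt * (L * 15)
        limit : reg s rlim ≡ n
        go≡   : reg s rgo′ ≡ bit (v <ᵇ n)
        regs  : Regs cnt v (reg s)
        alloc : Allocated m₀ cnt v (mem s)

    Body : ℕ → ℕ → (ℕ → ℕ) → State → Set
    Body cnt v m₀ s = reg s rlim ≡ n × Regs cnt v (reg s) × Allocated m₀ cnt (suc v) (mem s)

    module Loop {m₀ : ℕ → ℕ} (lv₀ : Levels K m₀) (al₀ : Filled C (AlignAt k) n m₀) where

      chunk0≤C : chunk0 ≤ C
      chunk0≤C = m≤m+n chunk0 (base k)

      thr0≤slot0 : thr0 ≤ slot0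
      thr0≤slot0 = ≤-trans (≤-trans (m≤m+n thr0 n) (m≤m+n lg0 n)) (≤-trans chunk0≤C (m≤m+n C n))

      levels′ : ∀ {m} → Below slot0 m₀ m → Levels K m
      levels′ fr = levels-keep (λ a a< → fr a (<-≤-trans a< thr0≤slot0)) lv₀

      aligned′ : ∀ {m} → Below slot0 m₀ m → Filled C (AlignAt k) n m
      aligned′ fr = keep ≤-refl fr al₀

      slot<S : ∀ {z} → z < n → slot0 + z < S
      slot<S z< = <-≤-trans (slot<ptr0 z<) (≤-trans (m≤m+n ptr0 n) F≤S)

      aligned< : ∀ {y z} → y < n → Aligned p y z → z < n
      aligned< y< (b , _ , _ , refl , _) = anc< b y<

      setPointer-rule : ∀ {s cnt v z} → v < n → z < n → Aligned p (anc p v) z → mem s (slot0 + z) ≢ 0 →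
        reg s rx ≡ mem s (slot0 + z) → reg s rz ≡ z → reg s rlim ≡ n → Regs cnt v (reg s) → Allocated m₀ cnt v (mem s) →
        ⟪ setPointer ⟫ s 5 (Body cnt v m₀)
      setPointer-rule {s} {cnt} {v} {z} v< z< al ≢0 x≡ z≡ lim≡ regs@(_ , ps , cs , _ , v≡) alloc = straight
        (_ , add= (PointerValues.depths≡ ps) z≡ (inW (inD ≤-refl z<)) , _ , inS (inD ≤-refl z<) , depthAt (levels′ (Allocated.frame alloc)) z< ,
         _ , add= refl x≡ small , _ , add= (ChunkValues.P≡ cs) v≡ (word (<⇒≤ ptr<S)) , ptr<S ,
         lim≡ , regs , alloc-pointer v< z< al ≢0 alloc)
        where
        ptr<S : ptr0 + v < S
        ptr<S = <-≤-trans (+-monoʳ-< ptr0 v<) F≤S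
        small : depth z + mem s (slot0 + z) < 2 ^ w
        small with Allocated.slots alloc z<
        ... | inj₁ ≡0 = ⊥-elim (≢0 ≡0)
        ... | inj₂ (i , i< , slot≡ , _) = word (≤-trans (≤-reflexive (+-comm (depth z) _))
                (≤-trans (+-mono-≤ (≤-trans (≤-reflexive slot≡) (≤-trans (≤-trans (m≤m+n _ L) (before i<)) (owned-fits {m = mem s} (Allocated.owned alloc)))) (<⇒≤ (depth<size z<))) chunk≤S))

      Slotted : ℕ → ℕ → ℕ → State → Set
      Slotted z cnt v s = mem s (slot0 + z) ≢ 0 × reg s rx ≡ mem s (slot0 + z) × reg s rz ≡ z × reg s rlim ≡ n ×
                          Regs cnt v (reg s) × Allocated m₀ cnt v (mem s)

      allocate-rule : ∀ {s cnt v z} → v < n → z < n → mem s (slot0 + z) ≡ 0 → Deep p z → reg s rs ≡ slot0 + z → reg s rz ≡ z →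
        Regs cnt v (reg s) → Allocated m₀ cnt v (mem s) →
        ⟪ allocate ⟫ s (11 + L * 15)
          (Slotted z (suc cnt) v)
      allocate-rule {s} {cnt} {v} {z} v< z< ≡0 dp s≡ z≡ (c , ps , cs , free≡ , v≡) alloc =
        weaken time (λ h → h)
        (straightThen (subst (_< S) (sym s≡) (slot<S z<) ,
         (runningMin-rule {cnt = cnt} z< new≤S parents ((c , ps , cs , free≡ , v≡) , z≡ , free≡) free≡ (ChunkValues.len≡ cs) z≡ z≡
          andThen λ { {s₁} (out , fl , (c₁ , ps₁ , cs₁ , free≡₁ , v≡₁) , z≡₁ , x≡₁) →
          straight (_ , add= free≡₁ (ChunkValues.len≡ cs₁) (word new≤S) ,
            let out′ = subst (λ m → Outside (F + cnt * L) L m (mem s₁)) stored≡ out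
                alloc′ = alloc-fill (<⇒≤ v<) z< ≡0 own out′ fl alloc
                slot≡ = trans (out′ _ (inj₁ (<-≤-trans (slot<ptr0 z<) (≤-trans (m≤m+n ptr0 n) (m≤m+n F (cnt * L)))))) (update-same (mem s) (slot0 + z) _)
            in (λ ≡0 → <⇒≢ (<-≤-trans 0<F (m≤m+n F (cnt * L))) (sym (trans (sym slot≡) ≡0))) , trans x≡₁ (sym slot≡) , z≡₁ ,
               Constants.size≡ c₁ , (c₁ , ps₁ , cs₁ , next≡ , v≡₁) , alloc′) })))
        where
        stored≡ : mem s [ reg s rs ↦ reg s rfree ] ≡ mem s [ slot0 + z ↦ F + cnt * L ]
        stored≡ = cong₂ (λ a x → mem s [ a ↦ x ]) s≡ free≡
        own : Owned (suc cnt) (mem s [ slot0 + z ↦ F + cnt * L ])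
        own = alloc-new z< ≡0 dp alloc
        next≡ : F + cnt * L + L ≡ F + suc cnt * L
        next≡ = trans (+-assoc F (cnt * L) L) (cong (F +_) (+-comm (cnt * L) L))
        new≤S : F + cnt * L + L ≤ S
        new≤S = ≤-trans (≤-reflexive next≡) (≤-trans (owned-fits {m = mem s [ slot0 + z ↦ F + cnt * L ]} own) (≤-trans (m≤m+n _ n) chunk≤S))
        parents : ∀ {u} → u < n → (mem s [ reg s rs ↦ reg s rfree ]) u ≡ parent u
        parents {u} u< = trans (cong (λ m → m u) stored≡)
          (trans (update-other (mem s) _ (λ e → <⇒≢ (<-≤-trans u< (≤-trans (m≤n+m n C) (m≤m+n slot0 z))) (sym e)))
                 (parentAt (levels′ (Allocated.frame alloc)) u<))
        time : 6 + ((2 + suc (L * suc (7 + 4))) + 2) ≤ 11 + L * 15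
        time = ≤-trans (≤-reflexive (solve 1 (λ l → con 6 :+ ((con 3 :+ l) :+ con 2) := con 11 :+ l) refl (L * 12)))
                 (+-monoʳ-≤ 11 (*-monoʳ-≤ L (m≤m+n 12 3)))

      allocStep-rule : ∀ {v τ s} → Inv m₀ v τ s → reg s rgo′ ≢ 0 → v < n × ∃[ T ] ⟪ allocStep ⟫ s T (Inv m₀ (suc v) (suc T + τ))
      allocStep-rule {v} {τ} {s} (invariant {cnt} v≤n τ≤ lim≡ go≡ regs@(c , ps , cs , free≡ , v≡) alloc) ≢0 = v<n , cases
        where
        v<n : v < n
        v<n = bit-lt≢0 v n (λ e → ≢0 (trans go≡ e))
        lv : Levels K (mem s)
        lv = levels′ (Allocated.frame alloc)
        finish : ∀ cnt {τ′ s′} → τ′ ≤ suc v * 40 + cnt * (L * 15) → Body cnt v m₀ s′ → ⟪ op add rv rv rone ⨾ op lt rgo′ rv rN ⟫ s′ 2 (Inv m₀ (suc v) τ′)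
        finish cnt τ′≤ (lim≡ , (c , ps , cs , free≡ , v≡) , alloc) = straight
          (_ , trans (add= v≡ (Constants.one≡ c) (word (≤-trans (≤-reflexive (+-comm v 1)) (≤-trans v<n (≤-trans (m≤n+m n ptr0) F≤S))))) (+-comm v 1) ,
           _ , lt= refl (Constants.size≡ c) , invariant v<n τ′≤ lim≡ refl (c , ps , cs , free≡ , refl) alloc)
        y z : ℕ
        y = anc p v
        z = mem s (C + y)
        y< = anc< p v<n
        al : Aligned p y z
        al = at (aligned′ (Allocated.frame alloc)) y<
        z< = aligned< y< al
        C+y<S : C + y < S
        C+y<S = <-≤-trans (+-monoʳ-< C y<) (≤-trans (m≤m+n (C + n) n) (≤-trans (m≤m+n ptr0 n) F≤S))
        Pre : State → Set
        Pre s₁ = reg s₁ re ≡ bit (depth v <ᵇ p) × reg s₁ rlim ≡ n × Regs cnt v (reg s₁) × mem s₁ ≡ mem s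
        measure : ⟪ op add rt rD rv ⨾ load rt rt ⨾ op lt re rt rpw ⟫ s 3 Pre
        measure = straight (_ , add= (PointerValues.depths≡ ps) v≡ (inW (inD ≤-refl v<n)) , _ , inS (inD ≤-refl v<n) , depthAt lv v<n ,
                            _ , lt= {a = depth v} refl (ChunkValues.pw≡ cs) , refl , lim≡ , regs , refl)
        Pre′ : State → Set
        Pre′ s₁ = reg s₁ rx ≡ mem s (slot0 + z) × reg s₁ rs ≡ slot0 + z × reg s₁ rz ≡ z × reg s₁ rlim ≡ n × Regs cnt v (reg s₁) × mem s₁ ≡ mem s
        lookup : ∀ {s₁} → Pre s₁ → ⟪ op add rt rp rv ⨾ load rt rt ⨾ op add rt rq rt ⨾ load rz rt ⨾ op add rs rslot rz ⨾ load rx rs ⟫ s₁ 6 Pre′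
        lookup (_ , lim≡ , regs@(_ , _ , cs , _ , v≡) , refl) = straight
          (_ , add= (ChunkValues.p≡ cs) v≡ (inW (inJ k≤K v<n)) , _ , inS (inJ k≤K v<n) , at (Table.jump (lv k k≤K)) v<n ,
           _ , add= (ChunkValues.q≡ cs) refl (word (<⇒≤ C+y<S)) , _ , C+y<S , refl ,
           _ , add= (ChunkValues.slot≡ cs) refl (word (<⇒≤ (slot<S z<))) , _ , slot<S z< , refl ,
           refl , refl , refl , lim≡ , regs , refl)
        large-case : ∀ {cnt′ T s₁} → p ≤ depth v → Pre s₁ → (∀ {s₂} → Pre′ s₂ → ⟪ ifnz rx nop allocate ⟫ s₂ T (Slotted z cnt′ v)) →
          ⟪ ifnz re nop
               ((op add rt rp rv ⨾ load rt rt ⨾ op add rt rq rt ⨾ load rz rt ⨾ op add rs rslot rz ⨾ load rx rs) ⨾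
                ifnz rx nop allocate ⨾ setPointer) ⟫ s₁ (suc (6 + (T + 5))) (Body cnt′ v m₀)
        large-case p≤ pre@(e≡ , _) slotted = ifnz-rule
          (λ ≢0 → ⊥-elim (<⇒≱ (bit-lt≢0 (depth v) p (λ e → ≢0 (trans e≡ e))) p≤))
          (λ _ → lookup pre andThen λ pre′ → slotted pre′ andThen λ { (≢0 , x≡ , z≡ , lim≡ , regs , alloc) →
                   setPointer-rule v<n z< al ≢0 x≡ z≡ lim≡ regs alloc })
        cases : ∃[ T ] ⟪ allocStep ⟫ s T (Inv m₀ (suc v) (suc T + τ))
        -- The branch is decided beforehand because the time charged to the iteration depends on it.
        -- The three branches need at most 7, 19 and 29 + 15 `L` steps, so 40 for each node and 15
        -- `L` for each new array suffice, the loop test included.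
        cases with depth v <? p | mem s (slot0 + z) ≟ 0
        ... | yes small | _ = 39 , weaken (m≤m+n 7 32) (λ h → h)
          (measure andThen λ { (e≡ , lim≡ , regs , refl) →
             ifnz-then {Q = Body cnt v m₀} (λ e → <⇒≱ small (bit-lt≡0 (depth v) p (trans (sym e≡) e))) (straight {nop} (lim≡ , regs , alloc-skip small alloc))
             andThen finish cnt (+-monoʳ-≤ 40 τ≤) })
        ... | no large | no x≢0 = 39 , weaken (m≤m+n 19 20) (λ h → h)
          (measure andThen λ pre → large-case {cnt} (≮⇒≥ large) pre
             (λ { (x≡ , _ , z≡ , lim≡ , regs , refl) →
                  ifnz-then (λ e → x≢0 (trans (sym x≡) e)) (straight {nop} (x≢0 , x≡ , z≡ , lim≡ , regs , alloc)) })
             andThen finish cnt (+-monoʳ-≤ 40 τ≤))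
        ... | no large | yes x≡0 = 39 + L * 15 , weaken time (λ h → h)
          (measure andThen λ pre → large-case {suc cnt} (≮⇒≥ large) pre
             (λ { (x≡ , s≡ , z≡ , lim≡ , regs , refl) →
                  ifnz-else (trans x≡ x≡0) (allocate-rule v<n z< x≡0 (deep-aligned v<n (≮⇒≥ large) al) s≡ z≡ regs alloc) })
             andThen finish (suc cnt) spent)
          where
          time : 3 + (suc (6 + (suc (11 + L * 15) + 5)) + 2) ≤ 39 + L * 15
          time = ≤-trans (≤-reflexive (solve 1 (λ l → con 3 :+ (con 1 :+ (con 6 :+ (con 12 :+ l :+ con 5)) :+ con 2) := con 29 :+ l) refl (L * 15)))
                   (+-monoˡ-≤ (L * 15) (m≤m+n 29 10))
          spent : suc (39 + L * 15) + τ ≤ suc v * 40 + suc cnt * (L * 15)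
          spent = ≤-trans (+-monoʳ-≤ (40 + L * 15) τ≤)
                    (≤-reflexive (solve 3 (λ l a b → con 40 :+ l :+ (a :+ b) := con 40 :+ a :+ (l :+ b)) refl (L * 15) (v * 40) (cnt * (L * 15))))

      alloc-loop : ∀ {s} → Inv m₀ 0 0 s → ⟪ while rgo′ allocStep ⟫ s (suc (n * 85))
        (λ s′ → ∃[ cnt ] (reg s′ rlim ≡ n × Regs cnt n (reg s′) × Allocated m₀ cnt n (mem s′)))
      alloc-loop i₀ = weaken ≤-refl (λ { {s′} (≡0 , v , τ , i) → finish {v} {τ} {s′} ≡0 i }) (while-rule (Inv m₀) n (n * 85) bounded allocStep-rule i₀)
        where
        bounded : ∀ {v τ s} → Inv m₀ v τ s → τ ≤ n * 85
        bounded {v} {τ} {s} (invariant {cnt} v≤n τ≤ _ _ _ alloc) = ≤-trans τ≤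
          (≤-trans (+-mono-≤ (*-monoˡ-≤ 40 v≤n) (≤-trans (≤-reflexive (sym (*-assoc cnt L 15))) (*-monoˡ-≤ 15 (owned-length {m = mem s} (Allocated.owned alloc)))))
          (≤-reflexive (solve 1 (λ x → x :* con 40 :+ (x :+ x :+ x) :* con 15 := x :* con 85) refl n)))
        finish : ∀ {v τ s′} → reg s′ rgo′ ≡ 0 → Inv m₀ v τ s′ → ∃[ cnt ] (reg s′ rlim ≡ n × Regs cnt n (reg s′) × Allocated m₀ cnt n (mem s′))
        finish {v} ≡0 (invariant {cnt} v≤n _ lim≡ go≡ regs alloc) with ≤-antisym v≤n (bit-lt≡0 v n (trans (sym go≡) ≡0))
        ... | refl = cnt , lim≡ , regs , alloc

    alignStep-rule : ∀ {s cnt} → Levels K (mem s) → Filled C (AlignAt k) n (mem s) → Regs cnt n (reg s) → reg s rlim ≡ n →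
      reg s rdst ≡ chunk (suc k) →
      ⟪ fill alignStep ⟫ s (n * 16) (λ s′ → Outside (chunk (suc k)) n (mem s) (mem s′) ×
        Filled (chunk (suc k)) (AlignAt (suc k)) n (mem s′) × Regs cnt n (reg s′) × reg s′ rdst ≡ chunk (suc k) × reg s′ rlim ≡ n)
    alignStep-rule {s} {cnt} lv al regs@(c , _) lim≡ d≡ = weaken (fill-time 8) (λ h → h)
      (fill-rule (λ _ ρ → Regs cnt n ρ × ρ rdst ≡ chunk (suc k) × ρ rlim ≡ n) (AlignAt (suc k)) S<W chunk≤S (λ _ _ _ h → h) (λ _ _ _ _ _ h → h)
        compute d≡ lim≡ (Constants.one≡ c) (regs , d≡ , lim≡))
      where
      compute : ∀ {i s′} → i < n → Ctl (chunk (suc k)) n i (reg s′) → Regs cnt n (reg s′) × reg s′ rdst ≡ chunk (suc k) × reg s′ rlim ≡ n →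
        Outside (chunk (suc k)) n (mem s) (mem s′) → Filled (chunk (suc k)) (AlignAt (suc k)) i (mem s′) →
        ⟪ alignStep ⟫ s′ 8 (λ t → mem t ≡ mem s′ × Ctl (chunk (suc k)) n i (reg t) × (Regs cnt n (reg t) × reg t rdst ≡ chunk (suc k) × reg t rlim ≡ n) × AlignAt (suc k) i (reg t rval))
      compute {i} {s′} i< ct@(ctl i≡ _ _ _) r@((_ , ps , cs , _) , _) out _ = straight
        (_ , add= (ChunkValues.q≡ cs) i≡ (word (<⇒≤ C+i<S)) , _ , C+i<S , refl ,
         _ , add= (PointerValues.depths≡ ps) refl (inW (inD ≤-refl z<)) , _ , inS (inD ≤-refl z<) , depthAt lv′ z< ,
         _ , mod= {a = depth z} {b = 2 ^ suc k} {{m^n≢0 2 (suc k)}} refl (ChunkValues.double≡ cs) ,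
         (λ ≢0 → _ , add= (ChunkValues.p≡ cs) refl (inW (inJ k≤K z<)) , _ , inS (inJ k≤K z<) , at (Table.jump (lv′ k k≤K)) z< ,
                 refl , ct , r , aligned-double-up {{m^n≢0 2 (suc k)}} i< al-z ≢0) ,
         (λ ≡0 → refl , ct , r , aligned-double-here al-z (m%n≡0⇒n∣m (depth z) (2 ^ suc k) {{m^n≢0 2 (suc k)}} ≡0)))
        where
        z = mem s′ (C + i)
        thr0≤next : thr0 ≤ chunk (suc k)
        thr0≤next = ≤-trans (≤-trans (m≤m+n thr0 n) (m≤m+n lg0 n)) (m≤m+n chunk0 (base (suc k)))
        C+n≤ : C + n ≤ chunk (suc k)
        C+n≤ = ≤-trans (≤-trans (m≤m+n (C + n) n) (≤-trans (m≤m+n ptr0 n) (m≤m+n F _))) (≤-reflexive chunk-end)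
        lv′ : Levels K (mem s′)
        lv′ = levels-keep (below thr0≤next out) lv
        al-z : Aligned p i z
        al-z = at (keep C+n≤ (below ≤-refl out) al) i<
        z< : z < n
        z< = let b , _ , _ , z≡ , _ = al-z in subst (_< n) (sym z≡) (anc< b i<)
        C+i<S : C + i < S
        C+i<S = <-≤-trans (+-monoʳ-< C i<) (≤-trans C+n≤ (≤-trans (m≤m+n _ n) chunk≤S))

  ready-keep : ∀ {k v y m m′} → Below (chunk (suc k)) m m′ → Ready k v y m → Ready k v y m′
  ready-keep bel (ready al y≡ ins fl) = ready al y≡ ins (keep ins bel fl)

  Done : ℕ → (ℕ → ℕ) → Set
  Done k m = ∀ {j u} → j < k → u < n → 2 ^ j ≤ depth u → Ready j u (m (chunk j + n + n + u)) m

  record ChunkInv (k : ℕ) (s : State) : Set where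
    constructor chunkInv
    field
      k≤K      : k ≤ K
      go≡      : reg s rgo ≡ bit (base k <ᵇ base K)
      const≡   : Const (reg s)
      pointer≡ : Pointers (reg s)
      p≡       : reg s rp ≡ base k
      q≡       : reg s rq ≡ chunk k
      pw≡      : reg s rpw ≡ 2 ^ k
      levels   : Levels K (mem s)
      near     : Filled thr0 NearAt n (mem s)
      logs     : Filled lg0 LogAt n (mem s)
      aligned  : Filled (chunk k) (AlignAt k) n (mem s)
      done     : Done k (mem s)

  base-cancel-< : ∀ {j k} → base j < base k → j < k
  base-cancel-< {j} {k} = *-cancelʳ-< str j k

  chunk-mono : ∀ {j k} → j ≤ k → chunk j ≤ chunk k
  chunk-mono j≤k = +-monoʳ-≤ chunk0 (*-monoˡ-≤ str j≤k)

  chunkStep-rule : ∀ {k s} → ChunkInv k s → reg s rgo ≢ 0 → k < K × ⟪ chunkStep ⟫ s (n * 124) (ChunkInv (suc k))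
  chunkStep-rule {k} {s} (chunkInv k≤K go≡ c ps p≡ q≡ pw≡ lv near logs al done) ≢0 = k<K , weaken time (λ h → h)
    (straightThen (_ , add= q≡ (Constants.size≡ c) (word slot≤S) ,
     (fill-rule R (λ _ x → x ≡ 0) S<W ptr≤S (λ _ _ _ h → h) (λ _ _ _ _ _ h → h)
        (λ _ ct r _ _ → straight (word z≤n , refl , ct , r , refl)) refl (Constants.limit≡ c) (Constants.one≡ c) (c , ps , p≡ , q≡ , pw≡ , refl)
      andThen λ { {s₁} (out₁ , zeros , c , ps , p≡ , q≡ , pw≡ , slot≡) →
      straightThen (_ , add= slot≡ (Constants.size≡ c) (word ptr≤S) , _ , add= refl (Constants.size≡ c) (word F≤S) ,
        _ , trans (add= pw≡ pw≡ (subst (_< 2 ^ w) (sym double) (word double≤S))) double , _ , add= refl pw≡ (word L≤S) ,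
        word z≤n , _ , lt= refl (Constants.size≡ c) ,
      (Loop.alloc-loop (levels₁ out₁) (keep ≤-refl (below ≤-refl out₁) al)
         (invariant {cnt = 0} z≤n z≤n (Constants.limit≡ c) refl
           (constants (Constants.size≡ c) (Constants.one≡ c) (Constants.two≡ c) (Constants.root≡ c) (Constants.stride≡ c) refl , ps ,
            chunkValues p≡ q≡ pw≡ slot≡ refl refl refl , sym (+-identityʳ F) , refl)
           (allocated (λ _ _ → refl) (λ z< → inj₁ (at zeros z<)) (λ _ ()) (λ ())))
       andThen λ { {s₂} (cnt , lim≡ , regs@(c₂ , ps₂ , cs₂ , free≡₂ , v≡₂) , alloc) →
      straightThen (_ , trans (add= (Constants.stride≡ c₂) (ChunkValues.q≡ cs₂) (subst (_< 2 ^ w) (sym (chunk-suc k)) (word next≤S))) (chunk-suc k) ,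
      (alignStep-rule {cnt = cnt} (levels-keep (≤thr0 (Allocated.frame alloc)) (levels₁ out₁)) (keep ≤-refl (Allocated.frame alloc) (keep ≤-refl (below ≤-refl out₁) al)) regs lim≡ refl
       andThen λ { {s₃} (out₃ , al′ , (c₃ , ps₃ , cs₃ , free≡₃ , v≡₃) , d≡ , lim≡₃) →
      straight (_ , add= (Constants.stride≡ c₃) (ChunkValues.p≡ cs₃) (word (≤-trans (*-monoˡ-≤ str (m≤n⇒m≤1+n k<K)) thr0≤S)) ,
        _ , lt= refl (PointerValues.end≡ ps₃) ,
        (let all = λ {a} (a< : a < slot0) → frame out₁ (Allocated.frame alloc) out₃ a a< in
         chunkInv k<K refl
           (constants (Constants.size≡ c₃) (Constants.one≡ c₃) (Constants.two≡ c₃) (Constants.root≡ c₃) (Constants.stride≡ c₃) lim≡₃)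
           ps₃ refl d≡ (ChunkValues.double≡ cs₃)
           (levels-keep (λ a a< → all (<-≤-trans a< thr0≤slot0)) lv)
           (keep (≤-trans (m≤m+n lg0 n) chunk0≤slot0) (λ a a< → all a<) near)
           (keep chunk0≤slot0 (λ a a< → all a<) logs)
           al′ (done′ (λ a a< → all a<) alloc out₃))) })) })) })))
    where
    k<K : k < K
    k<K = base-cancel-< (bit-lt≢0 (base k) (base K) (λ e → ≢0 (trans go≡ e)))
    open Alloc k<K hiding (k≤K)
    next≤S : chunk (suc k) ≤ S
    next≤S = ≤-trans (m≤m+n _ n) chunk≤S
    ptr≤S : ptr0 ≤ S
    ptr≤S = ≤-trans (m≤m+n _ n) F≤S
    slot≤S : slot0 ≤ S
    slot≤S = ≤-trans (m≤m+n _ n) ptr≤S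
    double : p + p ≡ 2 ^ suc k
    double = cong (p +_) (sym (+-identityʳ p))
    L≤S : L ≤ S
    L≤S = ≤-trans (+-mono-≤ (≤-trans (≤-reflexive (sym double)) (+-mono-≤ p≤n p≤n)) p≤n)
            (≤-trans (m≤n+m (n + n + n) F) (≤-trans (≤-reflexive chunk-end) next≤S))
      where
      p≤n : p ≤ n
      p≤n = ≤-trans (^-monoʳ-≤ 2 (≤-pred (≤-trans k<K K≤))) lg-small
    double≤S : 2 ^ suc k ≤ S
    double≤S = ≤-trans (m≤m+n _ p) L≤S
    chunk0≤slot0 : chunk0 ≤ slot0
    chunk0≤slot0 = ≤-trans (m≤m+n chunk0 (base k)) (m≤m+n C n)
    thr0≤slot0 : thr0 ≤ slot0
    thr0≤slot0 = ≤-trans (≤-trans (m≤m+n thr0 n) (m≤m+n lg0 n)) chunk0≤slot0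
    slot0≤next : slot0 ≤ chunk (suc k)
    slot0≤next = ≤-trans (≤-trans (m≤m+n slot0 n) (≤-trans (m≤m+n ptr0 n) (m≤m+n F _))) (≤-reflexive chunk-end)
    ≤thr0 : ∀ {m m′} → Below slot0 m m′ → Below thr0 m m′
    ≤thr0 bel a a< = bel a (<-≤-trans a< thr0≤slot0)
    levels₁ : ∀ {m} → Outside slot0 n (mem s) m → Levels K m
    levels₁ out = levels-keep (below thr0≤slot0 out) lv
    frame : ∀ {m₁ m₂ m₃} → Outside slot0 n (mem s) m₁ → Below slot0 m₁ m₂ → Outside (chunk (suc k)) n m₂ m₃ → Below slot0 (mem s) m₃
    frame out₁ fr out₃ = below-trans (below ≤-refl out₁) (below-trans fr (below slot0≤next out₃))
    done′ : ∀ {m₁ m₂ m₃ cnt} → Below slot0 (mem s) m₃ → Allocated m₁ cnt n m₂ → Outside (chunk (suc k)) n m₂ m₃ → Done (suc k) m₃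
    done′ {m₁} {m₂} {m₃} bel alloc out₃ {j} {u} (s≤s j≤k) u< p≤ with m≤n⇒m<n∨m≡n j≤k
    ... | inj₁ j<k = subst (λ y → Ready j u y m₃) (sym (bel _ ptr<)) (ready-keep (λ a a< → bel a (<-≤-trans a< (≤-trans (chunk-mono j<k) (m≤m+n C n)))) (done j<k u< p≤))
      where
      ptr< : chunk j + n + n + u < slot0
      ptr< = <-≤-trans (+-monoʳ-< (chunk j + n + n) u<) (≤-trans (m≤m+n _ (n + n + n))
               (≤-trans (≤-reflexive (Alloc.chunk-end (<-trans j<k k<K))) (≤-trans (chunk-mono j<k) (m≤m+n C n))))
    ... | inj₂ refl = subst (λ y → Ready k u y m₃) (sym (out₃ _ (inj₁ ptr<))) (ready-keep (below ≤-refl out₃) (alloc-ready alloc u< p≤))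
      where
      ptr< : ptr0 + u < chunk (suc k)
      ptr< = <-≤-trans (+-monoʳ-< ptr0 u<) (≤-trans (m≤m+n F _) (≤-reflexive chunk-end))
    R : ℕ → (Reg → ℕ) → Set
    R _ ρ = Const ρ × Pointers ρ × ρ rp ≡ base k × ρ rq ≡ C × ρ rpw ≡ p × ρ rslot ≡ slot0
    time : 2 + ((2 + suc (n * suc (1 + 4))) + (6 + (suc (n * 85) + (1 + (n * 16 + 4))))) ≤ n * 124
    time = constant 2 ⊕ (fill-time 1 ⊕ (constant 6 ⊕ ((constant 1 ⊕ ≤-refl {n * 85}) ⊕ (constant 1 ⊕ (≤-refl {n * 16} ⊕ constant 4)))))

  record Prepared (m : ℕ → ℕ) : Set where
    constructor prepared
    field
      levels : Levels K m
      near   : Filled thr0 NearAt n m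
      logs   : Filled lg0 LogAt n m
      done   : Done K m

  chunks-rule : ∀ {s} → Searched s →
    ⟪ chunks ⟫ s (n * 14 + suc lg * (n * 125)) (λ s′ → Const (reg s′) × Pointers (reg s′) × Prepared (mem s′))
  chunks-rule {s} (searched c ps q≡ lv near logs) = weaken time (λ h → h)
    (straightThen {P = move rdst rq}
     ((fill-rule (λ _ ρ → Const ρ × Pointers ρ × ρ rq ≡ chunk0) (AlignAt 0) S<W (chunk0≤ z≤n) (λ _ _ _ h → h) (λ _ _ _ _ _ h → h)
        (λ { {i} _ ct@(ctl i≡ _ _ _) r _ _ → straight (refl , ct , r , subst (Aligned 1 i) (sym i≡) (aligned-self i)) })
        (trans q≡ (sym (+-identityʳ chunk0))) (Constants.limit≡ c) (Constants.one≡ c) (c , ps , q≡))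
      andThen λ { (out , al , c , ps , q≡) →
      straightThen (word z≤n , word (≤-trans (s≤s z≤n) 2≤S) , _ , lt= refl (PointerValues.end≡ ps) ,
      (weaken (s≤s (*-monoˡ-≤ (suc (n * 124)) K≤)) (λ { {s′} (≡0 , k , i) → finish {s′} {k} ≡0 i })
        (for-rule ChunkInv K (n * 124) ChunkInv.k≤K chunkStep-rule
          (chunkInv z≤n refl c ps refl (trans q≡ (sym (+-identityʳ chunk0))) refl
            (levels-keep (below (≤-trans (≤-trans (m≤m+n thr0 n) (m≤m+n lg0 n)) chunk0≤chunk) out) lv)
            (keep (≤-trans (m≤m+n lg0 n) chunk0≤chunk) (below ≤-refl out) near) (keep chunk0≤chunk (below ≤-refl out) logs)
            al (λ ()))))) }))
    where
    chunk0≤chunk : chunk0 ≤ chunk 0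
    chunk0≤chunk = m≤m+n chunk0 (base 0)
    finish : ∀ {s′ k} → reg s′ rgo ≡ 0 → ChunkInv k s′ → Const (reg s′) × Pointers (reg s′) × Prepared (mem s′)
    finish {s′} {k} ≡0 (chunkInv k≤K go≡ c ps _ _ _ lv near logs _ done) with m≤n⇒m<n∨m≡n k≤K
    ... | inj₂ refl = c , ps , prepared lv near logs done
    ... | inj₁ k<K  = ⊥-elim (<⇒≱ (*-monoˡ-< str {{>-nonZero (<-≤-trans 0<n (m≤m+n n _))}} k<K) (bit-lt≡0 (base k) (base K) (trans (sym go≡) ≡0)))
    time : 1 + ((2 + suc (n * suc (1 + 4))) + (3 + suc (suc lg * suc (n * 124)))) ≤ n * 14 + suc lg * (n * 125)
    time = ≤-trans (≤-reflexive (solve 2 (λ x y → con 1 :+ ((con 3 :+ x) :+ (con 4 :+ y)) := con 1 :+ (con 3 :+ x) :+ con 4 :+ y) refl (n * 6) (suc lg * suc (n * 124))))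
             (+-mono-≤ (constant 1 ⊕ fill-time 1 ⊕ constant 4) (*-monoʳ-≤ (suc lg) (constant 1 ⊕ ≤-refl {n * 124})))

-- Queries

module Answering (X : Setting) (B : TopLevel X) where
  open Context X
  open TopLevel B
  open Searching X B hiding (Regs)
  open Chunking X B
  open +-*-Solver using (solve; _:=_; _:+_; _:*_; con)

  Answer : ℕ → ℕ → ℕ → Set
  Answer v zero      x = x ≡ n
  Answer v d@(suc _) x = IsMin x v d

  Ready-state : State → Set
  Ready-state s = Const (reg s) × Pointers (reg s) × Prepared (mem s)

  -- The node `z` is `a` edges above `v` with `p ≤ a < 2 * p`, and `crossing` finds a lighter edge
  -- at distance at least `2 * p` below the upper end. So that end lies above `z`, and from
  -- `d < 4 * p` the index `d ∸ a` is less than `3 * p`, the length of the array.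
  answer-far : ∀ {v d k c e m y} → v < n → d ≤ depth v → k < K → d < 2 ^ suc (suc k) →
    IsMin e v (2 ^ suc k) → Smaller c e → depth (anc d v) < depth c → Ready k v y m →
    depth (anc d v) ≤ y × y ≤ S × y ∸ depth (anc d v) < S × IsMin (m (y ∸ depth (anc d v))) v d
  answer-far {v} {d} {k} {c} {e} {m} {y} v< d≤ k<K hi mine smaller far (ready {z} {x} (b , b<p , b≤ , z≡ , _) y≡ ins fl)
    with x₀ , m≤x₀ , x₀<d , _ ← crossing v< d≤ mine smaller far =
    ≤-trans (m≤n+m du (d ∸ a + x)) (≤-reflexive (sym y≡′)) ,
    ≤-trans (≤-reflexive (trans y≡ (+-comm (depth z) x))) (≤-trans (+-mono-≤ (≤-trans (m≤m+n x L) ins) (<⇒≤ (depth<size z<))) fits-chunk) ,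
    subst (_< S) (sym cell≡) (<-≤-trans (+-monoʳ-< x idx<) (≤-trans ins (≤-trans (m≤m+n _ n) fits-chunk))) ,
    min-above v< d≤ (<⇒≤ a<m) mine smaller far
      (subst₂ (λ g u → IsMin g u (d ∸ a)) (cong m (sym cell≡)) za (at fl idx< z≢))
    where
    p = 2 ^ k
    L = 2 ^ suc k + p
    a = b + p
    du = depth (anc d v)
    za : z ≡ anc a v
    za = trans z≡ (sym (anc-+ b p v))
    z< : z < n
    z< = subst (_< n) (sym za) (anc< a v<)
    fits-chunk : chunk (suc k) + n ≤ S
    fits-chunk = chunk0≤ (s≤s (<⇒≤ k<K))
    a<m : a < 2 ^ suc k
    a<m = <-≤-trans (+-monoˡ-< p b<p) (≤-reflexive (cong (p +_) (sym (+-identityʳ p))))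
    a<d : a < d
    a<d = <-trans (<-≤-trans a<m m≤x₀) x₀<d
    z≢ : z ≢ root
    z≢ e = anc≢root v< (<-≤-trans a<d d≤) (trans (sym za) e)
    dz≡ : depth z ≡ d ∸ a + du
    dz≡ = trans (cong depth za) (trans (depth-anc a v<) (trans (cong (_∸ a) (sym (m+[n∸m]≡n d≤)))
          (trans (+-∸-comm (depth v ∸ d) (<⇒≤ a<d)) (cong (d ∸ a +_) (sym (depth-anc d v<))))))
    y≡′ : y ≡ d ∸ a + x + du
    y≡′ = trans y≡ (trans (cong (_+ x) dz≡) (solve 3 (λ q u x → q :+ u :+ x := q :+ x :+ u) refl (d ∸ a) du x))
    cell≡ : y ∸ du ≡ x + (d ∸ a)
    cell≡ = trans (cong (_∸ du) y≡′) (trans (m+n∸n≡m (d ∸ a + x) du) (+-comm (d ∸ a) x))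
    idx< : d ∸ a < L
    idx< = subst (d ∸ a <_) (m+n∸m≡n a L) (∸-monoˡ-< (<-≤-trans hi four) (<⇒≤ a<d))
      where
      four : 2 ^ suc (suc k) ≤ a + L
      four = ≤-trans (m≤m+n _ b) (≤-reflexive (solve 2 (λ p b → con 2 :* (con 2 :* p) :+ b := b :+ p :+ (con 2 :* p :+ p)) refl p b))

  n≤S : n ≤ S
  n≤S = ≤-trans (m≤n+m n thr0) lg0≤S

  follow-rule : ∀ {s v d k e c} → v < n → d ≤ depth v → k < K → 2 ^ suc k ≤ d → d < 2 ^ suc (suc k) →
    IsMin e v (2 ^ suc k) → Smaller c e → depth (anc d v) < depth c →
    Ready-state s → reg s 0 ≡ v → reg s rx ≡ base (suc k) → reg s ru ≡ depth (anc d v) →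
    ⟪ follow ⟫ s 5 (λ s′ → IsMin (reg s′ 0) v d × Ready-state s′)
  follow-rule {s} {v} {d} {k} v< d≤ k<K lo hi mine small far rs@(_ , pointers _ _ _ _ bP≡ , prepared _ _ _ done) v≡ x≡ u≡ =
    let r = done k<K v< (≤-trans (≤-trans (m≤m+n _ _) lo) d≤)
        du≤y , y≤S , cell<S , answer = answer-far v< d≤ k<K hi mine small far r
    in straight (_ , add= bP≡ x≡ (word (≤-trans (m≤m+n _ v) (<⇒≤ addr<S))) ,
         _ , trans (add= refl v≡ (word (<⇒≤ addr<S))) addr≡ , _ , subst (_< S) addr≡ addr<S , refl ,
         _ , sub= refl u≡ du≤y (word y≤S) , _ , cell<S , refl , answer , rs)
    where
    addr≡ : base K + n + n + n + n + base (suc k) + v ≡ chunk k + n + n + v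
    addr≡ = solve 4 (λ bK x b v → bK :+ x :+ x :+ x :+ x :+ (con 6 :* x :+ b) :+ v := con 6 :* x :+ bK :+ x :+ x :+ b :+ x :+ x :+ v) refl (base K) n (base k) v
    addr<S : base K + n + n + n + n + base (suc k) + v < S
    addr<S = subst (_< S) (sym addr≡) (<-≤-trans (+-monoʳ-< (chunk k + n + n) v<) (Alloc.F≤S k<K))

  answer-rule : ∀ {s v d} → v < n → 0 < d → d ≤ depth v → Ready-state s → reg s 0 ≡ v → reg s rx ≡ d → reg s ru ≡ depth (anc d v) →
    ⟪ lookUp ⨾ ifnz re follow (move 0 rt) ⟫ s (8 + 6) (λ s′ → IsMin (reg s′ 0) v d × Ready-state s′)
  answer-rule {s} {v} {d} v< 0<d d≤ rs@(constants N≡ _ _ _ _ _ , pointers _ thr≡ lg≡ _ _ , prepared lv near logs _) v≡ x≡ u≡ =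
    straightThen
      (_ , add= lg≡ x≡ (word (<⇒≤ lg<S)) , _ , lg<S , j≡ ,
       _ , add= refl N≡ (word (≤-trans (room₁ j) (≤-trans (*-monoˡ-≤ str (s≤s j≤K)) thr0≤S))) ,
       _ , add= refl v≡ (inW (inM j≤K v<)) , _ , inS (inM j≤K v<) , refl ,
       _ , add= thr≡ refl (word (<⇒≤ thr<S)) , _ , thr<S , thr≡c ,
       _ , lt= {b = depth c} u≡ refl ,
       ifnz-rule (λ ≢0 → far j rs v≡ refl u≡ j≤K lo hi low-min (bit-lt≢0 du (depth c) ≢0))
                 (λ ≡0 → weaken (s≤s z≤n) (λ h → h) (straight
                    (min-below v< d≤ (m^n>0 2 j) lo low-min small (bit-lt≡0 du (depth c) ≡0) , rs))))
    where
    du = depth (anc d v)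
    d<n : d < n
    d<n = ≤-<-trans d≤ (depth<size v<)
    lg<S : lg0 + d < S
    lg<S = <-≤-trans (+-monoʳ-< lg0 d<n) chunk0≤S
    d≤K : d ≤ 2 ^ K
    d≤K = ≤-trans d≤ (deep v<)
    log : ∃[ j ] (2 ^ j ≤ d × d < 2 ^ suc j × mem s (lg0 + d) ≡ base j)
    log = at logs d<n 0<d d≤K
    j = proj₁ log
    lo = proj₁ (proj₂ log)
    hi = proj₁ (proj₂ (proj₂ log))
    j≡ = proj₂ (proj₂ (proj₂ log))
    j≤K : j ≤ K
    j≤K = log≤K {d} {j} lo d≤K
    low = mem s (base j + n + v)
    low-min : IsMin low v (2 ^ j)
    low-min = at (Table.low (lv j j≤K)) v< (depth>0⇒≢ (<-≤-trans 0<d d≤))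
    low< : low < n
    low< = proj₁ (isMin-edge v< low-min)
    thr<S : thr0 + low < S
    thr<S = <-≤-trans (+-monoʳ-< thr0 low<) lg0≤S
    smaller : ∃[ c ] (c < n × Smaller c low × mem s (thr0 + low) ≡ depth c)
    smaller = at near low< (proj₂ (isMin-edge v< low-min))
    c = proj₁ smaller
    small = proj₁ (proj₂ (proj₂ smaller))
    thr≡c = proj₂ (proj₂ (proj₂ smaller))
    far : ∀ j {s₁} → Ready-state s₁ → reg s₁ 0 ≡ v → reg s₁ rx ≡ base j → reg s₁ ru ≡ du → j ≤ K → 2 ^ j ≤ d → d < 2 ^ suc j → IsMin low v (2 ^ j) → du < depth c →
          ⟪ follow ⟫ s₁ 5 (λ s′ → IsMin (reg s′ 0) v d × Ready-state s′)
    -- For `j = 0` the path is a single edge and has no room for a lighter one; this is why the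
    -- pointers of chunk `k` serve the logarithm `suc k`.
    far zero _ _ _ _ _ _ hi mine du<dc with crossing v< d≤ mine small du<dc
    ... | x , 1≤x , x<d , _ = ⊥-elim (<⇒≱ hi (≤-trans (s≤s 1≤x) x<d))
    far (suc k) rs v≡ x≡j u≡ k<K lo hi mine du<dc = follow-rule v< d≤ k<K lo hi mine small du<dc rs v≡ x≡j u≡

  -- A query writes to scratch registers only, so the state it leaves is ready for the next one. The
  -- 20 steps are 5 for the distance, 1 for the test, 8 for the look-up and 6 for the second test
  -- with the longer branch.
  answering-rule : ∀ {s v d} → v < n → d ≤ depth v → Ready-state s → reg s 0 ≡ v → reg s 1 ≡ anc d v →
    ⟪ answering ⟫ s 20 (λ s′ → Answer v d (reg s′ 0) × Ready-state s′)
  answering-rule {s} {v} {d} v< d≤ rs@(constants N≡ _ _ _ _ _ , pointers D≡ _ _ _ _ , prepared lv _ _ _) v≡ u≡ = straightThen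
    (_ , add= D≡ v≡ (inW (inD ≤-refl v<)) , _ , inS (inD ≤-refl v<) , depthAt lv v< ,
     _ , add= D≡ u≡ (inW (inD ≤-refl u<)) , _ , inS (inD ≤-refl u<) , depthAt lv u< ,
     _ , trans (sub= {a = depth v} {b = du} refl refl du≤dv (word (≤-trans (<⇒≤ (depth<size v<)) n≤S))) d≡ ,
     ifnz-rule (λ ≢0 → weaken ≤-refl (λ { (answer , rs′) → found d ≢0 answer , rs′ })
                 (answer-rule v< (n≢0⇒n>0 ≢0) d≤ rs v≡ refl refl))
               (λ ≡0 → weaken (s≤s z≤n) (λ h → h) (straight (empty d ≡0 , rs))))
    where
    u< = anc< d v<
    du = depth (anc d v)
    du≤dv : du ≤ depth v
    du≤dv = ≤-trans (≤-reflexive (depth-anc d v<)) (m∸n≤m (depth v) d)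
    d≡ : depth v ∸ du ≡ d
    d≡ = trans (cong (depth v ∸_) (depth-anc d v<)) (m∸[m∸n]≡n d≤)
    empty : ∀ d → d ≡ 0 → Answer v d (reg s rN)
    empty zero _ = N≡
    found : ∀ d {x} → d ≢ 0 → IsMin x v d → Answer v d x
    found zero ≢0    = ⊥-elim (≢0 refl)
    found (suc _) _ h = h

-- Totals for space and preprocessing time

-- Abstract, as the type checker would otherwise unfold products with this literal.
abstract
  factor : ℕ
  factor = 485

  485≤factor : 485 ≤ factor
  485≤factor = ≤-refl

-- The extra 1 turns the non-strict lower bound on 2 ^ `w` in the theorem into the strict inequality
-- `fits`.
space-bound : ∀ n lg → 0 < n → 0 < lg → suc (space n lg) ≤ factor * (n * lg)
space-bound n lg 0<n 0<lg = begin
  suc (space n lg)        ≤⟨ +-mono-≤ 0<n (≤-reflexive (solve 2 (λ n l → (con 2 :+ l) :* (con 6 :* n) :+ n :+ n :+ (con 2 :+ l) :* (con 6 :* n) :+ n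
                                                            := con 27 :* n :+ con 12 :* (n :* l)) refl n lg)) ⟩
  n + (27 * n + 12 * (n * lg)) ≡⟨ solve 2 (λ n m → n :+ (con 27 :* n :+ con 12 :* m) := con 28 :* n :+ con 12 :* m) refl n (n * lg) ⟩
  28 * n + 12 * (n * lg)  ≤⟨ +-monoˡ-≤ (12 * (n * lg)) (*-monoʳ-≤ 28 (m≤m*n n lg {{>-nonZero 0<lg}})) ⟩
  28 * (n * lg) + 12 * (n * lg) ≡⟨ sym (*-distribʳ-+ (n * lg) 28 12) ⟩
  40 * (n * lg)           ≤⟨ *-monoˡ-≤ (n * lg) (≤-trans (m≤m+n 40 445) 485≤factor) ⟩
  factor * (n * lg)          ∎
  where
  open ≤-Reasoning
  open +-*-Solver using (solve; _:=_; _:+_; _:*_; con)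

module Preprocessing (X : Setting) where
  open Context X
  open Doubling X

  Prepared-state : State → Set
  Prepared-state s = ∃[ B ] Answering.Ready-state X B s

  -- The origin of 485: the part linear in `n` has coefficient 292 and is absorbed by `n * lg`,
  -- whose own coefficient is 193.
  time-bound : 0 < lg → n * 34 + suc lg * (n * 57) + (n * (40 + (2 + lg) * 11) + (n * 14 + suc lg * (n * 125))) ≤ factor * (n * lg)
  time-bound 0<lg = begin
    n * 34 + suc lg * (n * 57) + (n * (40 + (2 + lg) * 11) + (n * 14 + suc lg * (n * 125)))
      ≡⟨ solve 2 (λ n l → n :* con 34 :+ (con 1 :+ l) :* (n :* con 57) :+ (n :* (con 40 :+ (con 2 :+ l) :* con 11) :+ (n :* con 14 :+ (con 1 :+ l) :* (n :* con 125)))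
                    := con 292 :* n :+ con 193 :* (n :* l)) refl n lg ⟩
    292 * n + 193 * (n * lg)        ≤⟨ +-monoˡ-≤ (193 * (n * lg)) (*-monoʳ-≤ 292 (m≤m*n n lg {{>-nonZero 0<lg}})) ⟩
    292 * (n * lg) + 193 * (n * lg) ≡⟨ sym (*-distribʳ-+ (n * lg) 292 193) ⟩
    485 * (n * lg)                  ≤⟨ *-monoˡ-≤ (n * lg) 485≤factor ⟩
    factor * (n * lg)                  ∎
    where
    open ≤-Reasoning
    open +-*-Solver using (solve; _:=_; _:+_; _:*_; con)

  search-time≡ : ∀ x → 7 + (3 + suc (1 + suc (2 + (suc x + 2)) + 4) + (2 + (15 + 1))) ≡ 40 + x
  search-time≡ = solve 1 (λ x → con 7 :+ (con 4 :+ (con 1 :+ (con 1 :+ (con 2 :+ (con 1 :+ x :+ con 2))) :+ con 4) :+ con 18) := con 40 :+ x) refl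
    where open +-*-Solver using (solve; _:=_; _:+_; con)

  preprocessing-rule : ∀ {s} → 0 < lg → reg s 0 ≡ n → (∀ {v} → v < n → mem s v ≡ parent v) →
    ⟪ preprocessing ⟫ s (factor * (n * lg)) Prepared-state
  preprocessing-rule 0<lg n≡ parents = weaken (time-bound 0<lg) (λ h → h) (doubling-rule n≡ parents andThen λ { (doubled B c p≡ lv) →
      weaken (≤-reflexive (cong (n *_) (search-time≡ ((2 + lg) * 11)))) (λ h → h) (Searching.searching-rule X B c p≡ lv)
      andThen λ found → weaken ≤-refl (λ r → B , r) (Chunking.chunks-rule X B found) })

-- From rooted trees to weighted trees

2^⌊log₂n⌋≤n : ∀ n → 0 < n → 2 ^ ⌊log₂ n ⌋ ≤ n
2^⌊log₂n⌋≤n n = go n (<-wellFounded n)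
  where
  go : ∀ n → Acc _<_ n → 0 < n → 2 ^ ⌊log₂ n ⌋ ≤ n
  go (suc zero) _ _ = s≤s z≤n
  go m@(suc (suc n)) (acc rec) _ = begin
    2 ^ ⌊log₂ m ⌋             ≡⟨ cong (2 ^_) (sym (trans (cong suc (⌊log₂⌊n/2⌋⌋≡⌊log₂n⌋∸1 m)) (m+[n∸m]≡n (⌊log₂⌋-mono-≤ {2} {m} (s≤s (s≤s z≤n)))))) ⟩
    2 * 2 ^ ⌊log₂ ⌊ m /2⌋ ⌋   ≤⟨ *-monoʳ-≤ 2 (go ⌊ m /2⌋ (rec (⌊n/2⌋<n (suc n))) (s≤s z≤n)) ⟩
    2 * ⌊ m /2⌋               ≡⟨ cong (⌊ m /2⌋ +_) (+-identityʳ _) ⟩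
    ⌊ m /2⌋ + ⌊ m /2⌋         ≤⟨ +-monoʳ-≤ ⌊ m /2⌋ (⌊n/2⌋≤⌈n/2⌉ m) ⟩
    ⌊ m /2⌋ + ⌈ m /2⌉         ≡⟨ ⌊n/2⌋+⌈n/2⌉≡n m ⟩
    m                         ∎
    where open ≤-Reasoning

module Encoding {a ℓ₁ ℓ₂ : Level} (O : StrictTotalOrder a ℓ₁ ℓ₂) {n : ℕ} (T : RootedTree n)
                (value : Edge T → StrictTotalOrder.Carrier O) where
  open RootedTree T hiding (Edge; Query; height)
  open OracleModel O T value
  private module O = StrictTotalOrder O

  parentᴺ depthᴺ : ℕ → ℕ
  parentᴺ = mem (initial T)
  depthᴺ v with v <? n
  ... | yes v< = depth (fromℕ< v<)
  ... | no _   = 0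

  edgeAbove : Fin n → Maybe (Edge T)
  edgeAbove x with x Fin.≟ root
  ... | yes _ = nothing
  ... | no x≢ = just (edge x x≢)

  edgeOf : ℕ → Maybe (Edge T)
  edgeOf v with v <? n
  ... | no _   = nothing
  ... | yes v< = edgeAbove (fromℕ< v<)

  -- A missing edge counts as infinitely heavy.
  lighterᴹ : Maybe (Edge T) → Maybe (Edge T) → Bool
  lighterᴹ (just e) (just f) = less e f
  lighterᴹ (just _) nothing  = true
  lighterᴹ nothing  _        = false

  less-irrefl : ∀ e → less e e ≡ false
  less-irrefl e = dec-false (value e O.<? value e) (O.irrefl O.Eq.refl)

  less⇒< : ∀ {e f} → less e f ≡ true → value e O.< value f
  less⇒< {e} {f} h with value e O.<? value f
  ... | yes e<f = e<f

  ≮⇒¬< : ∀ {e f} → less e f ≡ false → ¬ (value e O.< value f)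
  ≮⇒¬< {e} {f} h e<f with trans (sym h) (dec-true (value e O.<? value f) e<f)
  ... | ()

  lighterᴹ-irrefl : ∀ x → lighterᴹ x x ≡ false
  lighterᴹ-irrefl (just e) = less-irrefl e
  lighterᴹ-irrefl nothing  = refl

  lighterᴹ-asym : ∀ x y → lighterᴹ x y ≡ true → lighterᴹ y x ≡ false
  lighterᴹ-asym (just e) (just f) e<f = dec-false (value f O.<? value e) (O.asym (less⇒< {e} {f} e<f))
  lighterᴹ-asym (just _) nothing _ = refl

  -- This is transitivity of ≤, with ≤ read as not being heavier; trichotomy between the middle
  -- value and the smallest one takes care of ties.
  ≮ᴹ-trans : ∀ x y z → lighterᴹ y x ≡ false → lighterᴹ z y ≡ false → lighterᴹ z x ≡ false
  ≮ᴹ-trans x y nothing _ _ = refl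
  ≮ᴹ-trans (just e) (just f) (just g) f≮e g≮f = dec-false (value g O.<? value e) contradiction
    where
    contradiction : ¬ (value g O.< value e)
    contradiction g<e with O.compare (value f) (value g)
    ... | tri< f<g _ _ = ≮⇒¬< {f} {e} f≮e (O.trans f<g g<e)
    ... | tri≈ _ f≈g _ = ≮⇒¬< {f} {e} f≮e (O.<-respˡ-≈ (O.Eq.sym f≈g) g<e)
    ... | tri> _ _ g<f = ≮⇒¬< {g} {f} g≮f g<f

  below-n : ∀ {p} (P : ℕ → Set p) → (∀ (x : Fin n) → P (toℕ x)) → ∀ {v} → v < n → P v
  below-n P h v< = subst P (Fin.toℕ-fromℕ< v<) (h (fromℕ< v<))

  parent-toℕ : ∀ x → parentᴺ (toℕ x) ≡ toℕ (parent x)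
  parent-toℕ x with toℕ x <? n
  ... | yes x< = cong (λ y → toℕ (parent y)) (Fin.fromℕ<-toℕ x x<)
  ... | no x≮  = ⊥-elim (x≮ (Fin.toℕ<n x))

  depth-toℕ : ∀ x → depthᴺ (toℕ x) ≡ depth x
  depth-toℕ x with toℕ x <? n
  ... | yes x< = cong depth (Fin.fromℕ<-toℕ x x<)
  ... | no x≮  = ⊥-elim (x≮ (Fin.toℕ<n x))

  edgeAbove-child : ∀ (e : Edge T) → edgeAbove (Edge.child e) ≡ just e
  edgeAbove-child (edge x x≢) with x Fin.≟ root
  ... | yes x≡ = ⊥-elim-irr (x≢ x≡)
  ... | no _   = refl

  edgeOf-toℕ : ∀ (e : Edge T) → edgeOf (edgeId e) ≡ just e
  edgeOf-toℕ e with edgeId e <? n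
  ... | no x≮  = ⊥-elim (x≮ (Fin.toℕ<n (Edge.child e)))
  ... | yes x< = trans (cong edgeAbove (Fin.fromℕ<-toℕ (Edge.child e) x<)) (edgeAbove-child e)

  edge-named : ∀ {v} → v < n → v ≢ toℕ root → ∃[ e ] (edgeId e ≡ v)
  edge-named v< v≢ = edge (fromℕ< v<) (λ e → v≢ (trans (sym (Fin.toℕ-fromℕ< v<)) (cong toℕ e))) , Fin.toℕ-fromℕ< v<

  -- Depths are read off the given paths `toRoot`, which need not extend one another; uniqueness of
  -- the length relates the depth of a node to that of its parent.
  pathLength-unique : ∀ {v} (p q : Path v root) → pathLength p ≡ pathLength q
  pathLength-unique []      []       = refl
  pathLength-unique []      (v≢ ∷ _) = ⊥-elim (v≢ refl)
  pathLength-unique (v≢ ∷ _) []      = ⊥-elim (v≢ refl)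
  pathLength-unique (_ ∷ p) (_ ∷ q)  = cong suc (pathLength-unique p q)

  depth-step′ : ∀ x → x ≢ root → depth x ≡ suc (depth (parent x))
  depth-step′ x x≢ = pathLength-unique (toRoot x) (x≢ ∷ toRoot (parent x))

  weighted : WeightedTree
  weighted = record
    { size        = n
    ; root        = toℕ root
    ; parent      = parentᴺ
    ; depth       = depthᴺ
    ; lighter     = λ x y → lighterᴹ (edgeOf x) (edgeOf y)
    ; root<size   = Fin.toℕ<n root
    ; parent<     = below-n (λ v → parentᴺ v < n) (λ x → subst (_< n) (sym (parent-toℕ x)) (Fin.toℕ<n (parent x)))
    ; parent-root = trans (parent-toℕ root) (cong toℕ parent-root)
    ; parent-fix  = below-n (λ v → parentᴺ v ≡ v → v ≡ toℕ root) (λ x fix → cong toℕ (fixed x (Fin.toℕ-injective (trans (sym (parent-toℕ x)) fix))))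
    ; depth-root  = trans (depth-toℕ root) (pathLength-unique (toRoot root) [])
    ; depth-step  = λ {v} → below-n (λ v → v ≢ toℕ root → depthᴺ v ≡ suc (depthᴺ (parentᴺ v)))
                      (λ x x≢ → trans (depth-toℕ x) (trans (depth-step′ x (λ e → x≢ (cong toℕ e)))
                        (cong suc (sym (trans (cong depthᴺ (parent-toℕ x)) (depth-toℕ (parent x))))))) {v}
    ; lighter-irrefl = λ x → lighterᴹ-irrefl (edgeOf x)
    ; lighter-asym   = λ {x} {y} → lighterᴹ-asym (edgeOf x) (edgeOf y)
    ; ≮-trans        = λ {x} {y} {z} → ≮ᴹ-trans (edgeOf x) (edgeOf y) (edgeOf z)
    }
    where
    fixed : ∀ x → parent x ≡ x → x ≡ root
    fixed x fix with x Fin.≟ root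
    ... | yes x≡ = x≡
    -- A fixed point other than the root would be one deeper than itself.
    ... | no x≢  = ⊥-elim (1+n≢n (sym (trans (depth-step′ x x≢) (cong (λ y → suc (depth y)) fix))))

  open TreeTheory weighted using (anc; anc-parent; depth<size; IsMin; isMin-edge)

  path-anc : ∀ {v u} (p : Path v u) → anc (pathLength p) (toℕ v) ≡ toℕ u
  path-anc [] = refl
  path-anc (_∷_ {v} _ p) = trans (sym (anc-parent (pathLength p) (toℕ v))) (trans (cong (anc (pathLength p)) (parent-toℕ v)) (path-anc p))

  path≤depth : ∀ {v u} (p : Path v u) → pathLength p ≤ depth v
  path≤depth [] = z≤n
  path≤depth (_∷_ {v} v≢ p) = ≤-trans (s≤s (path≤depth p)) (≤-reflexive (sym (depth-step′ v v≢)))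

  edges⇒anc : ∀ {v u} (p : Path v u) {f} → f ∈ edges p → ∃[ j ] (j < pathLength p × edgeId f ≡ anc j (toℕ v))
  edges⇒anc (_ ∷ p) (here refl) = 0 , s≤s z≤n , refl
  edges⇒anc (_∷_ {v} _ p) (there f∈) = let j , j< , f≡ = edges⇒anc p f∈ in
    suc j , s≤s j< , trans f≡ (trans (cong (anc j) (sym (parent-toℕ v))) (anc-parent j (toℕ v)))

  anc⇒edges : ∀ {v u} (p : Path v u) {f} j → j < pathLength p → edgeId f ≡ anc j (toℕ v) → f ∈ edges p
  anc⇒edges (_ ∷ p) zero _ f≡ with Fin.toℕ-injective f≡
  ... | refl = here refl
  anc⇒edges (_∷_ {v} _ p) (suc j) (s≤s j<) f≡ =
    there (anc⇒edges p j j< (trans f≡ (trans (sym (anc-parent j (toℕ v))) (cong (anc j) (parent-toℕ v)))))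

  depth≤height : ∀ {v} → v < n → depthᴺ v ≤ height T
  depth≤height = below-n (λ v → depthᴺ v ≤ height T) λ x → ≤-trans (≤-reflexive (depth-toℕ x))
    (all-lookup (xs≤max 0 (map depth (allFin n))) (∈-map⁺ depth (∈-allFin x)))

  height≤n : height T ≤ n
  height≤n = max≤v⁺ {xs = map depth (allFin n)} z≤n (all-tabulate λ d∈ → let x , _ , d≡ = ∈-map⁻ depth d∈ in
    ≤-trans (≤-reflexive (trans d≡ (sym (depth-toℕ x)))) (<⇒≤ (depth<size (Fin.toℕ<n x))))

  module _ (2≤h : 2 ≤ height T) (w : ℕ) (large : factor * (n * ⌊log₂ height T ⌋) ≤ 2 ^ w) where
    0<n : 0 < n
    0<n = m<n⇒0<n (Fin.toℕ<n root)

    -- Height at least 2 makes the logarithm positive, so that terms linear in `n` are absorbed by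
    -- `n * lg`.
    0<log : 0 < ⌊log₂ height T ⌋
    0<log = ⌊log₂⌋-mono-≤ 2≤h

    setting : Setting
    setting = record
      { tree     = weighted
      ; lg       = ⌊log₂ height T ⌋
      ; w        = w
      ; lg-max   = λ k v< lt → ≤-trans (≤-reflexive (sym (⌊log₂[2^n]⌋≡n k))) (⌊log₂⌋-mono-≤ (≤-trans (<⇒≤ lt) (depth≤height v<)))
      ; lg-small = ≤-trans (2^⌊log₂n⌋≤n (height T) (<⇒≤ 2≤h)) height≤n
      ; fits     = ≤-trans (space-bound n ⌊log₂ height T ⌋ 0<n 0<log) large
      ; E        = Edge T
      ; ident    = edgeId
      ; edgeLess = less
      ; edges    = λ (x< , x≢) (y< , y≢) → named (edge-named x< x≢) (edge-named y< y≢)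
      }
      where
      named : ∀ {x y} → ∃[ e ] (edgeId e ≡ x) → ∃[ f ] (edgeId f ≡ y) →
              ∃[ e ] ∃[ f ] (x ≡ edgeId e × y ≡ edgeId f × less e f ≡ lighterᴹ (edgeOf x) (edgeOf y))
      named (e , refl) (f , refl) = e , f , refl , refl , sym (cong₂ lighterᴹ (edgeOf-toℕ e) (edgeOf-toℕ f))

    open Context setting using (S)
    open Preprocessing setting
    private module H = Hoare w S edgeId less

    correct : ∀ {v u} (p : Path v u) {B} {x} → Answering.Answer setting B (toℕ v) (pathLength p) x →
              ∃[ ans ] (x ≡ encode ans × Correct p ans)
    correct [] x≡ = nothing , x≡ , empty
    correct {v} q@(v≢ ∷ p) {x = x} mine@((j , j<d , j≤ , x≡) , low) =
      let x< , x≢ = isMin-edge (Fin.toℕ<n v) mine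
          e , e≡ = edge-named x< x≢
      in just e , sym e≡ , minimum (anc⇒edges q j (s≤s j≤) (trans e≡ x≡) , λ f f∈ →
           let i , i< , f≡ = edges⇒anc q f∈
           in ≮⇒¬< {f} {e} (trans (sym (trans (cong₂ lighterᴹ (cong edgeOf (sym f≡)) (cong edgeOf (sym e≡)))
                                            (cong₂ lighterᴹ (edgeOf-toℕ f) (edgeOf-toℕ e))))
                         (low i i< (≤-trans i< (≤-trans (path≤depth q) (≤-reflexive (sym (depth-toℕ v))))))))

    answers : ∀ {B} {s} → Answering.Ready-state setting B s → ∀ qs → AnswersAll w S factor answering s qs
    answers r [] = lift tt
    answers {B} {s} r (q ∷ qs) = reply
      (Answering.answering-rule setting B {s = pose q s} (Fin.toℕ<n leaf)
        (≤-trans (path≤depth path) (≤-reflexive (sym (depth-toℕ leaf)))) r refl (sym (path-anc path)))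
      where
      open Query q
      reply : H.⟪ answering ⟫ (pose q s) 20 (λ s′ → Answering.Answer setting B (toℕ leaf) (pathLength path) (reg s′ 0) × Answering.Ready-state setting B s′) →
              AnswersAll w S factor answering s (q ∷ qs)
      reply (H.halts {s′} {t} {o} run t≤ (answer , r′)) =
        let ans , ans≡ , cor = correct path {B} answer
        in s′ , t , ans , subst (Machine.Run w S edgeId less answering (pose q s) s′ t) (H.noOracle-calls refl run) run ,
           ≤-trans t≤ (≤-trans (m≤m+n 20 465) 485≤factor) , ans≡ , cor , answers {B} r′ qs

    bound : ℕ
    bound = factor * (n * ⌊log₂ height T ⌋)

    Built : Set _
    Built = ∃[ S ] ∃[ s ] ∃[ t ] ∃[ o ]
      S ≤ bound × t ≤ bound × o ≤ bound ×
      RAM.Run w S preprocessing (initial T) s t o × (∀ qs → AnswersAll w S factor answering s qs)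

    finished : H.⟪ preprocessing ⟫ (initial T) bound Prepared-state → Built
    finished (H.halts {s} {t} {o} run t≤ (B , r)) =
      S , s , t , o , <⇒≤ (space-bound n ⌊log₂ height T ⌋ 0<n 0<log) , t≤ , ≤-trans (H.calls≤time run) t≤ , run , answers {B} r

    prepare : H.⟪ preprocessing ⟫ (initial T) bound Prepared-state
    prepare = preprocessing-rule {initial T} 0<log refl (λ _ → refl)

    built : Built
    built = finished prepare

mainTheorem1 : ∀ {a ℓ₁ ℓ₂ : Level} →
    ∃[ D ] ∃[ c ]
    (∀ (n : ℕ) (T : RootedTree n) → 2 ≤ height T →
    ∀ (O : StrictTotalOrder a ℓ₁ ℓ₂) (value : Edge T → StrictTotalOrder.Carrier O) →
    ∀ (w : ℕ) → n < 2 ^ w → c * (n * ⌊log₂ height T ⌋) ≤ 2 ^ w →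
    ∃[ S ] ∃[ s ] ∃[ t ] ∃[ o ]
    S ≤ c * (n * ⌊log₂ height T ⌋) ×
    t ≤ c * (n * ⌊log₂ height T ⌋) ×
    o ≤ c * (n * ⌊log₂ height T ⌋) ×
    OracleModel.RAM.Run O T value w S (DataStructure.preprocess D) (initial T) s t o ×
    (∀ (qs : List (Query T)) →
    OracleModel.AnswersAll O T value w S c (DataStructure.query D) s qs))
mainTheorem1 = record { preprocess = preprocessing ; query = answering } , factor ,
  λ n T 2≤h O value w _ large → Encoding.built O T value 2≤h w large
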